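{- There is an absolute constant $C>0$ such that for every $n\ge2$ and every $\varepsilon\in(0,1)$ there is a non-adaptive convexity tester (with parameter $\varepsilon$) with one-sided error for sets in $\{0,\pm1\}^n$ that has query complexity at most $3^{C\sqrt{n\ln(1/\varepsilon)}\,\ln n}$ (that is, $3^{\widetilde O(\sqrt{n\ln 1/\varepsilon})}$ where $\widetilde O$ hides an extra $\ln n$ factor).
   Context: A set $S\subseteq\{0,\pm1\}^n$ is convex if $S=\mathrm{Conv}(S)\cap\{0,\pm1\}^n$, where $\mathrm{Conv}(S)\subseteq\mathbb{R}^n$ is the convex hull. For $S,T\subseteq\{0,\pm1\}^n$, $\mathrm{dist}(S,T)=|S\,\Delta\,T|/3^n$; $S$ is $\varepsilon$-far from convex if $\mathrm{dist}(S,T)\ge\varepsilon$ for every convex $T\subseteq\{0,\pm1\}^n$. A convexity tester with one-sided error and parameter $\varepsilon$ is a randomized algorithm with membership-oracle access to an unknown $S\subseteq\{0,\pm1\}^n$ that accepts with probability $1$ if $S$ is convex, and rejects with probability at least $2/3$ if $S$ is $\varepsilon$-far from convex. It is non-adaptive if it chooses its set of queries before receiving the answers to any of the queries. The query complexity is the number of membership queries made. -}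

module Defs where

open import Algebra.Bundles using (CommutativeRing)
import Algebra.Properties.CommutativeSemiring.Exp as Exp
open import Data.Bool.Base using (Bool; if_then_else_; not; _xor_; T)
open import Data.Fin.Base as Fin using (Fin)
open import Data.Integer.Base as ℤ using (+_)
import Data.Integer.Properties as ℤ
open import Data.List.Base using (List; []; _∷_; length; filterᵇ; cartesianProductWith)
open import Data.Nat.Base as ℕ using (ℕ; zero; suc)
import Data.Nat.Properties as ℕ
open import Data.Product.Base using (Σ; ∃; ∃-syntax; _×_; _,_; proj₁; proj₂)
open import Data.Rational.Base
  using (ℚ; mkℚ; 0ℚ; 1ℚ; ½; _+_; _*_; -_; _-_; _≤_; _<_; 1/_; ∣_∣; _/_; positive; nonNegative;
         toℚᵘ)
open import Data.Rational.Properties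
open import Data.Rational.Solver using (module +-*-Solver)
open import Data.Rational.Unnormalised.Base as ℚᵘ using (*≡*)
import Data.Rational.Unnormalised.Properties as ℚᵘ
open import Data.Sum.Base using (_⊎_; inj₁; inj₂; [_,_]′)
open import Data.Vec.Base as Vec using (Vec; []; _∷_)
import Data.Vec.Functional as Vector
open import Function.Base using (_∘_)
open import Function.Bundles using (_⇔_)
open import Relation.Binary.PropositionalEquality.Core using (_≡_; refl; sym; trans; cong; cong₂; subst; subst₂)
open import Relation.Nullary.Decidable.Core using (Dec; yes; no)
open import Relation.Nullary.Negation.Core using (¬_)

open +-*-Solver using (solve; _:=_; _:+_; _:*_; _:-_; :-_; con)
open Exp (CommutativeRing.commutativeSemiring +-*-commutativeRing)
  using (_^_; ^-distrib-*; ^-assocʳ; ^-congʳ)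

⅓ : ℚ
⅓ = + 1 / 3

<-by : ∀ {p q} d → 0ℚ < d → q ≡ p + d → p < q
<-by {p} d 0<d refl = subst (_< p + d) (+-identityʳ p) (+-monoʳ-< p 0<d)

≤-by : ∀ {p q} d → 0ℚ ≤ d → q ≡ p + d → p ≤ q
≤-by {p} d 0≤d refl = subst (_≤ p + d) (+-identityʳ p) (+-monoʳ-≤ p 0≤d)

<⇒0< : ∀ {p q} → p < q → 0ℚ < q - p
<⇒0< {p} {q} p<q = subst (_< q - p) (+-inverseʳ p) (+-monoˡ-< (- p) p<q)

≤⇒0≤ : ∀ {p q} → p ≤ q → 0ℚ ≤ q - p
≤⇒0≤ {p} {q} p≤q = subst (_≤ q - p) (+-inverseʳ p) (+-monoˡ-≤ (- p) p≤q)

0<p+q : ∀ {p q} → 0ℚ < p → 0ℚ < q → 0ℚ < p + q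
0<p+q = +-mono-<

0<p+q′ : ∀ {p q} → 0ℚ < p → 0ℚ ≤ q → 0ℚ < p + q
0<p+q′ = +-mono-<-≤

0≤p+q : ∀ {p q} → 0ℚ ≤ p → 0ℚ ≤ q → 0ℚ ≤ p + q
0≤p+q = +-mono-≤

0<p*q : ∀ {p q} → 0ℚ < p → 0ℚ < q → 0ℚ < p * q
0<p*q {p} {q} 0<p 0<q = positive⁻¹ (p * q) {{pos*pos⇒pos p {{positive 0<p}} q {{positive 0<q}}}}

0≤p*q : ∀ {p q} → 0ℚ ≤ p → 0ℚ ≤ q → 0ℚ ≤ p * q
0≤p*q {p} {q} 0≤p 0≤q =
  nonNegative⁻¹ (p * q) {{nonNeg*nonNeg⇒nonNeg p {{nonNegative 0≤p}} q {{nonNegative 0≤q}}}}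

0<½ : 0ℚ < ½
0<½ = positive⁻¹ ½

0<⅓ : 0ℚ < ⅓
0<⅓ = positive⁻¹ ⅓

0<1 : 0ℚ < 1ℚ
0<1 = positive⁻¹ 1ℚ

*-mono-≤′ : ∀ {p q r s} → 0ℚ ≤ p → 0ℚ ≤ r → p ≤ q → r ≤ s → p * r ≤ q * s
*-mono-≤′ {p} {q} {r} {s} 0≤p 0≤r p≤q r≤s =
  ≤-by ((q - p) * r + q * (s - r))
       (0≤p+q (0≤p*q (≤⇒0≤ p≤q) 0≤r) (0≤p*q (≤-trans 0≤p p≤q) (≤⇒0≤ r≤s)))
       (solve 4 (λ p q r s → q :* s := p :* r :+ ((q :- p) :* r :+ q :* (s :- r))) refl p q r s)

module _ {p : ℚ} (0<p : 0ℚ < p) where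

  inv : ℚ
  inv = (1/ p) {{pos⇒nonZero p {{positive 0<p}}}}

  *-inv : p * inv ≡ 1ℚ
  *-inv = *-inverseʳ p {{pos⇒nonZero p {{positive 0<p}}}}

  0<inv : 0ℚ < inv
  0<inv = positive⁻¹ inv {{1/pos⇒pos p {{positive 0<p}}}}

ι : ℕ → ℚ
ι n = + n / 1

ι-suc : ∀ n → ι (suc n) ≡ 1ℚ + ι n
ι-suc n = toℚᵘ-injective (ℚᵘ.≃-trans (toℚᵘ-fromℚᵘ (ℚᵘ.mkℚᵘ (+ suc n) 0))
  (ℚᵘ.≃-trans (*≡* (cong (ℤ._* (+ 1)) (sym (trans (cong₂ ℤ._+_ (ℤ.*-identityʳ (+ 1)) (ℤ.*-identityʳ (+ n))) refl))))
  (ℚᵘ.≃-trans (ℚᵘ.+-congʳ (toℚᵘ 1ℚ) (ℚᵘ.≃-sym (toℚᵘ-fromℚᵘ (ℚᵘ.mkℚᵘ (+ n) 0))))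
  (ℚᵘ.≃-sym (toℚᵘ-homo-+ 1ℚ (ι n))))))

0≤ι : ∀ n → 0ℚ ≤ ι n
0≤ι zero    = ≤-refl
0≤ι (suc n) = subst (0ℚ ≤_) (sym (ι-suc n)) (0≤p+q (<⇒≤ 0<1) (0≤ι n))

0<ι : ∀ n → 0ℚ < ι (suc n)
0<ι n = subst (0ℚ <_) (sym (ι-suc n)) (0<p+q′ 0<1 (0≤ι n))

ι-mono : ∀ {m n} → m ℕ.≤ n → ι m ≤ ι n
ι-mono {n = n} ℕ.z≤n = 0≤ι n
ι-mono {suc m} {suc n} (ℕ.s≤s m≤n) =
  subst₂ _≤_ (sym (ι-suc m)) (sym (ι-suc n)) (+-monoʳ-≤ 1ℚ (ι-mono m≤n))

archimedean : ∀ q → ∃[ n ] q < ι n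
archimedean q@(mkℚ (+ k) d c) = suc k , ≤-<-trans q≤ιk (<-by 1ℚ 0<1 (trans (ι-suc k) (+-comm 1ℚ (ι k))))
  where
  q≤ιk : q ≤ ι k
  q≤ιk = toℚᵘ-cancel-≤ (ℚᵘ.≤-respʳ-≃ (ℚᵘ.≃-sym (toℚᵘ-fromℚᵘ (ℚᵘ.mkℚᵘ (+ k) 0)))
    (ℚᵘ.*≤* (ℤ.*-monoˡ-≤-nonNeg (+ k) (ℤ.+≤+ (ℕ.s≤s ℕ.z≤n)))))
archimedean q@(mkℚ ℤ.-[1+ k ] d c) = 1 , <-trans (negative⁻¹ q) 0<1

abs-split : ∀ {p q ε} → ∣ p - q ∣ < ε → p < q + ε × q < p + ε
abs-split {p} {q} {ε} h = p<q+ε , q<p+ε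
  where
  x≤∣x∣ : ∀ x → x ≤ ∣ x ∣
  x≤∣x∣ x with ≤-total 0ℚ x
  ... | inj₁ 0≤x = ≤-reflexive (sym (0≤p⇒∣p∣≡p 0≤x))
  ... | inj₂ x≤0 = ≤-trans x≤0 (0≤∣p∣ x)
  p<q+ε : p < q + ε
  p<q+ε = <-by (ε - (p - q)) (<⇒0< (≤-<-trans (x≤∣x∣ (p - q)) h))
    (solve 3 (λ p q ε → q :+ ε := p :+ (ε :- (p :- q))) refl p q ε)
  q<p+ε : q < p + ε
  q<p+ε = <-by (ε - (- (p - q)))
    (<⇒0< (≤-<-trans (subst (- (p - q) ≤_) (∣-p∣≡∣p∣ (p - q)) (x≤∣x∣ (- (p - q)))) h))
    (solve 3 (λ p q ε → p :+ ε := q :+ (ε :- (:- (p :- q)))) refl p q ε)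

abs-join : ∀ {p q ε} → p < q + ε → q < p + ε → ∣ p - q ∣ < ε
abs-join {p} {q} {ε} p<q+ε q<p+ε with ∣p∣≡p∨∣p∣≡-p (p - q)
... | inj₁ eq = subst (_< ε) (sym eq) (<-by (q + ε - p) (<⇒0< p<q+ε)
                  (solve 3 (λ p q ε → ε := (p :- q) :+ (q :+ ε :- p)) refl p q ε))
... | inj₂ eq = subst (_< ε) (sym eq) (<-by (p + ε - q) (<⇒0< q<p+ε)
                  (solve 3 (λ p q ε → ε := :- (p :- q) :+ (p :+ ε :- q)) refl p q ε))

half : ∀ ε → ½ * ε + ½ * ε ≡ ε
half ε = trans (sym (*-distribʳ-+ ε ½ ½)) (*-identityˡ ε)

0<half : ∀ {ε} → 0ℚ < ε → 0ℚ < ½ * ε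
0<half = 0<p*q 0<½

half< : ∀ {ε} → 0ℚ < ε → ½ * ε < ε
half< {ε} 0<ε = <-by (½ * ε) (0<half 0<ε) (sym (half ε))

IsCauchy : (ℕ → ℚ) → Set
IsCauchy s = ∀ ε → 0ℚ < ε → ∃[ N ] ∀ m n → N ℕ.≤ m → N ℕ.≤ n → ∣ s m - s n ∣ < ε

record ℝ : Set where
  constructor mkℝ
  field
    seq    : ℕ → ℚ
    cauchy : IsCauchy seq

open ℝ public

infix  4 _<ᴿ_ _≤ᴿ_ _≃ᴿ_
infixl 6 _+ᴿ_
infixl 7 _*ᴿ_

record _<ᴿ_ (x y : ℝ) : Set where
  constructor lt
  field
    gap         : ℚ
    0<gap       : 0ℚ < gap
    start       : ℕ
    holds-after : ∀ n → start ℕ.≤ n → seq x n + gap ≤ seq y n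

_≤ᴿ_ : ℝ → ℝ → Set
x ≤ᴿ y = ¬ (y <ᴿ x)

_≃ᴿ_ : ℝ → ℝ → Set
x ≃ᴿ y = x ≤ᴿ y × y ≤ᴿ x

fromℚ : ℚ → ℝ
fromℚ q = mkℝ (λ _ → q) λ ε 0<ε → 0 , λ _ _ _ _ → subst (λ d → ∣ d ∣ < ε) (sym (+-inverseʳ q)) 0<ε

fromℕ : ℕ → ℝ
fromℕ n = fromℚ (ι n)

0ᴿ 1ᴿ : ℝ
0ᴿ = fromℚ 0ℚ
1ᴿ = fromℚ 1ℚ

abstract

  +-cauchy : ∀ x y → IsCauchy (λ n → seq x n + seq y n)
  +-cauchy x y ε 0<ε =
    let (M , x-close) = cauchy x (½ * ε) (0<half 0<ε)
        (N , y-close) = cauchy y (½ * ε) (0<half 0<ε)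
    in M ℕ.⊔ N , λ m n N≤m N≤n →
      ≤-<-trans
        (subst (λ d → ∣ d ∣ ≤ ∣ seq x m - seq x n ∣ + ∣ seq y m - seq y n ∣)
          (solve 4 (λ a b c d → (a :- b) :+ (c :- d) := (a :+ c) :- (b :+ d)) refl
            (seq x m) (seq x n) (seq y m) (seq y n))
          (∣p+q∣≤∣p∣+∣q∣ (seq x m - seq x n) (seq y m - seq y n)))
        (subst (∣ seq x m - seq x n ∣ + ∣ seq y m - seq y n ∣ <_) (half ε)
          (+-mono-< (x-close m n (ℕ.m⊔n≤o⇒m≤o M N N≤m) (ℕ.m⊔n≤o⇒m≤o M N N≤n))
                    (y-close m n (ℕ.m⊔n≤o⇒n≤o M N N≤m) (ℕ.m⊔n≤o⇒n≤o M N N≤n))))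

_+ᴿ_ : ℝ → ℝ → ℝ
x +ᴿ y = mkℝ (λ n → seq x n + seq y n) (+-cauchy x y)

bounded : ∀ x → ∃[ B ] 0ℚ < B × ∃[ N ] ∀ n → N ℕ.≤ n → ∣ seq x n ∣ ≤ B
bounded x with cauchy x 1ℚ 0<1
... | N , close = ∣ seq x N ∣ + 1ℚ , subst (0ℚ <_) (+-comm 1ℚ ∣ seq x N ∣) (0<p+q′ 0<1 (0≤∣p∣ (seq x N))) , N , λ n N≤n →
  ≤-trans
    (subst (λ d → ∣ d ∣ ≤ ∣ seq x N ∣ + ∣ seq x n - seq x N ∣)
      (solve 2 (λ a b → a :+ (b :- a) := b) refl (seq x N) (seq x n))
      (∣p+q∣≤∣p∣+∣q∣ (seq x N) (seq x n - seq x N)))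
    (+-monoʳ-≤ ∣ seq x N ∣ (<⇒≤ (close n N N≤n ℕ.≤-refl)))

inv-cancel : ∀ {C} (0<C : 0ℚ < C) δ → C * (inv 0<C * δ) ≡ δ
inv-cancel {C} 0<C δ =
  trans (sym (*-assoc C (inv 0<C) δ)) (trans (cong (_* δ) (*-inv 0<C)) (*-identityˡ δ))

*-shrink : ∀ {C c d δ} (0<C : 0ℚ < C) → ∣ c ∣ ≤ C → ∣ d ∣ < inv 0<C * δ → ∣ c * d ∣ < δ
*-shrink {C} {c} {d} {δ} 0<C c≤C d< = begin-strict
  ∣ c * d ∣         ≡⟨ ∣p*q∣≡∣p∣*∣q∣ c d ⟩
  ∣ c ∣ * ∣ d ∣     ≤⟨ *-mono-≤′ (0≤∣p∣ c) (0≤∣p∣ d) c≤C ≤-refl ⟩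
  C * ∣ d ∣         <⟨ *-monoʳ-<-pos C {{positive 0<C}} d< ⟩
  C * (inv 0<C * δ) ≡⟨ inv-cancel 0<C δ ⟩
  δ                 ∎
  where open ≤-Reasoning

*-close : ∀ {a b c d A B δ} (0<A : 0ℚ < A) (0<B : 0ℚ < B) → ∣ a ∣ ≤ A → ∣ d ∣ ≤ B →
          ∣ a - b ∣ < inv 0<B * δ → ∣ c - d ∣ < inv 0<A * δ → ∣ a * c - b * d ∣ < δ + δ
*-close {a} {b} {c} {d} {A} {B} {δ} 0<A 0<B a≤A d≤B a-b< c-d< = begin-strict
  ∣ a * c - b * d ∣                   ≡⟨ cong ∣_∣ (split a b c d) ⟩
  ∣ a * (c - d) + d * (a - b) ∣       ≤⟨ ∣p+q∣≤∣p∣+∣q∣ (a * (c - d)) (d * (a - b)) ⟩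
  ∣ a * (c - d) ∣ + ∣ d * (a - b) ∣   <⟨ +-mono-< (*-shrink 0<A a≤A c-d<) (*-shrink 0<B d≤B a-b<) ⟩
  δ + δ                               ∎
  where
  open ≤-Reasoning
  split : ∀ a b c d → a * c - b * d ≡ a * (c - d) + d * (a - b)
  split = solve 4 (λ a b c d → a :* c :- b :* d := a :* (c :- d) :+ d :* (a :- b)) refl

abstract

  *-cauchy : ∀ x y → IsCauchy (λ n → seq x n * seq y n)
  *-cauchy x y ε 0<ε =
    let (A , 0<A , K , x≤A) = bounded x
        (B , 0<B , L , y≤B) = bounded y
        (M , x-close) = cauchy x (inv 0<B * (½ * ε)) (0<p*q (0<inv 0<B) (0<half 0<ε))
        (N , y-close) = cauchy y (inv 0<A * (½ * ε)) (0<p*q (0<inv 0<A) (0<half 0<ε))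
        K≤ = ℕ.≤-trans (ℕ.m≤m⊔n K L) (ℕ.m≤m⊔n (K ℕ.⊔ L) (M ℕ.⊔ N))
        L≤ = ℕ.≤-trans (ℕ.m≤n⊔m K L) (ℕ.m≤m⊔n (K ℕ.⊔ L) (M ℕ.⊔ N))
        M≤ = ℕ.≤-trans (ℕ.m≤m⊔n M N) (ℕ.m≤n⊔m (K ℕ.⊔ L) (M ℕ.⊔ N))
        N≤ = ℕ.≤-trans (ℕ.m≤n⊔m M N) (ℕ.m≤n⊔m (K ℕ.⊔ L) (M ℕ.⊔ N))
    in (K ℕ.⊔ L) ℕ.⊔ (M ℕ.⊔ N) , λ m n ≤m ≤n →
      subst (∣ seq x m * seq y m - seq x n * seq y n ∣ <_) (half ε)
        (*-close {a = seq x m} {seq x n} {seq y m} {seq y n} 0<A 0<B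
          (x≤A m (ℕ.≤-trans K≤ ≤m)) (y≤B n (ℕ.≤-trans L≤ ≤n))
          (x-close m n (ℕ.≤-trans M≤ ≤m) (ℕ.≤-trans M≤ ≤n))
          (y-close m n (ℕ.≤-trans N≤ ≤m) (ℕ.≤-trans N≤ ≤n)))

_*ᴿ_ : ℝ → ℝ → ℝ
x *ᴿ y = mkℝ (λ n → seq x n * seq y n) (*-cauchy x y)

inv-antimono : ∀ {p q} (0<p : 0ℚ < p) (0<q : 0ℚ < q) → p ≤ q → inv 0<q ≤ inv 0<p
inv-antimono {p} {q} 0<p 0<q p≤q = begin
  inv 0<q                   ≡⟨ inv-cancel 0<p (inv 0<q) ⟨
  p * (inv 0<p * inv 0<q)   ≤⟨ *-mono-≤′ (<⇒≤ 0<p) (<⇒≤ (0<p*q (0<inv 0<p) (0<inv 0<q))) p≤q ≤-refl ⟩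
  q * (inv 0<p * inv 0<q)   ≡⟨ cong (q *_) (*-comm (inv 0<p) (inv 0<q)) ⟩
  q * (inv 0<q * inv 0<p)   ≡⟨ inv-cancel 0<q (inv 0<p) ⟩
  inv 0<p                   ∎
  where open ≤-Reasoning

inv-diff : ∀ {p q} (0<p : 0ℚ < p) (0<q : 0ℚ < q) → inv 0<p - inv 0<q ≡ (inv 0<p * inv 0<q) * (q - p)
inv-diff {p} {q} 0<p 0<q = trans
  (cong₂ _-_ (sym (trans (cong (inv 0<p *_) (*-inv 0<q)) (*-identityʳ (inv 0<p))))
             (sym (trans (cong (inv 0<q *_) (*-inv 0<p)) (*-identityʳ (inv 0<q)))))
  (factor p q (inv 0<p) (inv 0<q))
  where
  factor : ∀ a b i j → i * (b * j) - j * (a * i) ≡ (i * j) * (b - a)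
  factor = solve 4 (λ a b i j → i :* (b :* j) :- j :* (a :* i) := (i :* j) :* (b :- a)) refl

inv-close : ∀ {e p q ε} (0<e : 0ℚ < e) (0<p : 0ℚ < p) (0<q : 0ℚ < q) → e ≤ p → e ≤ q →
            ∣ q - p ∣ < (e * e) * ε → ∣ inv 0<p - inv 0<q ∣ < ε
inv-close {e} {p} {q} {ε} 0<e 0<p 0<q e≤p e≤q close = begin-strict
  ∣ i - j ∣                  ≡⟨ cong ∣_∣ (inv-diff 0<p 0<q) ⟩
  ∣ (i * j) * (q - p) ∣      ≡⟨ ∣p*q∣≡∣p∣*∣q∣ (i * j) (q - p) ⟩
  ∣ i * j ∣ * ∣ q - p ∣      ≡⟨ cong (_* ∣ q - p ∣) (0≤p⇒∣p∣≡p (0≤p*q 0≤i 0≤j)) ⟩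
  (i * j) * ∣ q - p ∣        ≤⟨ *-mono-≤′ (0≤p*q 0≤i 0≤j) (0≤∣p∣ (q - p))
                                 (*-mono-≤′ 0≤i 0≤j (inv-antimono 0<e 0<p e≤p) (inv-antimono 0<e 0<q e≤q)) ≤-refl ⟩
  (k * k) * ∣ q - p ∣        <⟨ *-monoʳ-<-pos (k * k) {{positive (0<p*q (0<inv 0<e) (0<inv 0<e))}} close ⟩
  (k * k) * ((e * e) * ε)    ≡⟨ regroup e k ε ⟩
  (e * k) * ((e * k) * ε)    ≡⟨ cong (λ u → u * (u * ε)) (*-inv 0<e) ⟩
  1ℚ * (1ℚ * ε)              ≡⟨ trans (*-identityˡ (1ℚ * ε)) (*-identityˡ ε) ⟩
  ε                          ∎
  where
  open ≤-Reasoning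
  i = inv 0<p
  j = inv 0<q
  k = inv 0<e
  0≤i = <⇒≤ (0<inv 0<p)
  0≤j = <⇒≤ (0<inv 0<q)
  regroup : ∀ e k ε → (k * k) * ((e * e) * ε) ≡ (e * k) * ((e * k) * ε)
  regroup = solve 3 (λ e k ε → (k :* k) :* ((e :* e) :* ε) := (e :* k) :* ((e :* k) :* ε)) refl

-- If x is at least e from index N on, its reciprocal is represented by the
-- reciprocals of the sequence shifted by N.
module Reciprocal (x : ℝ) (e : ℚ) (0<e : 0ℚ < e) (N : ℕ)
                  (e≤x : ∀ n → N ℕ.≤ n → 0ℚ + e ≤ seq x n) where

  e≤ : ∀ n → e ≤ seq x (N ℕ.+ n)
  e≤ n = subst (_≤ seq x (N ℕ.+ n)) (+-identityˡ e) (e≤x (N ℕ.+ n) (ℕ.m≤m+n N n))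

  0<x : ∀ n → 0ℚ < seq x (N ℕ.+ n)
  0<x n = <-≤-trans 0<e (e≤ n)

  abstract

    reciprocal-cauchy : IsCauchy (λ n → inv (0<x n))
    reciprocal-cauchy ε 0<ε =
      let (M , x-close) = cauchy x ((e * e) * ε) (0<p*q (0<p*q 0<e 0<e) 0<ε)
      in M , λ m n M≤m M≤n →
        inv-close 0<e (0<x m) (0<x n) (e≤ m) (e≤ n)
          (x-close (N ℕ.+ n) (N ℕ.+ m) (ℕ.≤-trans M≤n (ℕ.m≤n+m n N)) (ℕ.≤-trans M≤m (ℕ.m≤n+m m N)))

  reciprocal : ℝ
  reciprocal = mkℝ (λ n → inv (0<x n)) reciprocal-cauchy

_⁻¹[_] : (x : ℝ) → 0ᴿ <ᴿ x → ℝ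
x ⁻¹[ lt e 0<e N e≤x ] = Reciprocal.reciprocal x e 0<e N e≤x

⁻¹-positive : ∀ x (0<x : 0ᴿ <ᴿ x) → 0ᴿ <ᴿ x ⁻¹[ 0<x ]
⁻¹-positive x 0<x@(lt e 0<e N e≤x) =
  let (B , 0<B , K , x≤B) = bounded x
  in lt (inv 0<B) (0<inv 0<B) K λ n K≤n →
    let 0<y = Reciprocal.0<x x e 0<e N e≤x n
        y≤B = subst (_≤ B) (0≤p⇒∣p∣≡p (<⇒≤ 0<y)) (x≤B (N ℕ.+ n) (ℕ.≤-trans K≤n (ℕ.m≤n+m n N)))
    in ≤-trans (≤-reflexive (+-identityˡ (inv 0<B))) (inv-antimono 0<y 0<B y≤B)

bounds-within : ∀ x δ → 0ℚ < δ → ∃[ a ] ∃[ b ] fromℚ a <ᴿ x × x <ᴿ fromℚ b × b - a ≡ δ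
bounds-within x δ 0<δ =
  let η = ½ * (½ * δ)
      0<η = 0<half (0<half 0<δ)
      (N , close) = cauchy x η 0<η
      c = seq x N
  in c - ½ * δ , c + ½ * δ
   , (lt η 0<η N λ n N≤n →
        ≤-trans (≤-reflexive (below c δ)) (<⇒≤ (shift c (seq x n) η (proj₂ (abs-split {seq x n} {c} (close n N N≤n ℕ.≤-refl))))))
   , (lt η 0<η N λ n N≤n →
        ≤-trans (<⇒≤ (+-monoˡ-< η (proj₁ (abs-split {seq x n} {c} (close n N N≤n ℕ.≤-refl))))) (≤-reflexive (above c δ)))
   , gap c δ
  where
  below : ∀ c δ → (c - ½ * δ) + ½ * (½ * δ) ≡ c - ½ * (½ * δ)
  below = solve 2 (λ c δ → (c :- con ½ :* δ) :+ con ½ :* (con ½ :* δ) := c :- con ½ :* (con ½ :* δ)) refl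
  above : ∀ c δ → (c + ½ * (½ * δ)) + ½ * (½ * δ) ≡ c + ½ * δ
  above = solve 2 (λ c δ → (c :+ con ½ :* (con ½ :* δ)) :+ con ½ :* (con ½ :* δ) := c :+ con ½ :* δ) refl
  gap : ∀ c δ → (c + ½ * δ) - (c - ½ * δ) ≡ δ
  gap = solve 2 (λ c δ → (c :+ con ½ :* δ) :- (c :- con ½ :* δ) := δ) refl
  shift : ∀ c y η → c < y + η → c - η < y
  shift c y η h = <-by (y + η - c) (<⇒0< h) (solve 3 (λ c y η → y := (c :- η) :+ (y :+ η :- c)) refl c y η)

<ᴿ-between : ∀ {p x q} → fromℚ p <ᴿ x → x <ᴿ fromℚ q → p < q
<ᴿ-between {p} {x} {q} (lt ε 0<ε M p<x) (lt ε′ 0<ε′ N x<q) =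
  <-≤-trans (<-by ε 0<ε refl) (≤-trans (p<x (M ℕ.⊔ N) (ℕ.m≤m⊔n M N))
    (≤-trans (<⇒≤ (<-by ε′ 0<ε′ refl)) (x<q (M ℕ.⊔ N) (ℕ.m≤n⊔m M N))))

cotransitive : ∀ x {p q} → p < q → fromℚ p <ᴿ x ⊎ x <ᴿ fromℚ q
cotransitive x {p} {q} p<q =
  let (a , b , a<x , x<b , b-a≡δ) = bounds-within x (q - p) (<⇒0< p<q)
  in decide a b a<x x<b b-a≡δ (p ≤? a)
  where
  decide : ∀ a b → fromℚ a <ᴿ x → x <ᴿ fromℚ b → b - a ≡ q - p → Dec (p ≤ a) → fromℚ p <ᴿ x ⊎ x <ᴿ fromℚ q
  decide a b (lt ε 0<ε N a<x) _ _ (yes p≤a) =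
    inj₁ (lt ε 0<ε N λ n N≤n → ≤-trans (+-monoˡ-≤ ε p≤a) (a<x n N≤n))
  decide a b _ (lt ε 0<ε N x<b) b-a≡q-p (no p≰a) =
    inj₂ (lt ε 0<ε N λ n N≤n → ≤-trans (x<b n N≤n) (≤-by (p - a) (≤⇒0≤ (<⇒≤ (≰⇒> p≰a)))
      (trans (rearrange₁ p q) (trans (cong (λ d → d + p) (sym b-a≡q-p)) (rearrange₂ a b p)))))
    where
    rearrange₁ : ∀ p q → q ≡ (q - p) + p
    rearrange₁ = solve 2 (λ p q → q := (q :- p) :+ p) refl
    rearrange₂ : ∀ a b p → (b - a) + p ≡ b + (p - a)
    rearrange₂ = solve 3 (λ a b p → (b :- a) :+ p := b :+ (p :- a)) refl

positive-bound : ∀ {x} → 0ᴿ <ᴿ x → ∃[ r ] 0ℚ < r × fromℚ r <ᴿ x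
positive-bound (lt ε 0<ε N ε≤x) = ½ * ε , 0<half 0<ε , lt (½ * ε) (0<half 0<ε) N λ n N≤n →
  ≤-trans (≤-reflexive (trans (half ε) (sym (+-identityˡ ε)))) (ε≤x n N≤n)

record Cut : Set₁ where
  field
    lower upper : ℚ → Set
    lower-inhabited : ∃ lower
    upper-inhabited : ∃ upper
    ordered : ∀ {p q} → lower p → upper q → p < q
    located : ∀ {p q} → p < q → lower p ⊎ upper q

module Trisection (C : Cut) where
  open Cut C

  record Bracket : Set where
    constructor bracket
    field
      {left right} : ℚ
      left∈  : lower left
      right∈ : upper right

    width : ℚ
    width = right - left

    0<width : 0ℚ < width
    0<width = <⇒0< (ordered left∈ right∈)

  open Bracket

  leftThird rightThird : Bracket → ℚ
  leftThird  I = left I + ⅓ * width I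
  rightThird I = right I - ⅓ * width I

  thirds : ∀ I → leftThird I < rightThird I
  thirds I = <-by (⅓ * width I) (0<p*q 0<⅓ (0<width I)) (identity (left I) (right I))
    where
    identity : ∀ a b → b - ⅓ * (b - a) ≡ (a + ⅓ * (b - a)) + ⅓ * (b - a)
    identity = solve 2 (λ a b → b :- con ⅓ :* (b :- a) := (a :+ con ⅓ :* (b :- a)) :+ con ⅓ :* (b :- a)) refl

  choose : ∀ I → lower (leftThird I) ⊎ upper (rightThird I) → Bracket
  choose I (inj₁ l) = bracket l (right∈ I)
  choose I (inj₂ u) = bracket (left∈ I) u

  step : Bracket → Bracket
  step I = choose I (located (thirds I))

  brackets : ℕ → Bracket
  brackets zero    = bracket (proj₂ lower-inhabited) (proj₂ upper-inhabited)
  brackets (suc n) = step (brackets n)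

  choose-left : ∀ I s → left I ≤ left (choose I s)
  choose-left I (inj₁ _) = ≤-by (⅓ * width I) (<⇒≤ (0<p*q 0<⅓ (0<width I))) refl
  choose-left I (inj₂ _) = ≤-refl

  choose-right : ∀ I s → right (choose I s) ≤ right I
  choose-right I (inj₁ _) = ≤-refl
  choose-right I (inj₂ _) = ≤-by (⅓ * width I) (<⇒≤ (0<p*q 0<⅓ (0<width I)))
    (solve 2 (λ b w → b := (b :- con ⅓ :* w) :+ con ⅓ :* w) refl (right I) (width I))

  choose-width : ∀ I s → width (choose I s) ≡ width I - ⅓ * width I
  choose-width I (inj₁ _) = identity (left I) (right I)
    where
    identity : ∀ a b → b - (a + ⅓ * (b - a)) ≡ (b - a) - ⅓ * (b - a)
    identity = solve 2 (λ a b → b :- (a :+ con ⅓ :* (b :- a)) := (b :- a) :- con ⅓ :* (b :- a)) refl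
  choose-width I (inj₂ _) = identity (left I) (right I)
    where
    identity : ∀ a b → (b - ⅓ * (b - a)) - a ≡ (b - a) - ⅓ * (b - a)
    identity = solve 2 (λ a b → (b :- con ⅓ :* (b :- a)) :- a := (b :- a) :- con ⅓ :* (b :- a)) refl

  nested : ∀ {m n} → m ℕ.≤′ n → left (brackets m) ≤ left (brackets n) × right (brackets n) ≤ right (brackets m)
  nested ℕ.≤′-refl = ≤-refl , ≤-refl
  nested {m} (ℕ.≤′-step {n} m≤n) =
    let (l , r) = nested m≤n
        I = brackets n
        s = located (thirds I)
    in ≤-trans l (choose-left I s) , ≤-trans (choose-right I s) r

  width-bound : ∀ n → width (brackets n) * (1ℚ + 1ℚ + ι n) ≤ (1ℚ + 1ℚ) * width (brackets 0)
  width-bound zero = ≤-reflexive (solve 1 (λ w → w :* (con 1ℚ :+ con 1ℚ :+ con 0ℚ) := (con 1ℚ :+ con 1ℚ) :* w) refl (width (brackets 0)))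
  width-bound (suc n) = ≤-trans
    (≤-by (⅓ * (w * ι n)) (0≤p*q (<⇒≤ 0<⅓) (0≤p*q (<⇒≤ (0<width (brackets n))) (0≤ι n)))
      (trans (identity w (ι n))
        (cong (_+ ⅓ * (w * ι n))
          (sym (cong₂ (λ v k → v * (1ℚ + 1ℚ + k)) (choose-width (brackets n) (located (thirds (brackets n)))) (ι-suc n))))))
    (width-bound n)
    where
    w = width (brackets n)
    identity : ∀ w k → w * (1ℚ + 1ℚ + k) ≡ (w - ⅓ * w) * (1ℚ + 1ℚ + (1ℚ + k)) + ⅓ * (w * k)
    identity = solve 2 (λ w k → w :* (con 1ℚ :+ con 1ℚ :+ k) :=
      (w :- con ⅓ :* w) :* (con 1ℚ :+ con 1ℚ :+ (con 1ℚ :+ k)) :+ con ⅓ :* (w :* k)) refl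

  width-small : ∀ ε → 0ℚ < ε → ∃[ N ] width (brackets N) < ε
  width-small ε 0<ε =
    let W = (1ℚ + 1ℚ) * width (brackets 0)
        (N , big) = archimedean (inv 0<ε * W)
        k = 1ℚ + 1ℚ + ι N
        0<k : 0ℚ < k
        0<k = 0<p+q′ (0<p+q 0<1 0<1) (0≤ι N)
        W<εk : W < ε * k
        W<εk = subst (_< ε * k) (inv-cancel 0<ε W)
          (*-monoʳ-<-pos ε {{positive 0<ε}}
            (<-trans big (<-by (1ℚ + 1ℚ) (0<p+q 0<1 0<1) (+-comm (1ℚ + 1ℚ) (ι N)))))
    in N , *-cancelʳ-<-nonNeg k {{nonNegative (<⇒≤ 0<k)}} (≤-<-trans (width-bound N) W<εk)

  abstract

    left-cauchy : IsCauchy (left ∘ brackets)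
    left-cauchy ε 0<ε =
      let (N , small) = width-small ε 0<ε
          near : ∀ m n → N ℕ.≤ m → N ℕ.≤ n → left (brackets m) < left (brackets n) + ε
          near m n N≤m N≤n = <-trans (ordered (left∈ (brackets m)) (right∈ (brackets m)))
            (≤-<-trans (proj₂ (nested (ℕ.≤⇒≤′ N≤m)))
              (<-≤-trans (<-by (ε - width (brackets N)) (<⇒0< small) (identity (left (brackets N)) (right (brackets N)) ε))
                (+-monoˡ-≤ ε (proj₁ (nested (ℕ.≤⇒≤′ N≤n))))))
      in N , λ m n N≤m N≤n → abs-join {left (brackets m)} {left (brackets n)} (near m n N≤m N≤n) (near n m N≤n N≤m)
      where
      identity : ∀ a b ε → a + ε ≡ b + (ε - (b - a))
      identity = solve 3 (λ a b ε → a :+ ε := b :+ (ε :- (b :- a))) refl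

-- The lemmas lower≤fromCut and fromCut≤upper determine this real up to _≃ᴿ_.
fromCut : Cut → ℝ
fromCut C = mkℝ (Trisection.Bracket.left ∘ Trisection.brackets C) (Trisection.left-cauchy C)

lower≤fromCut : ∀ C {q} → Cut.lower C q → fromℚ q ≤ᴿ fromCut C
lower≤fromCut C {q} q∈ (lt ε 0<ε N below) =
  let open Trisection C
      open Bracket
      (M , small) = width-small ε 0<ε
      I = brackets (M ℕ.⊔ N)
      (l , r) = nested (ℕ.≤⇒≤′ (ℕ.m≤m⊔n M N))
      width< : width I < ε
      width< = ≤-<-trans (+-mono-≤ r (neg-antimono-≤ l)) small
      right< : right I < left I + ε
      right< = <-by (ε - width I) (<⇒0< width<)
        (solve 3 (λ a b ε → a :+ ε := b :+ (ε :- (b :- a))) refl (left I) (right I) ε)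
  in <-asym (Cut.ordered C q∈ (right∈ I)) (<-≤-trans right< (below (M ℕ.⊔ N) (ℕ.m≤n⊔m M N)))

fromCut≤upper : ∀ C {q} → Cut.upper C q → fromCut C ≤ᴿ fromℚ q
fromCut≤upper C {q} q∈ (lt ε 0<ε N above) =
  let open Trisection C
      open Bracket
      I = brackets N
  in <-asym (Cut.ordered C (left∈ I) q∈) (<-≤-trans (<-by ε 0<ε refl) (above N ℕ.≤-refl))

0<^ : ∀ {p} → 0ℚ < p → ∀ n → 0ℚ < p ^ n
0<^ 0<p zero    = 0<1
0<^ 0<p (suc n) = 0<p*q 0<p (0<^ 0<p n)

0≤^ : ∀ {p} → 0ℚ ≤ p → ∀ n → 0ℚ ≤ p ^ n
0≤^ 0≤p zero    = <⇒≤ 0<1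
0≤^ 0≤p (suc n) = 0≤p*q 0≤p (0≤^ 0≤p n)

^-mono-≤ : ∀ {p q} → 0ℚ ≤ p → p ≤ q → ∀ n → p ^ n ≤ q ^ n
^-mono-≤ 0≤p p≤q zero    = ≤-refl
^-mono-≤ 0≤p p≤q (suc n) = *-mono-≤′ 0≤p (0≤^ 0≤p n) p≤q (^-mono-≤ 0≤p p≤q n)

^≤1 : ∀ {p} → 0ℚ ≤ p → p ≤ 1ℚ → ∀ n → p ^ n ≤ 1ℚ
^≤1 0≤p p≤1 zero    = ≤-refl
^≤1 0≤p p≤1 (suc n) = *-mono-≤′ 0≤p (0≤^ 0≤p n) p≤1 (^≤1 0≤p p≤1 n)

1≤^ : ∀ {p} → 1ℚ ≤ p → ∀ n → 1ℚ ≤ p ^ n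
1≤^ 1≤p zero    = ≤-refl
1≤^ 1≤p (suc n) = *-mono-≤′ (<⇒≤ 0<1) (<⇒≤ 0<1) 1≤p (1≤^ 1≤p n)

1<^ : ∀ {p} → 1ℚ < p → ∀ n → 1ℚ < p ^ suc n
1<^ {p} 1<p n = <-≤-trans 1<p (subst (_≤ p * p ^ n) (*-identityʳ p)
  (*-mono-≤′ (<⇒≤ (<-trans 0<1 1<p)) (<⇒≤ 0<1) ≤-refl (1≤^ (<⇒≤ 1<p) n)))

0≤p*p : ∀ p → 0ℚ ≤ p * p
0≤p*p p with ≤-total 0ℚ p
... | inj₁ 0≤p = 0≤p*q 0≤p 0≤p
... | inj₂ p≤0 = subst (0ℚ ≤_) (solve 1 (λ p → (con 0ℚ :- p) :* (con 0ℚ :- p) := p :* p) refl p)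
                   (0≤p*q (≤⇒0≤ p≤0) (≤⇒0≤ p≤0))

bernoulli : ∀ {a} → 0ℚ ≤ 1ℚ + a → ∀ n → 1ℚ + ι n * a ≤ (1ℚ + a) ^ n
bernoulli {a} 0≤1+a zero    = ≤-reflexive (trans (cong (λ t → 1ℚ + t) (*-zeroˡ a)) (+-identityʳ 1ℚ))
bernoulli {a} 0≤1+a (suc n) = ≤-trans
  (≤-by (ι n * (a * a)) (0≤p*q (0≤ι n) (0≤p*p a))
    (trans (identity (ι n) a) (cong (λ k → (1ℚ + k * a) + ι n * (a * a)) (sym (ι-suc n)))))
  (*-monoˡ-≤-nonNeg (1ℚ + a) {{nonNegative 0≤1+a}} (bernoulli 0≤1+a n))
  where
  identity : ∀ k a → (1ℚ + a) * (1ℚ + k * a) ≡ (1ℚ + (1ℚ + k) * a) + k * (a * a)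
  identity = solve 2 (λ k a → (con 1ℚ :+ a) :* (con 1ℚ :+ k :* a) :=
    (con 1ℚ :+ (con 1ℚ :+ k) :* a) :+ k :* (a :* a)) refl

1/suc : ℕ → ℚ
1/suc n = inv (0<ι n)

0<1/suc : ∀ n → 0ℚ < 1/suc n
0<1/suc n = 0<inv (0<ι n)

ι*1/suc : ∀ n → ι (suc n) * 1/suc n ≡ 1ℚ
ι*1/suc n = *-inv (0<ι n)

-- Rational bounds on e^q, from (1 + q/n)ⁿ < e^q < 1/(1 - q/n)ⁿ for nonzero q
-- and n > ∣q∣; both bounds converge to e^q.

infix 4 _<e^_ e^_<_

_<e^_ : ℚ → ℚ → Set
r <e^ q = ∃[ n ] 0ℚ < 1ℚ + q * 1/suc n × r < (1ℚ + q * 1/suc n) ^ suc n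

e^_<_ : ℚ → ℚ → Set
e^ q < r = ∃[ n ] 0ℚ < 1ℚ - q * 1/suc n × 1ℚ < r * (1ℚ - q * 1/suc n) ^ suc n

0≤1+a : ∀ m a → 0ℚ < 1ℚ + ι (suc m) * a → 0ℚ ≤ 1ℚ + a
0≤1+a m a pos with ≤-total 0ℚ a
... | inj₁ 0≤a = 0≤p+q (<⇒≤ 0<1) 0≤a
... | inj₂ a≤0 = subst (0ℚ ≤_)
  (trans (cong (λ k → (1ℚ + k * a) + ι m * (0ℚ - a)) (ι-suc m)) (identity (ι m) a))
  (0≤p+q (<⇒≤ pos) (0≤p*q (0≤ι m) (≤⇒0≤ a≤0)))
  where
  identity : ∀ k a → (1ℚ + (1ℚ + k) * a) + k * (0ℚ - a) ≡ 1ℚ + a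
  identity = solve 2 (λ k a → (con 1ℚ :+ (con 1ℚ :+ k) :* a) :+ k :* (con 0ℚ :- a) := con 1ℚ :+ a) refl

bounds-product : ∀ m n q → 0ℚ < 1ℚ + q * 1/suc n → 0ℚ < 1ℚ - q * 1/suc m →
                 (1ℚ + q * 1/suc n) ^ suc n * (1ℚ - q * 1/suc m) ^ suc m ≤ 1ℚ
bounds-product m n q 0<A 0<B = begin
  A ^ suc n * B ^ suc m
    ≤⟨ *-mono-≤′ (0≤^ (<⇒≤ 0<A) (suc n)) (0≤^ (<⇒≤ 0<B) (suc m))
         (^-mono-≤ (<⇒≤ 0<A) A≤ (suc n)) (^-mono-≤ (<⇒≤ 0<B) B≤ (suc m)) ⟩
  ((1ℚ + a) ^ suc m) ^ suc n * ((1ℚ + - a) ^ suc n) ^ suc m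
    ≡⟨ cong₂ _*_ (^-assocʳ (1ℚ + a) (suc m) (suc n))
         (trans (^-assocʳ (1ℚ + - a) (suc n) (suc m)) (^-congʳ (1ℚ + - a) (ℕ.*-comm (suc n) (suc m)))) ⟩
  (1ℚ + a) ^ k * (1ℚ + - a) ^ k
    ≡⟨ ^-distrib-* (1ℚ + a) (1ℚ + - a) k ⟨
  ((1ℚ + a) * (1ℚ + - a)) ^ k
    ≤⟨ ^≤1 (0≤p*q 0≤1+a′ 0≤1-a) (≤-by (a * a) (0≤p*p a) (square a)) k ⟩
  1ℚ ∎
  where
  open ≤-Reasoning
  A = 1ℚ + q * 1/suc n
  B = 1ℚ - q * 1/suc m
  k = suc m ℕ.* suc n
  a = q * 1/suc n * 1/suc m
  square : ∀ a → 1ℚ ≡ (1ℚ + a) * (1ℚ + - a) + a * a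
  square = solve 1 (λ a → con 1ℚ := (con 1ℚ :+ a) :* (con 1ℚ :+ :- a) :+ a :* a) refl
  A≡ : A ≡ 1ℚ + ι (suc m) * a
  A≡ = cong (λ t → 1ℚ + t) (sym (trans (swap (ι (suc m)) (q * 1/suc n) (1/suc m))
         (trans (cong (q * 1/suc n *_) (ι*1/suc m)) (*-identityʳ (q * 1/suc n)))))
    where
    swap : ∀ i u v → i * (u * v) ≡ u * (i * v)
    swap = solve 3 (λ i u v → i :* (u :* v) := u :* (i :* v)) refl
  B≡ : B ≡ 1ℚ + ι (suc n) * - a
  B≡ = cong (λ t → 1ℚ + t) (sym (trans (swap (ι (suc n)) q (1/suc n) (1/suc m))
         (trans (cong (λ t → - (q * 1/suc m * t)) (ι*1/suc n)) (cong -_ (*-identityʳ (q * 1/suc m))))))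
    where
    swap : ∀ i q u v → i * - (q * u * v) ≡ - (q * v * (i * u))
    swap = solve 4 (λ i q u v → i :* (:- (q :* u :* v)) := :- (q :* v :* (i :* u))) refl
  0≤1+a′ : 0ℚ ≤ 1ℚ + a
  0≤1+a′ = 0≤1+a m a (subst (0ℚ <_) A≡ 0<A)
  0≤1-a : 0ℚ ≤ 1ℚ + - a
  0≤1-a = 0≤1+a n (- a) (subst (0ℚ <_) B≡ 0<B)
  A≤ : A ≤ (1ℚ + a) ^ suc m
  A≤ = subst (_≤ (1ℚ + a) ^ suc m) (sym A≡) (bernoulli 0≤1+a′ (suc m))
  B≤ : B ≤ (1ℚ + - a) ^ suc n
  B≤ = subst (_≤ (1ℚ + - a) ^ suc n) (sym B≡) (bernoulli 0≤1-a (suc n))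

exp-bounds-< : ∀ {r q q′ s} → r <e^ q → q ≤ q′ → e^ q′ < s → r < s
exp-bounds-< {r} {q} {q′} {s} (n , 0<A , r<Aⁿ) q≤q′ (m , 0<B′ , 1<sB′ᵐ) =
  <-trans r<Aⁿ (*-cancelʳ-<-nonNeg (B′ ^ suc m) {{nonNegative 0≤B′ᵐ}}
    (≤-<-trans (≤-trans
        (*-mono-≤′ (0≤^ (<⇒≤ 0<A) (suc n)) 0≤B′ᵐ ≤-refl (^-mono-≤ (<⇒≤ 0<B′) B′≤B (suc m)))
        (bounds-product m n q 0<A (<-≤-trans 0<B′ B′≤B)))
      1<sB′ᵐ))
  where
  B = 1ℚ - q * 1/suc m
  B′ = 1ℚ - q′ * 1/suc m
  0≤B′ᵐ : 0ℚ ≤ B′ ^ suc m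
  0≤B′ᵐ = 0≤^ (<⇒≤ 0<B′) (suc m)
  B′≤B : B′ ≤ B
  B′≤B = ≤-by ((q′ - q) * 1/suc m) (0≤p*q (≤⇒0≤ q≤q′) (<⇒≤ (0<1/suc m)))
    (solve 3 (λ q q′ u → con 1ℚ :- q :* u := (con 1ℚ :- q′ :* u) :+ (q′ :- q) :* u) refl q q′ (1/suc m))

∃-large : ∀ a b c → ∃[ n ] a < ι (suc n) × b < ι (suc n) × c < ι (suc n)
∃-large a b c =
  let (i , a<i) = archimedean a
      (j , b<j) = archimedean b
      (k , c<k) = archimedean c
      n = i ℕ.⊔ (j ℕ.⊔ k)
      up : ∀ {x} l → x < ι l → l ℕ.≤ n → x < ι (suc n)
      up l x<l l≤n = <-≤-trans x<l (ι-mono (ℕ.m≤n⇒m≤1+n l≤n))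
  in n , up i a<i (ℕ.m≤m⊔n i (j ℕ.⊔ k))
       , up j b<j (ℕ.≤-trans (ℕ.m≤m⊔n j k) (ℕ.m≤n⊔m i (j ℕ.⊔ k)))
       , up k c<k (ℕ.≤-trans (ℕ.m≤n⊔m j k) (ℕ.m≤n⊔m i (j ℕ.⊔ k)))

1/suc-shrink : ∀ {p δ} n → (0<δ : 0ℚ < δ) → inv 0<δ * p < ι (suc n) → p * 1/suc n < δ
1/suc-shrink {p} {δ} n 0<δ large = begin-strict
  p * 1/suc n                      ≡⟨ cong (_* 1/suc n) (inv-cancel 0<δ p) ⟨
  δ * (inv 0<δ * p) * 1/suc n      <⟨ *-monoˡ-<-pos (1/suc n) {{positive (0<1/suc n)}}
                                        (*-monoʳ-<-pos δ {{positive 0<δ}} large) ⟩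
  δ * ι (suc n) * 1/suc n          ≡⟨ *-assoc δ (ι (suc n)) (1/suc n) ⟩
  δ * (ι (suc n) * 1/suc n)        ≡⟨ cong (δ *_) (ι*1/suc n) ⟩
  δ * 1ℚ                           ≡⟨ *-identityʳ δ ⟩
  δ                                ∎
  where open ≤-Reasoning

0<1-p/n : ∀ {p} n → p < ι (suc n) → 0ℚ < 1ℚ - p * 1/suc n
0<1-p/n {p} n large = <⇒0< (subst (p * 1/suc n <_) (ι*1/suc n)
  (*-monoˡ-<-pos (1/suc n) {{positive (0<1/suc n)}} large))

0<1+p/n : ∀ {p} n → - p < ι (suc n) → 0ℚ < 1ℚ + p * 1/suc n
0<1+p/n {p} n large = subst (0ℚ <_)
  (solve 2 (λ p u → con 1ℚ :- (:- p) :* u := con 1ℚ :+ p :* u) refl p (1/suc n)) (0<1-p/n { - p} n large)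

module ExpCut (x : ℝ) where

  lower upper : ℚ → Set
  lower r = ∃[ q ] fromℚ q <ᴿ x × r <e^ q
  upper r = ∃[ q ] x <ᴿ fromℚ q × e^ q < r

  lower-nonPos : ∀ {r} → r ≤ 0ℚ → lower r
  lower-nonPos {r} r≤0 =
    let (q , _ , q<x , _) = bounds-within x 1ℚ 0<1
        (n , large , _) = ∃-large (- q) 0ℚ 0ℚ
        0<A = 0<1+p/n {q} n large
    in q , q<x , n , 0<A , ≤-<-trans r≤0 (0<^ 0<A (suc n))

  upper-inhabited : ∃ upper
  upper-inhabited =
    let (_ , q , _ , x<q , _) = bounds-within x 1ℚ 0<1
        (n , large , _) = ∃-large q 0ℚ 0ℚ
        0<B = 0<1-p/n {q} n large
        0<Bⁿ = 0<^ 0<B (suc n)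
    in inv 0<Bⁿ + 1ℚ , q , x<q , n , 0<B , <-by _ 0<Bⁿ (expand _ 0<Bⁿ)
    where
    expand : ∀ b (0<b : 0ℚ < b) → (inv 0<b + 1ℚ) * b ≡ 1ℚ + b
    expand b 0<b = trans (solve 2 (λ b i → (i :+ con 1ℚ) :* b := b :* i :+ b) refl b (inv 0<b)) (cong (_+ b) (*-inv 0<b))

  ordered : ∀ {r s} → lower r → upper s → r < s
  ordered (q , q<x , r<) (q′ , x<q′ , <s) =
    exp-bounds-< {q = q} {q′} r< (<⇒≤ (<ᴿ-between {q} {x} {q′} q<x x<q′)) <s

  located-pos : ∀ {r s} → 0ℚ < s → r < s → lower r ⊎ upper s
  located-pos {r} {s} 0<s r<s =
    let δ = ½ * (s - r)
        0<δ = 0<half (<⇒0< r<s)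
        (q , q′ , q<x , x<q′ , gap) = bounds-within x (inv 0<s * δ) (0<p*q (0<inv 0<s) 0<δ)
        (n , largeA , largeB , largeC) = ∃-large (- q) q′ (inv 0<δ * (s * (q * q′)))
        0<A = 0<1+p/n {q} n largeA
        0<B = 0<1-p/n {q′} n largeB
    in decide q q′ q<x x<q′ gap n 0<A 0<B (1/suc-shrink n 0<δ largeC) (r <? (1ℚ + q * 1/suc n) ^ suc n)
    where
    decide : ∀ q q′ → fromℚ q <ᴿ x → x <ᴿ fromℚ q′ → q′ - q ≡ inv 0<s * (½ * (s - r)) → ∀ n →
             0ℚ < 1ℚ + q * 1/suc n → 0ℚ < 1ℚ - q′ * 1/suc n → s * (q * q′) * 1/suc n < ½ * (s - r) →
             Dec (r < (1ℚ + q * 1/suc n) ^ suc n) → lower r ⊎ upper s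
    decide q q′ q<x x<q′ gap n 0<A 0<B small (yes r<Aⁿ) = inj₁ (q , q<x , n , 0<A , r<Aⁿ)
    decide q q′ q<x x<q′ gap n 0<A 0<B small (no r≮Aⁿ) = inj₂ (q′ , x<q′ , n , 0<B ,
      *-cancelʳ-<-nonNeg (A ^ suc n) {{nonNegative (0≤^ (<⇒≤ 0<A) (suc n))}} (begin-strict
        1ℚ * A ^ suc n                  ≡⟨ *-identityˡ (A ^ suc n) ⟩
        A ^ suc n                       ≤⟨ ≮⇒≥ r≮Aⁿ ⟩
        r                               <⟨ r<s*bound ⟩
        s * (1ℚ + ι (suc n) * y)        ≤⟨ *-monoˡ-≤-nonNeg s {{nonNegative (<⇒≤ 0<s)}} (bernoulli 0≤1+y (suc n)) ⟩
        s * (1ℚ + y) ^ suc n            ≡⟨ cong (λ t → s * t ^ suc n) (sym AB≡1+y) ⟩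
        s * (A * B) ^ suc n             ≡⟨ cong (s *_) (^-distrib-* A B (suc n)) ⟩
        s * (A ^ suc n * B ^ suc n)     ≡⟨ solve 3 (λ s a b → s :* (a :* b) := s :* b :* a) refl s (A ^ suc n) (B ^ suc n) ⟩
        s * B ^ suc n * A ^ suc n       ∎))
      where
      open ≤-Reasoning
      u = 1/suc n
      A = 1ℚ + q * u
      B = 1ℚ - q′ * u
      y = - (((q′ - q) + q * q′ * u) * u)
      AB≡1+y : A * B ≡ 1ℚ + y
      AB≡1+y = solve 3 (λ q q′ u → (con 1ℚ :+ q :* u) :* (con 1ℚ :- q′ :* u) :=
        con 1ℚ :+ (:- (((q′ :- q) :+ q :* q′ :* u) :* u))) refl q q′ u
      0≤1+y : 0ℚ ≤ 1ℚ + y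
      0≤1+y = subst (0ℚ ≤_) AB≡1+y (<⇒≤ (0<p*q 0<A 0<B))
      sgap : s * (q′ - q) ≡ ½ * (s - r)
      sgap = trans (cong (s *_) gap) (inv-cancel 0<s (½ * (s - r)))
      ι*y : ι (suc n) * y ≡ - ((q′ - q) + q * q′ * u)
      ι*y = trans (solve 3 (λ k t u → k :* (:- (t :* u)) := :- (t :* (k :* u))) refl (ι (suc n)) ((q′ - q) + q * q′ * u) u)
        (cong -_ (trans (cong (((q′ - q) + q * q′ * u) *_) (ι*1/suc n)) (*-identityʳ _)))
      r<s*bound : r < s * (1ℚ + ι (suc n) * y)
      r<s*bound = <-by (½ * (s - r) - s * (q * q′) * u) (<⇒0< small)
        (trans (cong (λ t → s * (1ℚ + t)) ι*y)
          (trans (solve 4 (λ s g c u → s :* (con 1ℚ :+ (:- (g :+ c :* u))) := s :- s :* g :- s :* c :* u) refl s (q′ - q) (q * q′) u)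
            (trans (cong (λ t → s - t - s * (q * q′) * u) sgap)
              (solve 3 (λ s r c → s :- con ½ :* (s :- r) :- c := r :+ (con ½ :* (s :- r) :- c)) refl s r (s * (q * q′) * u)))))

  abstract

    located : ∀ {r s} → r < s → lower r ⊎ upper s
    located {r} {s} r<s = decide (0ℚ <? s)
      where
      decide : Dec (0ℚ < s) → lower r ⊎ upper s
      decide (yes 0<s) = located-pos 0<s r<s
      decide (no 0≮s)  = inj₁ (lower-nonPos (≤-trans (<⇒≤ r<s) (≮⇒≥ 0≮s)))

  cut : Cut
  cut = record
    { lower = lower
    ; upper = upper
    ; lower-inhabited = 0ℚ , lower-nonPos ≤-refl
    ; upper-inhabited = upper-inhabited
    ; ordered = ordered
    ; located = located
    }

exp : ℝ → ℝ
exp x = fromCut (ExpCut.cut x)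

module LnCut (x : ℝ) (0<x : 0ᴿ <ᴿ x) where

  lower upper : ℚ → Set
  lower q = ∃[ r ] e^ q < r × fromℚ r <ᴿ x
  upper q = ∃[ r ] x <ᴿ fromℚ r × r <e^ q

  lower-inhabited : ∃ lower
  lower-inhabited =
    let (r , 0<r , r<x) = positive-bound {x} 0<x
        q = - inv 0<r
        B≡ : 1ℚ - q * 1ℚ ≡ 1ℚ + inv 0<r
        B≡ = solve 1 (λ i → con 1ℚ :- (:- i) :* con 1ℚ := con 1ℚ :+ i) refl (inv 0<r)
        rB≡ : r * ((1ℚ - q * 1ℚ) * 1ℚ) ≡ 1ℚ + r
        rB≡ = trans (cong (λ t → r * (t * 1ℚ)) B≡)
          (trans (solve 2 (λ r i → r :* ((con 1ℚ :+ i) :* con 1ℚ) := r :* i :+ r) refl r (inv 0<r))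
            (cong (_+ r) (*-inv 0<r)))
    in q , r , (0 , subst (0ℚ <_) (sym B≡) (0<p+q 0<1 (0<inv 0<r)) , <-by r 0<r rB≡) , r<x

  upper-inhabited : ∃ upper
  upper-inhabited =
    let (r₀ , 0<r₀ , r₀<x) = positive-bound {x} 0<x
        (_ , r , _ , x<r , _) = bounds-within x 1ℚ 0<1
        0<r = <-trans 0<r₀ (<ᴿ-between {r₀} {x} {r} r₀<x x<r)
    in r , r , x<r , 0
     , subst (0ℚ <_) (cong (λ t → 1ℚ + t) (sym (*-identityʳ r))) (0<p+q 0<1 0<r)
     , <-by 1ℚ 0<1 (solve 1 (λ r → (con 1ℚ :+ r :* con 1ℚ) :* con 1ℚ := r :+ con 1ℚ) refl r)

  ordered : ∀ {p q} → lower p → upper q → p < q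
  ordered {p} {q} (r , <r , r<x) (s , x<s , s<) = ≰⇒> λ q≤p →
    <-asym (<ᴿ-between {r} {x} {s} r<x x<s) (exp-bounds-< {s} {q} {p} {r} s< q≤p <r)

  locate : ∀ {p q} → p < q → lower p ⊎ upper q
  locate {p} {q} p<q =
    let 0<δ = <⇒0< p<q
        (n , largeA , largeB , largeC) = ∃-large p (- q) (inv 0<δ * (p * q))
    in decide n (0<1-p/n {p} n largeA) (0<1+p/n {q} n largeB) (1/suc-shrink n 0<δ largeC)
    where
    decide : ∀ n → 0ℚ < 1ℚ - p * 1/suc n → 0ℚ < 1ℚ + q * 1/suc n → p * q * 1/suc n < q - p → lower p ⊎ upper q
    decide n 0<A 0<B small =
      let (r , inva<r , r<b) = <-dense inva<b
          (s , r<s , s<b) = <-dense r<b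
      in conclude inva<r r<s s<b (cotransitive x r<s)
      where
      u = 1/suc n
      A = 1ℚ - p * u
      B = 1ℚ + q * u
      a = A ^ suc n
      b = B ^ suc n
      0<a : 0ℚ < a
      0<a = 0<^ 0<A (suc n)
      1<AB : 1ℚ < A * B
      1<AB = <-by (((q - p) - p * q * u) * u) (0<p*q (<⇒0< small) (0<1/suc n))
        (solve 3 (λ p q u → (con 1ℚ :- p :* u) :* (con 1ℚ :+ q :* u) :=
          con 1ℚ :+ ((q :- p) :- p :* q :* u) :* u) refl p q u)
      1<ab : 1ℚ < a * b
      1<ab = subst (1ℚ <_) (^-distrib-* A B (suc n)) (1<^ 1<AB n)
      inva<b : inv 0<a < b
      inva<b = *-cancelˡ-<-nonNeg a {{nonNegative (<⇒≤ 0<a)}} (subst (_< a * b) (sym (*-inv 0<a)) 1<ab)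
      conclude : ∀ {r s} → inv 0<a < r → r < s → s < b → fromℚ r <ᴿ x ⊎ x <ᴿ fromℚ s → lower p ⊎ upper q
      conclude {r} {s} inva<r _ _ (inj₁ r<x) = inj₁ (r , (n , 0<A ,
        subst₂ _<_ (*-inv 0<a) (*-comm a r) (*-monoʳ-<-pos a {{positive 0<a}} inva<r)) , r<x)
      conclude {r} {s} _ _ s<b (inj₂ x<s) = inj₂ (s , x<s , n , 0<B , s<b)

  abstract

    located : ∀ {p q} → p < q → lower p ⊎ upper q
    located = locate

  cut : Cut
  cut = record
    { lower = lower
    ; upper = upper
    ; lower-inhabited = lower-inhabited
    ; upper-inhabited = upper-inhabited
    ; ordered = ordered
    ; located = located
    }

ln : (x : ℝ) → 0ᴿ <ᴿ x → ℝ
ln x 0<x = fromCut (LnCut.cut x 0<x)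

module SqrtCut (x : ℝ) where

  lower upper : ℚ → Set
  lower q = q < 0ℚ ⊎ fromℚ (q * q) <ᴿ x
  upper q = 0ℚ < q × x <ᴿ fromℚ (q * q)

  square-mono : ∀ {p q} → 0ℚ ≤ p → p < q → p * p < q * q
  square-mono {p} {q} 0≤p p<q = <-by ((q - p) * (q - p) + ((q - p) * p + (q - p) * p))
    (0<p+q′ (0<p*q 0<q-p 0<q-p) (0≤p+q (0≤p*q (<⇒≤ 0<q-p) 0≤p) (0≤p*q (<⇒≤ 0<q-p) 0≤p)))
    (solve 2 (λ p q → q :* q := p :* p :+ ((q :- p) :* (q :- p) :+ ((q :- p) :* p :+ (q :- p) :* p))) refl p q)
    where
    0<q-p : 0ℚ < q - p
    0<q-p = <⇒0< p<q

  upper-inhabited : ∃ upper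
  upper-inhabited =
    let (_ , r , _ , lt ε 0<ε N x<r , _) = bounds-within x 1ℚ 0<1
        q = 1ℚ + ∣ r ∣
        0<q = 0<p+q′ 0<1 (0≤∣p∣ r)
    in q , 0<q , lt ε 0<ε N λ n N≤n → ≤-trans (x<r n N≤n) (r≤q² r)
    where
    r≤q² : ∀ r → r ≤ (1ℚ + ∣ r ∣) * (1ℚ + ∣ r ∣)
    r≤q² r = ≤-trans (r≤∣r∣ (≤-total 0ℚ r)) (≤-by (1ℚ + a + a * a)
      (0≤p+q (0≤p+q (<⇒≤ 0<1) (0≤∣p∣ r)) (0≤p*p a))
      (solve 1 (λ a → (con 1ℚ :+ a) :* (con 1ℚ :+ a) := a :+ (con 1ℚ :+ a :+ a :* a)) refl a))
      where
      a = ∣ r ∣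
      r≤∣r∣ : 0ℚ ≤ r ⊎ r ≤ 0ℚ → r ≤ ∣ r ∣
      r≤∣r∣ (inj₁ 0≤r) = ≤-reflexive (sym (0≤p⇒∣p∣≡p 0≤r))
      r≤∣r∣ (inj₂ r≤0) = ≤-trans r≤0 (0≤∣p∣ r)

  ordered : ∀ {p q} → lower p → upper q → p < q
  ordered (inj₁ p<0) (0<q , _) = <-trans p<0 0<q
  ordered {p} {q} (inj₂ p²<x) (0<q , x<q²) = ≰⇒> λ q≤p →
    <-irrefl refl (<-≤-trans (<ᴿ-between {p * p} {x} {q * q} p²<x x<q²)
      (*-mono-≤′ (<⇒≤ 0<q) (<⇒≤ 0<q) q≤p q≤p))

  abstract

    located : ∀ {p q} → p < q → lower p ⊎ upper q
    located {p} {q} p<q = decide (p <? 0ℚ)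
      where
      decide : Dec (p < 0ℚ) → lower p ⊎ upper q
      decide (yes p<0) = inj₁ (inj₁ p<0)
      decide (no p≮0)  = [ inj₁ ∘ inj₂ , (λ x<q² → inj₂ (≤-<-trans (≮⇒≥ p≮0) p<q , x<q²)) ]′
                           (cotransitive x (square-mono (≮⇒≥ p≮0) p<q))

  cut : Cut
  cut = record
    { lower = lower
    ; upper = upper
    ; lower-inhabited = - 1ℚ , inj₁ (negative⁻¹ (- 1ℚ))
    ; upper-inhabited = upper-inhabited
    ; ordered = ordered
    ; located = located
    }

-- The square root of a negative real is 0.
sqrt : ℝ → ℝ
sqrt x = fromCut (SqrtCut.cut x)

fromℕ-positive : ∀ n → 1 ℕ.≤ n → 0ᴿ <ᴿ fromℕ n
fromℕ-positive (suc n) _ = lt (ι (suc n)) (0<ι n) 0 λ _ _ → ≤-reflexive (+-identityˡ (ι (suc n)))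

3^_ : ℝ → ℝ
3^ y = exp (y *ᴿ ln (fromℕ 3) (fromℕ-positive 3 (ℕ.s≤s ℕ.z≤n)))

sumᴿ : ∀ {m} → (Fin m → ℝ) → ℝ
sumᴿ {zero}  f = 0ᴿ
sumᴿ {suc m} f = f Fin.zero +ᴿ sumᴿ (f ∘ Fin.suc)

data Trit : Set where
  -1ᵗ 0ᵗ +1ᵗ : Trit

toℝ : Trit → ℝ
toℝ -1ᵗ = fromℚ (- 1ℚ)
toℝ 0ᵗ  = 0ᴿ
toℝ +1ᵗ = 1ᴿ

Point : ℕ → Set
Point n = Vec Trit n

embed : ∀ {n} → Point n → Fin n → ℝ
embed x j = toℝ (Vec.lookup x j)

TernarySet : ℕ → Set
TernarySet n = Point n → Bool

infix 4 _∈_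

_∈_ : ∀ {n} → Point n → TernarySet n → Set
x ∈ S = T (S x)

Conv : ∀ {n} → TernarySet n → (Fin n → ℝ) → Set
Conv {n} S v =
  ∃[ m ] Σ (Fin m → Point n) λ y → Σ (Fin m → ℝ) λ c →
    (∀ i → y i ∈ S) ×
    (∀ i → 0ᴿ ≤ᴿ c i) ×
    sumᴿ c ≃ᴿ 1ᴿ ×
    (∀ j → sumᴿ (λ i → c i *ᴿ embed (y i) j) ≃ᴿ v j)

Convex : ∀ {n} → TernarySet n → Set
Convex S = ∀ x → x ∈ S ⇔ Conv S (embed x)

points : ∀ n → List (Point n)
points zero    = [] ∷ []
points (suc n) = cartesianProductWith _∷_ (-1ᵗ ∷ 0ᵗ ∷ +1ᵗ ∷ []) (points n)

∣_△_∣ : ∀ {n} → TernarySet n → TernarySet n → ℕ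
∣_△_∣ {n} S S′ = length (filterᵇ (λ x → S x xor S′ x) (points n))

dist : ∀ {n} → TernarySet n → TernarySet n → ℝ
dist {n} S S′ = fromℚ (((+ ∣ S △ S′ ∣) / (3 ℕ.^ n)) {{ℕ.m^n≢0 3 n}})

FarFromConvex : ∀ {n} → ℝ → TernarySet n → Set
FarFromConvex ε S = ∀ S′ → Convex S′ → ε ≤ᴿ dist S S′

-- The random coins are an outcome ω of a finite probability space. The queries
-- depend on ω only; the verdict depends on ω and on the oracle's answers.
record NonAdaptiveAlgorithm (n : ℕ) : Set where
  field
    outcomes    : ℕ
    prob        : Fin outcomes → ℝ
    prob-nonNeg : ∀ ω → 0ᴿ ≤ᴿ prob ω
    prob-total  : sumᴿ prob ≃ᴿ 1ᴿ
    queries     : Fin outcomes → List (Point n)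
    accepts     : ∀ ω → Vec Bool (length (queries ω)) → Bool

  acceptsOn : TernarySet n → Fin outcomes → Bool
  acceptsOn S ω = accepts ω (Vec.map S (Vec.fromList (queries ω)))

  Pr : (Fin outcomes → Bool) → ℝ
  Pr event = sumᴿ λ ω → if event ω then prob ω else 0ᴿ

  queryComplexity : ℕ
  queryComplexity = Vector.foldr ℕ._⊔_ 0 (length ∘ queries)

IsOneSidedConvexityTester : ∀ {n} → ℝ → NonAdaptiveAlgorithm n → Set
IsOneSidedConvexityTester ε A =
  (∀ S → Convex S → Pr (acceptsOn S) ≃ᴿ 1ᴿ) ×
  (∀ S → FarFromConvex ε S → fromℚ (+ 2 / 3) ≤ᴿ Pr (not ∘ acceptsOn S))
  where open NonAdaptiveAlgorithm A

{-# OPTIONS --safe #-}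

-- If x lies in the hull of a set of points, then only the points that agree with
-- x on its nonzero coordinates contribute. When x and the points are in the middle
-- layers (about 2n/3 nonzero coordinates, up to O(W)), all of them are within Hamming
-- distance W of x. So let the tester sample points x, query the Hamming ball of
-- radius W around each, and reject when some queried point outside S lies in the
-- hull of the queried points of S; sets that are convex are never rejected.
-- If S is far from convex, compare it with the hull H of its part in the middle
-- layers: up to the few points outside the middle layers, S differs from H only in
-- points of H \ S. With k of order ln(1/ε) such that 4⁻ᵏ < ε, and m of order √(n/k),
-- a Chernoff bound shows that W = 6mk = O(√(n ln(1/ε))) leaves at most half of a
-- fraction 4⁻ᵏ of the cube outside the middle layers. So H \ S has density at least
-- 4⁻ᵏ/2 there, 4ᵏ⁺¹ samples hit it with probability at least 2/3, and this takes
-- n^O(mk) queries. If k > n, querying the whole cube is within the budget.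
-- Hull membership is decided over ℚ by Farkas' lemma, whose separating functional
-- also rules out combinations with real coefficients.

module Submission where

open import Defs
open import Data.Nat.Base using (_≤_)
open import Data.Nat.Properties using (<⇒≤)
open import Data.Product.Base using (∃-syntax; _×_)

open import Algebra.Bundles using (CommutativeRing)
import Algebra.Properties.CommutativeSemiring.Exp as Exp
import Algebra.Properties.Semiring.Sum as Sum
open import Data.Bool.Base using (Bool; true; false; if_then_else_; not; _∧_; _∨_; _xor_; T)
open import Data.Bool.ListAction using (all)
open import Data.Bool.Properties using (T?; T-∧; T-∨; T-≡)
open import Data.Fin.Base as Fin using (Fin)
import Data.Integer.Base as ℤ
import Data.Integer.Properties as ℤ
open import Data.List.Base as List using (List; []; _∷_; length; filterᵇ; cartesianProductWith; concatMap)
import Data.List.Membership.Propositional as List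
open import Data.List.Membership.Propositional.Properties
open import Data.List.Properties using (length-++; length-map)
open import Data.List.Relation.Unary.All as All using (All)
open import Data.List.Relation.Unary.All.Properties using (all-filter; all⁺; all⁻)
open import Data.List.Relation.Unary.Any as Any using (here; there; index)
open import Data.List.Relation.Unary.Any.Properties using (lookup-index)
open import Data.Nat.Base as ℕ using (ℕ; zero; suc; s≤s; z≤n; _≤ᵇ_)
import Data.Nat.Properties as ℕ
open import Data.Nat.Solver using () renaming (module +-*-Solver to ℕ-Solver)
open import Data.Product.Base using (_,_; proj₁; proj₂)
open import Data.Rational.Base
  using (ℚ; 0ℚ; 1ℚ; ½; _+_; _*_; -_; _-_; _/_; positive; nonNegative)
  renaming (_≤_ to _≤ℚ_; _<_ to _<ℚ_)
import Data.Rational.Properties as ℚ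
open import Data.Rational.Solver using (module +-*-Solver)
open import Data.Rational.Unnormalised.Base as ℚᵘ using (*≡*)
import Data.Rational.Unnormalised.Properties as ℚᵘ
open import Data.Sum.Base using (_⊎_; inj₁; inj₂; [_,_]′)
open import Data.Unit.Base using (tt)
open import Data.Vec.Base as Vec using (Vec; []; _∷_)
open import Data.Vec.Functional as Vector using (Vector)
open import Data.Vec.Properties using (≡-dec)
open import Function.Base using (_∘_)
open import Function.Bundles using (Equivalence; mk⇔)
open import Relation.Binary.Definitions using (DecidableEquality; tri<; tri≈; tri>)
open import Relation.Binary.PropositionalEquality.Core
  using (_≡_; _≢_; refl; sym; trans; cong; cong₂; subst; subst₂)
open import Relation.Nullary.Decidable.Core using (Dec; yes; no; does)
open import Relation.Nullary.Negation.Core using (¬_; contradiction)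

open +-*-Solver using (solve; _:=_; _:+_; _:*_; _:-_; :-_; con)
open ℕ-Solver using () renaming (solve to ℕ-solve; _:+_ to _⊕_; _:*_ to _⊗_; _:=_ to _⊜_; con to ⟨_⟩)
open Exp (CommutativeRing.commutativeSemiring ℚ.+-*-commutativeRing)
  using (_^_; ^-distrib-*; ^-assocʳ; ^-homo-*)
open Sum (CommutativeRing.semiring ℚ.+-*-commutativeRing)
  using (sum; sum-cong-≗; sum-replicate-zero; ∑-distrib-+; ∑-comm; *-distribˡ-sum; *-distribʳ-sum)

-- Farkas' lemma over ℚ

sum-mono : ∀ {n} {f g : Vector ℚ n} → (∀ i → f i ≤ℚ g i) → sum f ≤ℚ sum g
sum-mono {zero}  f≤g = ℚ.≤-refl
sum-mono {suc n} f≤g = ℚ.+-mono-≤ (f≤g Fin.zero) (sum-mono (f≤g ∘ Fin.suc))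

sum-nonNeg : ∀ {n} {f : Vector ℚ n} → (∀ i → 0ℚ ≤ℚ f i) → 0ℚ ≤ℚ sum f
sum-nonNeg {zero}  0≤f = ℚ.≤-refl
sum-nonNeg {suc n} 0≤f = 0≤p+q (0≤f Fin.zero) (sum-nonNeg (0≤f ∘ Fin.suc))

term≤sum : ∀ {n} {f : Vector ℚ n} → (∀ i → 0ℚ ≤ℚ f i) → ∀ i → f i ≤ℚ sum f
term≤sum {suc n} 0≤f Fin.zero    = ≤-by _ (sum-nonNeg (0≤f ∘ Fin.suc)) refl
term≤sum {suc n} {f} 0≤f (Fin.suc i) =
  ℚ.≤-trans (term≤sum (0≤f ∘ Fin.suc) i) (≤-by (f Fin.zero) (0≤f Fin.zero) (ℚ.+-comm (f Fin.zero) (sum (f ∘ Fin.suc))))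

positive-term : ∀ {n} (f : Vector ℚ n) → 0ℚ <ℚ sum f → ∃[ i ] 0ℚ <ℚ f i
positive-term {zero}  f 0<0 = contradiction 0<0 (ℚ.<-irrefl refl)
positive-term {suc n} f 0<sum with 0ℚ ℚ.<? f Fin.zero
... | yes 0<f₀ = Fin.zero , 0<f₀
... | no  0≮f₀ = let (i , 0<fᵢ) = positive-term (f ∘ Fin.suc) (ℚ.<-≤-trans 0<sum f₀+s≤s) in Fin.suc i , 0<fᵢ
  where
  s = sum (f ∘ Fin.suc)
  f₀+s≤s : f Fin.zero + s ≤ℚ s
  f₀+s≤s = ≤-by (0ℚ - f Fin.zero) (≤⇒0≤ (ℚ.≮⇒≥ 0≮f₀))
    (solve 2 (λ a s → s := (a :+ s) :+ (con 0ℚ :- a)) refl (f Fin.zero) s)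

0≤-p : ∀ {p} → p ≤ℚ 0ℚ → 0ℚ ≤ℚ - p
0≤-p = ℚ.neg-antimono-≤

p*q≤0 : ∀ {p q} → 0ℚ ≤ℚ p → q ≤ℚ 0ℚ → p * q ≤ℚ 0ℚ
p*q≤0 {p} {q} 0≤p q≤0 = ≤-by (p * - q) (0≤p*q 0≤p (0≤-p q≤0))
  (solve 2 (λ p q → con 0ℚ := p :* q :+ p :* (:- q)) refl p q)

0<p*q⇒0<q : ∀ {p q} → 0ℚ ≤ℚ p → 0ℚ <ℚ p * q → 0ℚ <ℚ q
0<p*q⇒0<q 0≤p 0<pq = ℚ.≰⇒> λ q≤0 → ℚ.<-irrefl refl (ℚ.<-≤-trans 0<pq (p*q≤0 0≤p q≤0))

infix 8 _·_
_·_ : ∀ {d} → Vector ℚ d → Vector ℚ d → ℚ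
u · v = sum λ j → u j * v j

infixl 6 _+[_]_
_+[_]_ : ∀ {d} → Vector ℚ d → ℚ → Vector ℚ d → Vector ℚ d
(u +[ c ] v) j = u j + c * v j

·-comm : ∀ {d} (u v : Vector ℚ d) → u · v ≡ v · u
·-comm u v = sum-cong-≗ λ j → ℚ.*-comm (u j) (v j)

·-linearˡ : ∀ {d} (u v w : Vector ℚ d) c → (u +[ c ] v) · w ≡ u · w + c * v · w
·-linearˡ u v w c = trans
  (sum-cong-≗ λ j → solve 4 (λ u v w c → (u :+ c :* v) :* w := u :* w :+ c :* (v :* w)) refl (u j) (v j) (w j) c)
  (trans (∑-distrib-+ (λ j → u j * w j) (λ j → c * (v j * w j)))
    (cong (u · w +_) (sym (*-distribˡ-sum c (λ j → v j * w j)))))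

·-linearʳ : ∀ {d} (w u v : Vector ℚ d) c → w · (u +[ c ] v) ≡ w · u + c * w · v
·-linearʳ w u v c = trans (·-comm w (u +[ c ] v)) (trans (·-linearˡ u v w c)
  (cong₂ (λ s t → s + c * t) (·-comm u w) (·-comm v w)))

·-combination : ∀ {m d} (c : Vector ℚ m) (α : Fin m → Vector ℚ d) (x : Vector ℚ d) →
                (λ j → c · λ i → α i j) · x ≡ c · λ i → α i · x
·-combination c α x = trans
  (sum-cong-≗ λ j → *-distribʳ-sum (x j) (λ i → c i * α i j))
  (trans (∑-comm λ j i → c i * α i j * x j)
    (sum-cong-≗ λ i → trans (sum-cong-≗ λ j → ℚ.*-assoc (c i) (α i j) (x j))
      (sym (*-distribˡ-sum (c i) λ j → α i j * x j))))

InCone Separated : ∀ {m d} → (Fin m → Vector ℚ d) → Vector ℚ d → Set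
InCone α γ = ∃[ c ] (∀ i → 0ℚ ≤ℚ c i) × (∀ j → (c · λ i → α i j) ≡ γ j)
Separated α γ = ∃[ x ] (∀ i → α i · x ≤ℚ 0ℚ) × 0ℚ <ℚ γ · x

-- Bartl's inductive proof: if x separates the vectors after the first from γ
-- but is positive on the first vector α₀, eliminate α₀ by projecting along it
-- onto the hyperplane orthogonal to x, and recurse.
farkas : ∀ {m d} (α : Fin m → Vector ℚ d) (γ : Vector ℚ d) → InCone α γ ⊎ Separated α γ
-- Without generators the cone is 0, so a nonzero `γ` separates itself.
farkas {zero} α γ with 0ℚ ℚ.<? γ · γ
... | yes 0<γγ = inj₂ (γ , (λ ()) , 0<γγ)
... | no  0≮γγ = inj₁ ((λ ()) , (λ ()) , λ j → sym (square-zero (γ j) (ℚ.≤-trans (term≤sum (λ i → 0≤p*p (γ i)) j) (ℚ.≮⇒≥ 0≮γγ))))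
  where
  square-zero : ∀ p → p * p ≤ℚ 0ℚ → p ≡ 0ℚ
  square-zero p p²≤0 with ℚ.<-cmp p 0ℚ
  ... | tri< p<0 _ _ = contradiction (ℚ.<-≤-trans (subst (0ℚ <ℚ_) (solve 1 (λ p → (con 0ℚ :- p) :* (con 0ℚ :- p) := p :* p) refl p)
                         (0<p*q (<⇒0< p<0) (<⇒0< p<0))) p²≤0) (ℚ.<-irrefl refl)
  ... | tri≈ _ p≡0 _ = p≡0
  ... | tri> _ _ 0<p = contradiction (ℚ.<-≤-trans (0<p*q 0<p 0<p) p²≤0) (ℚ.<-irrefl refl)
farkas {suc m} α γ = extend (farkas (α ∘ Fin.suc) γ)
  where
  α₀ = α Fin.zero
  α₊ = α ∘ Fin.suc

  module Project (y : _) (neg : ∀ i → α₊ i · y ≤ℚ 0ℚ) (pos : 0ℚ <ℚ γ · y) (0<p : 0ℚ <ℚ α₀ · y) where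
    r = inv 0<p
    0≤r = ℚ.<⇒≤ (0<inv 0<p)
    -- Subtracting these multiples of `α₀` makes `α′ i` and `γ′` orthogonal to `y`.
    g = γ · y * r
    a : Fin m → ℚ
    a i = α₊ i · y * r
    α′ = λ i → α₊ i +[ - a i ] α₀
    γ′ = γ +[ - g ] α₀

    lift : InCone α′ γ′ → InCone α γ
    lift (c , 0≤c , eq) = c₀ Vector.∷ c , (λ { Fin.zero → 0≤c₀ ; (Fin.suc i) → 0≤c i }) , eq′
      where
      -- Undoing the projection puts this coefficient on `α₀`; it is nonnegative because `g` is
      -- positive and every `a i` is at most 0.
      c₀ = g + - (c · a)
      0≤c₀ : 0ℚ ≤ℚ c₀
      0≤c₀ = 0≤p+q (ℚ.<⇒≤ (0<p*q pos (0<inv 0<p))) (0≤-p (ℚ.≤-trans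
        (sum-mono λ i → p*q≤0 (0≤c i) (subst (_≤ℚ 0ℚ) (ℚ.*-comm r (α₊ i · y)) (p*q≤0 0≤r (neg i))))
        (ℚ.≤-reflexive (sum-replicate-zero m))))
      eq′ : ∀ j → c₀ * α₀ j + (c · λ i → α₊ i j) ≡ γ j
      eq′ j = trans (solve 4 (λ g s t b → (g :+ (:- s)) :* b :+ t := (t :+ (:- b) :* s) :+ g :* b) refl g (c · a) (c · λ i → α₊ i j) (α₀ j))
        (trans (cong (_+ g * α₀ j) (trans (sym (·-linearʳ c (λ i → α₊ i j) a (- α₀ j)))
          (trans (sum-cong-≗ λ i → cong (λ t → c i * (α₊ i j + t)) (solve 2 (λ b a → (:- b) :* a := (:- a) :* b) refl (α₀ j) (a i))) (eq j))))
          (solve 3 (λ γ g b → (γ :+ (:- g) :* b) :+ g :* b := γ) refl (γ j) g (α₀ j)))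

    drop : Separated α′ γ′ → Separated α γ
    drop (x , neg′ , pos′) = z
      , (λ { Fin.zero → ℚ.≤-reflexive (trans (·-linearʳ α₀ x y (- t)) kill)
           ; (Fin.suc i) → subst (_≤ℚ 0ℚ) (sym (same (α₊ i))) (neg′ i) })
      , subst (0ℚ <ℚ_) (sym (same γ)) pos′
      where
      -- Shifting `x` along `y` makes `α₀ · z` vanish; by `same`, this shift is adjoint to the
      -- projection along `α₀`.
      t = α₀ · x * r
      z = x +[ - t ] y
      kill : α₀ · x + - t * α₀ · y ≡ 0ℚ
      kill = trans (solve 3 (λ u r p → u :+ (:- (u :* r)) :* p := u :- u :* (p :* r)) refl (α₀ · x) r (α₀ · y))
        (trans (cong (λ v → α₀ · x - α₀ · x * v) (*-inv 0<p)) (solve 1 (λ u → u :- u :* con 1ℚ := con 0ℚ) refl (α₀ · x)))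
      same : ∀ β → β · z ≡ (β +[ - (β · y * r) ] α₀) · x
      same β = trans (·-linearʳ β x y (- t)) (trans
        (solve 4 (λ u v w r → u :+ (:- (w :* r)) :* v := u :+ (:- (v :* r)) :* w) refl (β · x) (β · y) (α₀ · x) r)
        (sym (·-linearˡ β α₀ x (- (β · y * r)))))

  extend : InCone α₊ γ ⊎ Separated α₊ γ → InCone α γ ⊎ Separated α γ
  extend (inj₁ (c , 0≤c , eq)) = inj₁ (0ℚ Vector.∷ c , (λ { Fin.zero → ℚ.≤-refl ; (Fin.suc i) → 0≤c i })
    , λ j → trans (cong (_+ (c · λ i → α₊ i j)) (ℚ.*-zeroˡ (α₀ j))) (trans (ℚ.+-identityˡ _) (eq j)))
  extend (inj₂ (y , neg , pos)) = decide ((α₀ · y) ℚ.≤? 0ℚ)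
    where
    decide : Dec (α₀ · y ≤ℚ 0ℚ) → InCone α γ ⊎ Separated α γ
    decide (yes α₀y≤0) = inj₂ (y , (λ { Fin.zero → α₀y≤0 ; (Fin.suc i) → neg i }) , pos)
    decide (no α₀y≰0)  = [ inj₁ ∘ lift , inj₂ ∘ drop ]′ (farkas α′ γ′)
      where open Project y neg pos (ℚ.≰⇒> α₀y≰0)

-- Convex hulls in the ternary cube

≤ᴿ-pointwise : ∀ x y → (∀ n → seq x n ≤ℚ seq y n) → x ≤ᴿ y
≤ᴿ-pointwise x y x≤y (lt ε 0<ε N y+ε≤x) =
  ℚ.<-irrefl refl (ℚ.<-≤-trans (<-by ε 0<ε refl) (ℚ.≤-trans (y+ε≤x N ℕ.≤-refl) (x≤y N)))

≃ᴿ-pointwise : ∀ x y → (∀ n → seq x n ≡ seq y n) → x ≃ᴿ y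
≃ᴿ-pointwise x y x≡y =
  ≤ᴿ-pointwise x y (ℚ.≤-reflexive ∘ x≡y) , ≤ᴿ-pointwise y x (ℚ.≤-reflexive ∘ sym ∘ x≡y)

seq-sumᴿ : ∀ {m} (f : Fin m → ℝ) n → seq (sumᴿ f) n ≡ sum λ i → seq (f i) n
seq-sumᴿ {zero}  f n = refl
seq-sumᴿ {suc m} f n = cong (seq (f Fin.zero) n +_) (seq-sumᴿ (f ∘ Fin.suc) n)

infix 4 _≲_
-- A positive form of asymptotic inequality between rational approximations. It passes through
-- finite sums and scaling, so functionals can be evaluated along the approximations of real
-- coefficients.
record _≲_ (s t : ℕ → ℚ) : Set where
  constructor eventually
  field
    within : ∀ δ → 0ℚ <ℚ δ → ∃[ N ] ∀ n → N ≤ n → s n ≤ℚ t n + δ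

open _≲_

≲-pointwise : ∀ {s t} → (∀ n → s n ≤ℚ t n) → s ≲ t
≲-pointwise {t = t} s≤t = eventually λ δ 0<δ → 0 , λ n _ → ℚ.≤-trans (s≤t n) (≤-by {t n} δ (ℚ.<⇒≤ 0<δ) refl)

≲-+ : ∀ {s t s′ t′} → s ≲ t → s′ ≲ t′ → (λ n → s n + s′ n) ≲ (λ n → t n + t′ n)
≲-+ {t = t} {t′ = t′} s≲t s′≲t′ = eventually λ δ 0<δ →
  let (M , s≤) = within s≲t (½ * δ) (0<half 0<δ)
      (N , s′≤) = within s′≲t′ (½ * δ) (0<half 0<δ)
  in M ℕ.⊔ N , λ n ≤n → ℚ.≤-trans
    (ℚ.+-mono-≤ (s≤ n (ℕ.m⊔n≤o⇒m≤o M N ≤n)) (s′≤ n (ℕ.m⊔n≤o⇒n≤o M N ≤n)))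
    (ℚ.≤-reflexive (solve 3 (λ a b δ → (a :+ con ½ :* δ) :+ (b :+ con ½ :* δ) := (a :+ b) :+ δ) refl (t n) (t′ n) δ))

≲-trans : ∀ {s t u} → s ≲ t → t ≲ u → s ≲ u
≲-trans {u = u} s≲t t≲u = eventually λ δ 0<δ →
  let (M , s≤) = within s≲t (½ * δ) (0<half 0<δ)
      (N , t≤) = within t≲u (½ * δ) (0<half 0<δ)
  in M ℕ.⊔ N , λ n ≤n → ℚ.≤-trans
    (ℚ.≤-trans (s≤ n (ℕ.m⊔n≤o⇒m≤o M N ≤n)) (ℚ.+-monoˡ-≤ (½ * δ) (t≤ n (ℕ.m⊔n≤o⇒n≤o M N ≤n))))
    (ℚ.≤-reflexive (solve 2 (λ a δ → (a :+ con ½ :* δ) :+ con ½ :* δ := a :+ δ) refl (u n) δ))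

≲-sum : ∀ {m} {s t : Fin m → ℕ → ℚ} → (∀ i → s i ≲ t i) → (λ n → sum λ i → s i n) ≲ (λ n → sum λ i → t i n)
≲-sum {zero}  s≲t = ≲-pointwise λ _ → ℚ.≤-refl
≲-sum {suc m} s≲t = ≲-+ (s≲t Fin.zero) (≲-sum (s≲t ∘ Fin.suc))

≲-scale : ∀ {s t c} → 0ℚ ≤ℚ c → s ≲ t → (λ n → s n * c) ≲ (λ n → t n * c)
≲-scale {s} {t} {c} 0≤c s≲t = eventually λ δ 0<δ →
  -- Dividing by `1 + c` rather than `c` covers `c = 0`.
  let 0<1+c = 0<p+q′ 0<1 0≤c
      η = inv 0<1+c * δ
      0<η = 0<p*q (0<inv 0<1+c) 0<δ
      (N , s≤) = within s≲t η 0<η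
  in N , λ n N≤n → ℚ.≤-trans (ℚ.*-monoʳ-≤-nonNeg c {{nonNegative 0≤c}} (s≤ n N≤n))
    (≤-by η (ℚ.<⇒≤ 0<η) (trans (cong (t n * c +_) (sym (inv-cancel 0<1+c δ)))
      (solve 3 (λ t c η → t :* c :+ (con 1ℚ :+ c) :* η := (t :+ η) :* c :+ η) refl (t n) c η)))

≲-neg : ∀ {s t c} → c ≤ℚ 0ℚ → s ≲ t → (λ n → t n * c) ≲ (λ n → s n * c)
≲-neg {s} {t} {c} c≤0 s≲t = eventually λ δ 0<δ →
  let (N , h) = within (≲-scale (0≤-p c≤0) s≲t) δ 0<δ
  in N , λ n N≤n → ≤-by ((t n * - c + δ) - s n * - c) (≤⇒0≤ (h n N≤n))
    (solve 4 (λ s t c δ → s :* c :+ δ := t :* c :+ ((t :* (:- c) :+ δ) :- s :* (:- c))) refl (s n) (t n) c δ)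

≲-const : ∀ {p q} → (λ _ → p) ≲ (λ _ → q) → p ≤ℚ q
≲-const {p} {q} p≲q = ℚ.≮⇒≥ λ q<p →
  let (N , h) = within p≲q (½ * (p - q)) (0<half (<⇒0< q<p))
  in ℚ.<-irrefl refl (ℚ.<-≤-trans
    (<-by {q + ½ * (p - q)} {p} (½ * (p - q)) (0<half (<⇒0< q<p))
      (solve 2 (λ p q → p := (q :+ con ½ :* (p :- q)) :+ con ½ :* (p :- q)) refl p q))
    (h N ℕ.≤-refl))

-- Past both Cauchy moduli for `δ/4`, an excess of `δ` at one index leaves an excess of `δ/2` at all
-- later ones, which would witness `y <ᴿ x`.
≤ᴿ⇒≲ : ∀ x y → x ≤ᴿ y → seq x ≲ seq y
≤ᴿ⇒≲ x y x≤y = eventually λ δ 0<δ →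
  let η = ½ * (½ * δ)
      0<η = 0<half (0<half 0<δ)
      (M , x-close) = cauchy x η 0<η
      (K , y-close) = cauchy y η 0<η
      M≤ : ∀ {n} → M ℕ.⊔ K ≤ n → M ≤ n
      M≤ = ℕ.m⊔n≤o⇒m≤o M K
      K≤ : ∀ {n} → M ℕ.⊔ K ≤ n → K ≤ n
      K≤ = ℕ.m⊔n≤o⇒n≤o M K
  in M ℕ.⊔ K , λ n N≤n → ℚ.≮⇒≥ λ y+δ<x → x≤y (lt (½ * δ) (0<half 0<δ) (M ℕ.⊔ K) λ k N≤k →
    let x< = proj₁ (abs-split {seq x n} {seq x k} (x-close n k (M≤ N≤n) (M≤ N≤k)))
        y< = proj₁ (abs-split {seq y k} {seq y n} (y-close k n (K≤ N≤k) (K≤ N≤n)))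
    in ≤-by ((seq x k + η - seq x n) + (seq y n + η - seq y k) + (seq x n - (seq y n + δ)))
         (0≤p+q (0≤p+q (ℚ.<⇒≤ (<⇒0< x<)) (ℚ.<⇒≤ (<⇒0< y<))) (ℚ.<⇒≤ (<⇒0< y+δ<x)))
         (solve 5 (λ xk xn yk yn δ → xk := (yk :+ con ½ :* δ) :+
           ((xk :+ con ½ :* (con ½ :* δ) :- xn) :+ (yn :+ con ½ :* (con ½ :* δ) :- yk) :+ (xn :- (yn :+ δ)))) refl
           (seq x k) (seq x n) (seq y k) (seq y n) δ))

-- Hulls of ternary sets and their separating functionals

toℚ : Trit → ℚ
toℚ t = seq (toℝ t) 0

seq-toℝ : ∀ t n → seq (toℝ t) n ≡ toℚ t
seq-toℝ -1ᵗ n = refl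
seq-toℝ 0ᵗ  n = refl
seq-toℝ +1ᵗ n = refl

-- The leading coordinate 1 forces the coefficients of a conic combination to sum to 1. Cone
-- membership thus becomes hull membership, and linear functionals become affine ones.
homogenize : ∀ {n} → Point n → Vector ℚ (suc n)
homogenize x = 1ℚ Vector.∷ λ j → toℚ (Vec.lookup x j)

trits : List Trit
trits = -1ᵗ ∷ 0ᵗ ∷ +1ᵗ ∷ []

∈-trits : ∀ t → t List.∈ trits
∈-trits -1ᵗ = here refl
∈-trits 0ᵗ  = there (here refl)
∈-trits +1ᵗ = there (there (here refl))

∈-points : ∀ {n} (x : Point n) → x List.∈ points n
∈-points []       = here refl
∈-points (t ∷ x) = ∈-cartesianProductWith⁺ _∷_ (∈-trits t) (∈-points x)

infix 4 _⊆_
_⊆_ : ∀ {n} → TernarySet n → TernarySet n → Set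
S ⊆ S′ = ∀ x → x ∈ S → x ∈ S′

module _ {n : ℕ} (S : TernarySet n) where

  members : List (Point n)
  members = filterᵇ S (points n)

  member : Fin (length members) → Point n
  member = List.lookup members

  member∈ : ∀ i → member i ∈ S
  member∈ i = All.lookup (all-filter (T? ∘ S) (points n)) (∈-lookup {xs = members} i)

  ∈⇒member : ∀ y → y ∈ S → ∃[ i ] y ≡ member i
  ∈⇒member y y∈S =
    let y∈members = ∈-filter⁺ (T? ∘ S) (∈-points y) y∈S
    in index y∈members , lookup-index y∈members

  hull-cases : ∀ x → InCone (homogenize ∘ member) (homogenize x) ⊎ Separated (homogenize ∘ member) (homogenize x)
  hull-cases x = farkas (homogenize ∘ member) (homogenize x)

  -- Such a `z` is an affine halfspace containing `S`.
  Bound : Vector ℚ (suc n) → Set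
  Bound z = ∀ y → y ∈ S → homogenize y · z ≤ℚ 0ℚ

  abstract

    hull : TernarySet n
    hull x = [ (λ _ → true) , (λ _ → false) ]′ (hull-cases x)

    hull-combination : ∀ x → x ∈ hull → InCone (homogenize ∘ member) (homogenize x)
    hull-combination x x∈ with hull-cases x
    ... | inj₁ combination = combination

    hull-separator : ∀ x → ¬ x ∈ hull → ∃[ z ] Bound z × 0ℚ <ℚ homogenize x · z
    hull-separator x x∉ with hull-cases x
    ... | inj₁ _ = contradiction _ x∉
    ... | inj₂ (z , neg , pos) = z , (λ y y∈S → let (i , y≡) = ∈⇒member y y∈S in
            subst (λ y → homogenize y · z ≤ℚ 0ℚ) (sym y≡) (neg i)) , pos

  -- The dual route into the hull: testing functionals replaces the search for rational
  -- coefficients.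
  by-separation : ∀ x → (∀ z → Bound z → homogenize x · z ≤ℚ 0ℚ) → x ∈ hull
  by-separation x bounded with T? (hull x)
  ... | yes x∈ = x∈
  ... | no x∉ = let (z , bound , pos) = hull-separator x x∉ in
          contradiction (ℚ.<-≤-trans pos (bounded z bound)) (ℚ.<-irrefl refl)

  ⊆-hull : S ⊆ hull
  ⊆-hull x x∈S = by-separation x λ z bound → bound x x∈S

  combination-value : ∀ x ((c , _) : InCone (homogenize ∘ member) (homogenize x)) z →
                      homogenize x · z ≡ c · λ i → homogenize (member i) · z
  combination-value x (c , _ , eq) z = trans
    (sum-cong-≗ λ j → cong (_* z j) (sym (eq j))) (·-combination c (homogenize ∘ member) z)

  hull-bound : ∀ z → Bound z → ∀ x → x ∈ hull → homogenize x · z ≤ℚ 0ℚ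
  hull-bound z bound x x∈ =
    let combination@(c , 0≤c , _) = hull-combination x x∈
    in ℚ.≤-trans (ℚ.≤-reflexive (combination-value x combination z))
      (ℚ.≤-trans (sum-mono λ i → p*q≤0 (0≤c i) (bound (member i) (member∈ i)))
        (ℚ.≤-reflexive (sum-replicate-zero (length members))))

  hull⊆Conv : ∀ x → x ∈ hull → Conv S (embed x)
  hull⊆Conv x x∈ =
    let (c , 0≤c , eq) = hull-combination x x∈
    in length members , member , fromℚ ∘ c , member∈
     , (λ i → ≤ᴿ-pointwise 0ᴿ (fromℚ (c i)) λ _ → 0≤c i)
     , ≃ᴿ-pointwise (sumᴿ (fromℚ ∘ c)) 1ᴿ (λ k → trans (seq-sumᴿ (fromℚ ∘ c) k)
         (trans (sum-cong-≗ λ i → sym (ℚ.*-identityʳ (c i))) (eq Fin.zero)))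
     , λ j → ≃ᴿ-pointwise (sumᴿ λ i → fromℚ (c i) *ᴿ embed (member i) j) (embed x j) λ k →
         trans (seq-sumᴿ (λ i → fromℚ (c i) *ᴿ embed (member i) j) k)
           (trans (sum-cong-≗ λ i → cong (c i *_) (seq-toℝ (Vec.lookup (member i) j) k))
             (trans (eq (Fin.suc j)) (sym (seq-toℝ (Vec.lookup x j) k))))

  ⊆-Conv : ∀ x → x ∈ S → Conv S (embed x)
  ⊆-Conv x x∈S = 1 , (λ _ → x) , (λ _ → 1ᴿ) , (λ _ → x∈S)
    , (λ _ → ≤ᴿ-pointwise 0ᴿ 1ᴿ λ _ → ℚ.<⇒≤ 0<1)
    , ≃ᴿ-pointwise (1ᴿ +ᴿ 0ᴿ) 1ᴿ (λ _ → ℚ.+-identityʳ 1ℚ)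
    , λ j → ≃ᴿ-pointwise (1ᴿ *ᴿ embed x j +ᴿ 0ᴿ) (embed x j) λ k →
        trans (ℚ.+-identityʳ _) (ℚ.*-identityˡ (seq (embed x j) k))

  -- The value of `z` at `x` is the limit of the sums of `c i` times the values of `z` at `y i`,
  -- taken along the approximations of the `c i`. These weights are asymptotically nonnegative and
  -- the values at most 0.
  Conv-bound : ∀ z → Bound z → ∀ x → Conv S (embed x) → homogenize x · z ≤ℚ 0ℚ
  Conv-bound z bound x (m , y , c , y∈S , 0≤c , (c≤1 , 1≤c) , combination) = ≲-const
    (≲-trans {t = λ n → sum λ j → coordinate j n * z j} (≲-sum term)
      (≲-trans (≲-pointwise λ n → ℚ.≤-reflexive (·-combination (λ i → seq (c i) n) (homogenize ∘ y) z))
        (≲-trans (≲-sum λ i → ≲-neg (bound (y i) (y∈S i)) (≤ᴿ⇒≲ 0ᴿ (c i) (0≤c i)))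
          (≲-pointwise λ n → ℚ.≤-reflexive (trans (sum-cong-≗ λ i → ℚ.*-zeroˡ (homogenize (y i) · z)) (sum-replicate-zero m))))))
    where
    coordinate : Fin (suc n) → ℕ → ℚ
    coordinate j k = (λ i → seq (c i) k) · λ i → homogenize (y i) j
    coordinate-zero : ∀ k → seq (sumᴿ c) k ≡ coordinate Fin.zero k
    coordinate-zero k = trans (seq-sumᴿ c k) (sum-cong-≗ λ i → sym (ℚ.*-identityʳ (seq (c i) k)))
    coordinate-suc : ∀ j k → seq (sumᴿ λ i → c i *ᴿ embed (y i) j) k ≡ coordinate (Fin.suc j) k
    coordinate-suc j k = trans (seq-sumᴿ (λ i → c i *ᴿ embed (y i) j) k)
      (sum-cong-≗ λ i → cong (seq (c i) k *_) (seq-toℝ (Vec.lookup (y i) j) k))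
    resp : ∀ {s t u v : ℕ → ℚ} → (∀ k → s k ≡ u k) → (∀ k → t k ≡ v k) → s ≲ t → u ≲ v
    resp s≡u t≡v s≲t = ≲-trans (≲-pointwise λ k → ℚ.≤-reflexive (sym (s≡u k)))
      (≲-trans s≲t (≲-pointwise λ k → ℚ.≤-reflexive (t≡v k)))
    upper : ∀ j → coordinate j ≲ λ _ → homogenize x j
    upper Fin.zero    = resp coordinate-zero (λ _ → refl) (≤ᴿ⇒≲ (sumᴿ c) 1ᴿ c≤1)
    upper (Fin.suc j) = resp (coordinate-suc j) (seq-toℝ (Vec.lookup x j))
      (≤ᴿ⇒≲ (sumᴿ λ i → c i *ᴿ embed (y i) j) (embed x j) (proj₁ (combination j)))
    lower : ∀ j → (λ _ → homogenize x j) ≲ coordinate j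
    lower Fin.zero    = resp (λ _ → refl) coordinate-zero (≤ᴿ⇒≲ 1ᴿ (sumᴿ c) 1≤c)
    lower (Fin.suc j) = resp (seq-toℝ (Vec.lookup x j)) (coordinate-suc j)
      (≤ᴿ⇒≲ (embed x j) (sumᴿ λ i → c i *ᴿ embed (y i) j) (proj₂ (combination j)))
    -- The sign of `z j` decides which half of the equality in coordinate `j` is needed.
    term : ∀ j → (λ _ → homogenize x j * z j) ≲ λ k → coordinate j k * z j
    term j with ℚ.≤-total 0ℚ (z j)
    ... | inj₁ 0≤z = ≲-scale 0≤z (lower j)
    ... | inj₂ z≤0 = ≲-neg z≤0 (upper j)

-- A halfspace containing `S` contains `hull S`, hence also every real combination of points of
-- `hull S`.
hull-convex : ∀ {n} (S : TernarySet n) → Convex (hull S)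
hull-convex S x = mk⇔ (⊆-Conv (hull S) x) λ x∈Conv →
  by-separation S x λ z bound → Conv-bound (hull S) z (hull-bound S z bound) x x∈Conv

Conv-mono : ∀ {n} {S S′ : TernarySet n} → S ⊆ S′ → ∀ {v} → Conv S v → Conv S′ v
Conv-mono S⊆S′ (m , y , c , y∈S , rest) = m , y , c , (λ i → S⊆S′ (y i) (y∈S i)) , rest

infix 4 _extends_
-- The points extending `x` are the ternary points of the smallest face of the cube `[-1,1]^n` that
-- contains `x`.
_extends_ : ∀ {n} → Point n → Point n → Set
y extends x = ∀ j → Vec.lookup x j ≢ 0ᵗ → Vec.lookup y j ≡ Vec.lookup x j

-- For nonzero `s`, the functional `1 - s t` supports the interval `[-1,1]` at its endpoint `s`.
slack-nonNeg : ∀ s t → 0ℚ ≤ℚ 1ℚ + - toℚ s * toℚ t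
slack-nonNeg -1ᵗ -1ᵗ = ℚ.≤-refl
slack-nonNeg -1ᵗ 0ᵗ  = ℚ.<⇒≤ 0<1
slack-nonNeg -1ᵗ +1ᵗ = 0≤ι 2
slack-nonNeg 0ᵗ  -1ᵗ = ℚ.<⇒≤ 0<1
slack-nonNeg 0ᵗ  0ᵗ  = ℚ.<⇒≤ 0<1
slack-nonNeg 0ᵗ  +1ᵗ = ℚ.<⇒≤ 0<1
slack-nonNeg +1ᵗ -1ᵗ = 0≤ι 2
slack-nonNeg +1ᵗ 0ᵗ  = ℚ.<⇒≤ 0<1
slack-nonNeg +1ᵗ +1ᵗ = ℚ.≤-refl

slack-tight : ∀ s t → s ≢ 0ᵗ → 1ℚ + - toℚ s * toℚ t ≤ℚ 0ℚ → t ≡ s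
slack-tight -1ᵗ -1ᵗ _ _ = refl
slack-tight -1ᵗ 0ᵗ  _ h = contradiction (ℚ.<-≤-trans 0<1 h) (ℚ.<-irrefl refl)
slack-tight -1ᵗ +1ᵗ _ h = contradiction (ℚ.<-≤-trans (0<ι 1) h) (ℚ.<-irrefl refl)
slack-tight 0ᵗ  t   0≢0 _ = contradiction refl 0≢0
slack-tight +1ᵗ -1ᵗ _ h = contradiction (ℚ.<-≤-trans (0<ι 1) h) (ℚ.<-irrefl refl)
slack-tight +1ᵗ 0ᵗ  _ h = contradiction (ℚ.<-≤-trans 0<1 h) (ℚ.<-irrefl refl)
slack-tight +1ᵗ +1ᵗ _ _ = refl

slack-self : ∀ s → s ≢ 0ᵗ → 1ℚ + - toℚ s * toℚ s ≡ 0ℚ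
slack-self -1ᵗ _   = refl
slack-self 0ᵗ  0≢0 = contradiction refl 0≢0
slack-self +1ᵗ _   = refl

-- On a nonzero coordinate x takes an extreme value, so every point that
-- contributes to a convex combination equal to x agrees with x there.
hull-face : ∀ {n} (S S′ : TernarySet n) x → (∀ y → y ∈ S → y extends x → y ∈ S′) → x ∈ hull S → x ∈ hull S′
hull-face S S′ x S⊆S′ x∈ = by-separation S′ x λ z bound → ℚ.≮⇒≥ λ 0<xz →
  -- A functional positive at `x` is positive at some contributing point, which extends `x` and so
  -- lies in `S′`, against `bound`.
  let (i , 0<cᵢyᵢz) = positive-term (λ i → c i * homogenize (member S i) · z)
        (subst (0ℚ <ℚ_) (combination-value S x combination z) 0<xz)
      y = member S i
      0<yz = 0<p*q⇒0<q (0≤c i) 0<cᵢyᵢz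
      0<cᵢ = 0<p*q⇒0<q (ℚ.<⇒≤ 0<yz) (subst (0ℚ <ℚ_) (ℚ.*-comm (c i) (homogenize y · z)) 0<cᵢyᵢz)
  in ℚ.<-irrefl refl (ℚ.<-≤-trans 0<yz (bound y (S⊆S′ y (member∈ S i) (agrees i 0<cᵢ))))
  where
  combination = hull-combination S x x∈
  c = proj₁ combination
  0≤c = proj₁ (proj₂ combination)
  eq = proj₂ (proj₂ combination)
  agrees : ∀ i → 0ℚ <ℚ c i → member S i extends x
  agrees i 0<cᵢ j xⱼ≢0 = slack-tight xⱼ (Vec.lookup (member S i) j) xⱼ≢0 (ℚ.≮⇒≥ λ 0<slack →
    ℚ.<-irrefl refl (ℚ.<-≤-trans (0<p*q 0<cᵢ 0<slack)
      (ℚ.≤-trans (term≤sum (λ i → 0≤p*q (0≤c i) (slack-nonNeg xⱼ (Vec.lookup (member S i) j))) i)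
        (ℚ.≤-reflexive total))))
    where
    xⱼ = Vec.lookup x j
    -- The weighted slacks sum to the slack of `x` itself, which is 0; being nonnegative, each of
    -- them vanishes.
    total : (c · λ i → 1ℚ + - toℚ xⱼ * toℚ (Vec.lookup (member S i) j)) ≡ 0ℚ
    total = trans (·-linearʳ c (λ _ → 1ℚ) (λ i → toℚ (Vec.lookup (member S i) j)) (- toℚ xⱼ))
      (trans (cong₂ (λ s t → s + - toℚ xⱼ * t) (eq Fin.zero) (eq (Fin.suc j))) (slack-self xⱼ xⱼ≢0))

-- Sums over lists and words

ι-+ : ∀ m n → ι (m ℕ.+ n) ≡ ι m + ι n
ι-+ zero    n = sym (ℚ.+-identityˡ (ι n))
ι-+ (suc m) n = trans (ι-suc (m ℕ.+ n)) (trans (cong (1ℚ +_) (ι-+ m n))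
  (trans (sym (ℚ.+-assoc 1ℚ (ι m) (ι n))) (cong (_+ ι n) (sym (ι-suc m)))))

ι-* : ∀ m n → ι (m ℕ.* n) ≡ ι m * ι n
ι-* zero    n = sym (ℚ.*-zeroˡ (ι n))
ι-* (suc m) n = trans (ι-+ n (m ℕ.* n)) (trans (cong (ι n +_) (ι-* m n))
  (trans (solve 2 (λ n mn → n :+ mn := con 1ℚ :* n :+ mn) refl (ι n) (ι m * ι n))
    (trans (sym (ℚ.*-distribʳ-+ (ι n) 1ℚ (ι m))) (cong (_* ι n) (sym (ι-suc m))))))

ι-^ : ∀ m n → ι (m ℕ.^ n) ≡ ι m ^ n
ι-^ m zero    = refl
ι-^ m (suc n) = trans (ι-* m (m ℕ.^ n)) (cong (ι m *_) (ι-^ m n))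

/-ι : ∀ m n .{{_ : ℕ.NonZero n}} → ((ℤ.+ m) / n) * ι n ≡ ι m
/-ι m n@(suc d) = ℚ.toℚᵘ-injective (ℚᵘ.≃-trans (ℚ.toℚᵘ-homo-* ((ℤ.+ m) / n) (ι n))
  (ℚᵘ.≃-trans (ℚᵘ.*-cong (ℚ.toℚᵘ-fromℚᵘ (ℚᵘ.mkℚᵘ (ℤ.+ m) d)) (ℚ.toℚᵘ-fromℚᵘ (ℚᵘ.mkℚᵘ (ℤ.+ n) 0)))
  (ℚᵘ.≃-trans (*≡* (ℤ.*-assoc (ℤ.+ m) (ℤ.+ n) (ℤ.+ 1)))
  (ℚᵘ.≃-sym (ℚ.toℚᵘ-fromℚᵘ (ℚᵘ.mkℚᵘ (ℤ.+ m) 0))))))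

private variable A B C : Set

∑ : List A → (A → ℚ) → ℚ
∑ xs f = sum (f ∘ List.lookup xs)

∑-cong : ∀ (xs : List A) {f g : A → ℚ} → (∀ x → f x ≡ g x) → ∑ xs f ≡ ∑ xs g
∑-cong xs f≡g = sum-cong-≗ (f≡g ∘ List.lookup xs)

∑-mono : ∀ (xs : List A) {f g : A → ℚ} → (∀ x → f x ≤ℚ g x) → ∑ xs f ≤ℚ ∑ xs g
∑-mono xs f≤g = sum-mono (f≤g ∘ List.lookup xs)

∑-++ : ∀ (xs ys : List A) f → ∑ (xs List.++ ys) f ≡ ∑ xs f + ∑ ys f
∑-++ []       ys f = sym (ℚ.+-identityˡ (∑ ys f))
∑-++ (x ∷ xs) ys f = trans (cong (f x +_) (∑-++ xs ys f)) (sym (ℚ.+-assoc (f x) (∑ xs f) (∑ ys f)))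

∑-map : ∀ (h : A → B) xs f → ∑ (List.map h xs) f ≡ ∑ xs (f ∘ h)
∑-map h []       f = refl
∑-map h (x ∷ xs) f = cong (f (h x) +_) (∑-map h xs f)

∑-cartesianProductWith : ∀ (h : A → B → C) xs ys f →
                         ∑ (cartesianProductWith h xs ys) f ≡ ∑ xs λ x → ∑ ys λ y → f (h x y)
∑-cartesianProductWith h []       ys f = refl
∑-cartesianProductWith h (x ∷ xs) ys f = trans (∑-++ (List.map (h x) ys) (cartesianProductWith h xs ys) f)
  (cong₂ _+_ (∑-map (h x) ys f) (∑-cartesianProductWith h xs ys f))

∑-one : ∀ (xs : List A) → ∑ xs (λ _ → 1ℚ) ≡ ι (length xs)
∑-one []       = refl
∑-one (x ∷ xs) = trans (cong (1ℚ +_) (∑-one xs)) (sym (ι-suc (length xs)))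

words : List A → ∀ k → List (Vec A k)
words xs zero    = [] ∷ []
words xs (suc k) = cartesianProductWith _∷_ xs (words xs k)

points≡words : ∀ n → points n ≡ words trits n
points≡words zero    = refl
points≡words (suc n) = cong (cartesianProductWith _∷_ trits) (points≡words n)

∏ : (A → ℚ) → ∀ {k} → Vec A k → ℚ
∏ g []      = 1ℚ
∏ g (x ∷ v) = g x * ∏ g v

-- Independence of the letters. It yields both the moment generating function on the cube and the
-- probability that all samples miss.
∑-words : ∀ (xs : List A) g k → ∑ (words xs k) (∏ g) ≡ ∑ xs g ^ k
∑-words xs g zero    = refl
∑-words xs g (suc k) = trans (∑-cartesianProductWith _∷_ xs (words xs k) (∏ g))
  (trans (∑-cong xs λ x → trans (sym (*-distribˡ-sum (g x) (∏ g ∘ List.lookup (words xs k)))) (cong (g x *_) (∑-words xs g k)))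
    (sym (*-distribʳ-sum (∑ xs g ^ k) (g ∘ List.lookup xs))))

length-words : ∀ (xs : List A) k → ι (length (words xs k)) ≡ ι (length xs) ^ k
length-words xs k = trans (sym (∑-one (words xs k))) (trans (∑-cong (words xs k) (sym ∘ ∏-one))
  (trans (∑-words xs (λ _ → 1ℚ) k) (cong (_^ k) (∑-one xs))))
  where
  ∏-one : ∀ {k} (v : Vec _ k) → ∏ (λ _ → 1ℚ) v ≡ 1ℚ
  ∏-one []      = refl
  ∏-one (x ∷ v) = trans (ℚ.*-identityˡ _) (∏-one v)

length-cartesianProductWith : ∀ (f : A → B → C) xs ys →
                              length (cartesianProductWith f xs ys) ≡ length xs ℕ.* length ys
length-cartesianProductWith f []       ys = refl
length-cartesianProductWith f (x ∷ xs) ys = trans (length-++ (List.map (f x) ys))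
  (cong₂ ℕ._+_ (length-map (f x) ys) (length-cartesianProductWith f xs ys))

length-points : ∀ n → length (points n) ≡ 3 ℕ.^ n
length-points zero    = refl
length-points (suc n) = trans (length-cartesianProductWith _∷_ trits (points n)) (cong (3 ℕ.*_) (length-points n))

𝟙 : Bool → ℚ
𝟙 b = if b then 1ℚ else 0ℚ

0≤𝟙 : ∀ b → 0ℚ ≤ℚ 𝟙 b
0≤𝟙 true  = ℚ.<⇒≤ 0<1
0≤𝟙 false = ℚ.≤-refl

𝟙≤1 : ∀ b → 𝟙 b ≤ℚ 1ℚ
𝟙≤1 true  = ℚ.≤-refl
𝟙≤1 false = ℚ.<⇒≤ 0<1

length-filterᵇ : ∀ p (xs : List A) → ι (length (filterᵇ p xs)) ≡ ∑ xs (𝟙 ∘ p)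
length-filterᵇ p []       = refl
length-filterᵇ p (x ∷ xs) with p x
... | true  = trans (ι-suc (length (filterᵇ p xs))) (cong (1ℚ +_) (length-filterᵇ p xs))
... | false = trans (length-filterᵇ p xs) (sym (ℚ.+-identityˡ (∑ xs (𝟙 ∘ p))))

∑-complement : ∀ p (xs : List A) → ∑ xs (𝟙 ∘ not ∘ p) ≡ ι (length xs) - ∑ xs (𝟙 ∘ p)
∑-complement p xs = trans (solve 2 (λ a b → b := (a :+ b) :- a) refl (∑ xs (𝟙 ∘ p)) (∑ xs (𝟙 ∘ not ∘ p)))
  (cong (_- ∑ xs (𝟙 ∘ p)) (trans (sym (∑-distrib-+ (𝟙 ∘ p ∘ List.lookup xs) (𝟙 ∘ not ∘ p ∘ List.lookup xs)))
    (trans (∑-cong xs (λ x → either (p x))) (∑-one xs))))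
  where
  either : ∀ b → 𝟙 b + 𝟙 (not b) ≡ 1ℚ
  either true  = refl
  either false = refl

∑-markov : ∀ (xs : List A) p f {θ} → (∀ x → 0ℚ ≤ℚ f x) → (∀ x → T (p x) → θ ≤ℚ f x) → ∑ xs (𝟙 ∘ p) * θ ≤ℚ ∑ xs f
∑-markov xs p f {θ} 0≤f θ≤f = ℚ.≤-trans (ℚ.≤-reflexive (*-distribʳ-sum θ (𝟙 ∘ p ∘ List.lookup xs))) (∑-mono xs bound)
  where
  bound : ∀ x → 𝟙 (p x) * θ ≤ℚ f x
  bound x with p x | θ≤f x
  ... | true  | θ≤ = ℚ.≤-trans (ℚ.≤-reflexive (ℚ.*-identityˡ θ)) (θ≤ _)
  ... | false | _  = ℚ.≤-trans (ℚ.≤-reflexive (ℚ.*-zeroˡ θ)) (0≤f x)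

-- The tester attached to a list of query sets

_≟_ : DecidableEquality Trit
-1ᵗ ≟ -1ᵗ = yes refl
-1ᵗ ≟ 0ᵗ  = no λ ()
-1ᵗ ≟ +1ᵗ = no λ ()
0ᵗ  ≟ -1ᵗ = no λ ()
0ᵗ  ≟ 0ᵗ  = yes refl
0ᵗ  ≟ +1ᵗ = no λ ()
+1ᵗ ≟ -1ᵗ = no λ ()
+1ᵗ ≟ 0ᵗ  = no λ ()
+1ᵗ ≟ +1ᵗ = yes refl

T-not⁻ : ∀ {b} → T (not b) → ¬ T b
T-not⁻ {false} _ ()

T-not⁺ : ∀ {b} → ¬ T b → T (not b)
T-not⁺ {false} _  = tt
T-not⁺ {true}  ¬t = ¬t tt

module _ {n : ℕ} where

  positives : (qs : List (Point n)) → Vec Bool (length qs) → TernarySet n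
  -- Points never queried count as outside, which keeps this set inside `S`.
  positives []       []       y = false
  positives (q ∷ qs) (b ∷ bs) y = if does (≡-dec _≟_ y q) then b else positives qs bs y

  responses : TernarySet n → (qs : List (Point n)) → Vec Bool (length qs)
  responses S qs = Vec.map S (Vec.fromList qs)

  positives-⊆ : ∀ S qs → positives qs (responses S qs) ⊆ S
  positives-⊆ S (q ∷ qs) y y∈ with ≡-dec _≟_ y q
  ... | yes refl = y∈
  ... | no  _    = positives-⊆ S qs y y∈

  ∈-positives : ∀ S qs {y} → y List.∈ qs → y ∈ S → y ∈ positives qs (responses S qs)
  ∈-positives S (q ∷ qs) {y} y∈qs y∈S with ≡-dec _≟_ y q | y∈qs
  ... | yes refl | _         = y∈S
  ... | no  y≢q  | here y≡q  = contradiction y≡q y≢q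
  ... | no  _    | there y∈ = ∈-positives S qs y∈ y∈S

  verdict : (qs : List (Point n)) → TernarySet n → Bool
  verdict qs S = all (λ q → S q ∨ not (hull S q)) qs

  consistent : TernarySet n → List (Point n) → Bool
  consistent S qs = verdict qs (positives qs (responses S qs))

  -- The positive answers form a subset of `S`, so by convexity their hull cannot leave `S`.
  convex⇒consistent : ∀ S → Convex S → ∀ qs → consistent S qs ≡ true
  convex⇒consistent S convex qs = Equivalence.to T-≡ (all⁻ _ (All.tabulate accepted))
    where
    S′ = positives qs (responses S qs)
    accepted : ∀ {q} → q List.∈ qs → T (S′ q ∨ not (hull S′ q))
    accepted {q} q∈qs with T? (hull S′ q)
    ... | yes q∈hull = Equivalence.from T-∨ (inj₁ (∈-positives S qs q∈qs
            (Equivalence.from (convex q) (Conv-mono (positives-⊆ S qs) (hull⊆Conv S′ q q∈hull)))))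
    ... | no  q∉hull = Equivalence.from T-∨ (inj₂ (T-not⁺ q∉hull))

  violation⇒inconsistent : ∀ S qs {q} → q List.∈ qs → ¬ q ∈ S → q ∈ hull (positives qs (responses S qs)) →
                           T (not (consistent S qs))
  violation⇒inconsistent S qs {q} q∈qs q∉S q∈hull = T-not⁺ λ ok →
    [ (λ q∈S′ → q∉S (positives-⊆ S qs q q∈S′)) , (λ q∉hull → T-not⁻ q∉hull q∈hull) ]′
      (Equivalence.to T-∨ (All.lookup (all⁺ _ qs ok) q∈qs))

  -- The coins are positions in `qss` with uniform weight `r`, so probabilities are counts over the
  -- list, repetitions included.
  module Tester (qss : List (List (Point n))) (nonempty : 0ℚ <ℚ ι (length qss)) where

    r = inv nonempty

    seq-uniform : ∀ k → seq (sumᴿ {length qss} λ _ → fromℚ r) k ≡ 1ℚ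
    seq-uniform k = trans (seq-sumᴿ {length qss} (λ _ → fromℚ r) k)
      (trans (sum-cong-≗ {length qss} λ _ → sym (ℚ.*-identityʳ r))
        (trans (sym (*-distribˡ-sum {length qss} r (λ _ → 1ℚ)))
          (trans (cong (r *_) (∑-one qss)) (trans (ℚ.*-comm r (ι (length qss))) (*-inv nonempty)))))

    tester : NonAdaptiveAlgorithm n
    tester = record
      { outcomes    = length qss
      ; prob        = λ _ → fromℚ r
      ; prob-nonNeg = λ _ → ≤ᴿ-pointwise 0ᴿ (fromℚ r) λ _ → ℚ.<⇒≤ (0<inv nonempty)
      ; prob-total  = ≃ᴿ-pointwise (sumᴿ {length qss} λ _ → fromℚ r) 1ᴿ seq-uniform
      ; queries     = List.lookup qss
      ; accepts     = λ ω bs → verdict (List.lookup qss ω) (positives (List.lookup qss ω) bs)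
      }

    open NonAdaptiveAlgorithm tester

    seq-Pr : ∀ (e : List (Point n) → Bool) k → seq (Pr (e ∘ List.lookup qss)) k ≡ r * ∑ qss (𝟙 ∘ e)
    seq-Pr e k = trans (seq-sumᴿ (λ ω → if e (List.lookup qss ω) then fromℚ r else 0ᴿ) k)
      (trans (∑-cong qss λ qs → scale (e qs)) (sym (*-distribˡ-sum r (𝟙 ∘ e ∘ List.lookup qss))))
      where
      scale : ∀ b → seq (if b then fromℚ r else 0ᴿ) k ≡ r * 𝟙 b
      scale true  = sym (ℚ.*-identityʳ r)
      scale false = sym (ℚ.*-zeroʳ r)

    accepts-convex : ∀ S → Convex S → Pr (acceptsOn S) ≃ᴿ 1ᴿ
    accepts-convex S convex = ≃ᴿ-pointwise (Pr (acceptsOn S)) 1ᴿ λ k → trans (seq-Pr (consistent S) k)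
      (trans (cong (r *_) (trans (∑-cong qss λ qs → cong 𝟙 (convex⇒consistent S convex qs)) (∑-one qss)))
        (trans (ℚ.*-comm r (ι (length qss))) (*-inv nonempty)))

    rejects-often : ∀ S → ∑ qss (𝟙 ∘ consistent S) * ι 3 ≤ℚ ι (length qss) → fromℚ ((ℤ.+ 2) / 3) ≤ᴿ Pr (not ∘ acceptsOn S)
    rejects-often S few = ≤ᴿ-pointwise (fromℚ ((ℤ.+ 2) / 3)) (Pr (not ∘ acceptsOn S)) λ k →
      ℚ.≤-trans bound (ℚ.≤-reflexive (sym (seq-Pr (not ∘ consistent S) k)))
      where
      a = ∑ qss (𝟙 ∘ consistent S)
      N = ι (length qss)
      r*few : 0ℚ ≤ℚ ⅓ * (r * (N - a * ι 3))
      r*few = 0≤p*q (ℚ.<⇒≤ 0<⅓) (0≤p*q (ℚ.<⇒≤ (0<inv nonempty)) (≤⇒0≤ few))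
      bound : (ℤ.+ 2) / 3 ≤ℚ r * ∑ qss (𝟙 ∘ not ∘ consistent S)
      bound = ≤-by (⅓ * (r * (N - a * ι 3))) r*few (trans (cong (r *_) (∑-complement (consistent S) qss))
        (trans (solve 3 (λ r N a → r :* (N :- a) := con ((ℤ.+ 2) / 3) :* (N :* r) :+ con ⅓ :* (r :* (N :- a :* con (ι 3)))) refl r N a)
          (cong (_+ ⅓ * (r * (N - a * ι 3))) (trans (cong ((ℤ.+ 2) / 3 *_) (*-inv nonempty)) (ℚ.*-identityʳ _)))))

-- A rational `ρ` strictly below `ε` turns farness into a count: a distance below `ρ` would be below
-- `ε`, and comparison of rationals is decidable.
far⇒disagreement : ∀ {n} (S S′ : TernarySet n) {ε} ρ → FarFromConvex ε S → Convex S′ → fromℚ ρ <ᴿ ε →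
                   ρ * ι (3 ℕ.^ n) ≤ℚ ∑ (points n) λ x → 𝟙 (S x xor S′ x)
far⇒disagreement {n} S S′ ρ far convex (lt g 0<g N ρ+g≤) = begin
  ρ * ι (3 ℕ.^ n)                        ≤⟨ ℚ.*-monoʳ-≤-nonNeg (ι (3 ℕ.^ n)) {{nonNegative (0≤ι (3 ℕ.^ n))}} ρ≤d ⟩
  d * ι (3 ℕ.^ n)                        ≡⟨ /-ι ∣ S △ S′ ∣ (3 ℕ.^ n) ⟩
  ι ∣ S △ S′ ∣                           ≡⟨ length-filterᵇ (λ x → S x xor S′ x) (points n) ⟩
  ∑ (points n) (λ x → 𝟙 (S x xor S′ x))  ∎
  where
  open ℚ.≤-Reasoning
  instance _ = ℕ.m^n≢0 3 n
  d = (ℤ.+ ∣ S △ S′ ∣) / (3 ℕ.^ n)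
  ρ≤d : ρ ≤ℚ d
  ρ≤d = ℚ.≮⇒≥ λ d<ρ → far S′ convex (lt g 0<g N λ k N≤k →
    ℚ.≤-trans (ℚ.+-monoˡ-≤ g (ℚ.<⇒≤ d<ρ)) (ρ+g≤ k N≤k))

-- Detectable violations of convexity inside a set of layers

module _ {n : ℕ} (S G : TernarySet n) where

  inner : TernarySet n
  inner x = S x ∧ G x

  bad : TernarySet n
  bad x = G x ∧ (hull inner x ∧ not (S x))

  -- By `hull-face`, `x` stays in the hull of those points of `inner` that extend it, and all of
  -- these are queried.
  bad⇒inconsistent : ∀ qs x → x ∈ bad → x List.∈ qs → (∀ y → y ∈ G → y extends x → y List.∈ qs) → T (not (consistent S qs))
  bad⇒inconsistent qs x x-bad x∈qs queried =
    let (_ , rest) = Equivalence.to (T-∧ {G x}) x-bad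
        (x∈hull , x∉S) = Equivalence.to (T-∧ {hull inner x}) rest
    in violation⇒inconsistent S qs x∈qs (T-not⁻ x∉S) (hull-face inner _ x
         (λ y y∈ y-ext → let (y∈S , y∈G) = Equivalence.to (T-∧ {S y}) y∈ in ∈-positives S qs (queried y y∈G y-ext) y∈S) x∈hull)

  -- Compare `S` with the convex set `hull inner`. Inside `G` it contains `S`, so a disagreement
  -- there is a bad point; the rest is charged to the complement of `G`.
  far⇒many-bad : ∀ {ε} ρ → FarFromConvex ε S → fromℚ ρ <ᴿ ε →
                 ρ * ι (3 ℕ.^ n) ≤ℚ ∑ (points n) (𝟙 ∘ bad) + ∑ (points n) (𝟙 ∘ not ∘ G)
  far⇒many-bad {ε} ρ far ρ<ε = ℚ.≤-trans (far⇒disagreement S (hull inner) {ε} ρ far (hull-convex inner) ρ<ε)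
    (ℚ.≤-trans (∑-mono (points n) pointwise)
      (ℚ.≤-reflexive (∑-distrib-+ (𝟙 ∘ bad ∘ List.lookup (points n)) (𝟙 ∘ not ∘ G ∘ List.lookup (points n)))))
    where
    pointwise : ∀ x → 𝟙 (S x xor hull inner x) ≤ℚ 𝟙 (bad x) + 𝟙 (not (G x))
    pointwise x = cases (G x) (S x) (hull inner x) λ x∈S x∈G → ⊆-hull inner x (Equivalence.from T-∧ (x∈S , x∈G))
      where
      cases : ∀ g s h → (T s → T g → T h) → 𝟙 (s xor h) ≤ℚ 𝟙 (g ∧ (h ∧ not s)) + 𝟙 (not g)
      cases false true  h     _ = 𝟙≤1 (not h)
      cases false false h     _ = 𝟙≤1 h
      cases true  true  true  _ = ℚ.≤-refl
      cases true  true  false i = contradiction (i tt tt) λ ()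
      cases true  false true  _ = ℚ.≤-refl
      cases true  false false _ = ℚ.≤-refl

-- Hamming balls and middle layers

total : (Trit → ℕ) → ∀ {n} → Point n → ℕ
total w []      = 0
total w (t ∷ x) = w t ℕ.+ total w x

zeroᵗ nonzeroᵗ : Trit → ℕ
zeroᵗ 0ᵗ = 1
zeroᵗ _  = 0
nonzeroᵗ 0ᵗ = 0
nonzeroᵗ _  = 1

zeros nonzeros : ∀ {n} → Point n → ℕ
zeros    = total zeroᵗ
nonzeros = total nonzeroᵗ

nonzeros+zeros : ∀ {n} (x : Point n) → nonzeros x ℕ.+ zeros x ≡ n
nonzeros+zeros []         = refl
nonzeros+zeros (-1ᵗ ∷ x) = cong suc (nonzeros+zeros x)
nonzeros+zeros (0ᵗ ∷ x)  = trans (ℕ.+-suc (nonzeros x) (zeros x)) (cong suc (nonzeros+zeros x))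
nonzeros+zeros (+1ᵗ ∷ x) = cong suc (nonzeros+zeros x)

-- A rewritten coordinate may receive its old value, so entries can repeat; only membership and the
-- length bound matter.
ball : ∀ {n} → ℕ → Point n → List (Point n)
ball d       []      = [] ∷ []
ball zero    (t ∷ x) = List.map (t ∷_) (ball zero x)
ball (suc d) (t ∷ x) = List.map (t ∷_) (ball (suc d) x) List.++ cartesianProductWith _∷_ trits (ball d x)

∈-ball-same : ∀ {n} d t (x : Point n) {y} → y List.∈ ball d x → (t ∷ y) List.∈ ball d (t ∷ x)
∈-ball-same zero    t x y∈ = ∈-map⁺ (t ∷_) y∈
∈-ball-same (suc d) t x y∈ = ∈-++⁺ˡ (∈-map⁺ (t ∷_) y∈)

∈-ball-change : ∀ {n} d s t (x : Point n) {y} → y List.∈ ball d x → (t ∷ y) List.∈ ball (suc d) (s ∷ x)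
∈-ball-change d s t x y∈ = ∈-++⁺ʳ (List.map (s ∷_) (ball (suc d) x)) (∈-cartesianProductWith⁺ _∷_ (∈-trits t) y∈)

∈-ball-centre : ∀ {n} d (x : Point n) → x List.∈ ball d x
∈-ball-centre d []      = here refl
∈-ball-centre d (t ∷ x) = ∈-ball-same d t x (∈-ball-centre d x)

nonzeros-extends : ∀ {n} (x y : Point n) → y extends x → nonzeros x ≤ nonzeros y
nonzeros-extends []         []        ext = z≤n
nonzeros-extends (0ᵗ ∷ x)  (t ∷ y)   ext = ℕ.≤-trans (nonzeros-extends x y (ext ∘ Fin.suc)) (ℕ.m≤n+m (nonzeros y) (nonzeroᵗ t))
nonzeros-extends (-1ᵗ ∷ x) (t ∷ y) ext with refl ← ext Fin.zero (λ ()) = s≤s (nonzeros-extends x y (ext ∘ Fin.suc))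
nonzeros-extends (+1ᵗ ∷ x) (t ∷ y) ext with refl ← ext Fin.zero (λ ()) = s≤s (nonzeros-extends x y (ext ∘ Fin.suc))

-- The points differ only where `y` fills a zero of `x`, which happens `nonzeros y - nonzeros x`
-- times.
extends⇒∈-ball : ∀ {n} d (x y : Point n) → y extends x → nonzeros y ≤ nonzeros x ℕ.+ d → y List.∈ ball d x

extends⇒∈-ball-flip : ∀ {n} d t (x y : Point n) → y extends x → suc (nonzeros y) ≤ nonzeros x ℕ.+ d →
                      (t ∷ y) List.∈ ball d (0ᵗ ∷ x)
-- With no radius left, one more filled zero would exceed the allowed number of nonzeros.
extends⇒∈-ball-flip zero    t x y ext ≤d =
  contradiction (nonzeros-extends x y ext) (ℕ.<⇒≱ (subst (nonzeros y ℕ.<_) (ℕ.+-identityʳ (nonzeros x)) ≤d))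
extends⇒∈-ball-flip (suc d) t x y ext ≤d =
  ∈-ball-change d 0ᵗ t x (extends⇒∈-ball d x y ext (ℕ.s≤s⁻¹ (subst (suc (nonzeros y) ≤_) (ℕ.+-suc (nonzeros x) d) ≤d)))

extends⇒∈-ball d []        []        ext _  = here refl
extends⇒∈-ball d (0ᵗ ∷ x)  (0ᵗ ∷ y)  ext ≤d = ∈-ball-same d 0ᵗ x (extends⇒∈-ball d x y (ext ∘ Fin.suc) ≤d)
extends⇒∈-ball d (0ᵗ ∷ x)  (-1ᵗ ∷ y) ext ≤d = extends⇒∈-ball-flip d -1ᵗ x y (ext ∘ Fin.suc) ≤d
extends⇒∈-ball d (0ᵗ ∷ x)  (+1ᵗ ∷ y) ext ≤d = extends⇒∈-ball-flip d +1ᵗ x y (ext ∘ Fin.suc) ≤d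
extends⇒∈-ball d (-1ᵗ ∷ x) (t ∷ y)   ext ≤d with refl ← ext Fin.zero (λ ()) =
  ∈-ball-same d -1ᵗ x (extends⇒∈-ball d x y (ext ∘ Fin.suc) (ℕ.s≤s⁻¹ ≤d))
extends⇒∈-ball d (+1ᵗ ∷ x) (t ∷ y)   ext ≤d with refl ← ext Fin.zero (λ ()) =
  ∈-ball-same d +1ᵗ x (extends⇒∈-ball d x y (ext ∘ Fin.suc) (ℕ.s≤s⁻¹ ≤d))

-- Each unit of radius costs one choice: no change, or one of 3 trits at one of `n` places.
length-ball : ∀ {n} d (x : Point n) → length (ball d x) ≤ (1 ℕ.+ 3 ℕ.* n) ℕ.^ d
length-ball d [] = ℕ.≤-reflexive (sym (ℕ.^-zeroˡ d))
length-ball zero (t ∷ x) = ℕ.≤-trans (ℕ.≤-reflexive (length-map (t ∷_) (ball zero x))) (length-ball zero x)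
length-ball {suc n} (suc d) (t ∷ x) = begin
  length (List.map (t ∷_) (ball (suc d) x) List.++ cartesianProductWith _∷_ trits (ball d x))
    ≡⟨ length-++ (List.map (t ∷_) (ball (suc d) x)) ⟩
  length (List.map (t ∷_) (ball (suc d) x)) ℕ.+ length (cartesianProductWith _∷_ trits (ball d x))
    ≡⟨ cong₂ ℕ._+_ (length-map (t ∷_) (ball (suc d) x)) (length-cartesianProductWith _∷_ trits (ball d x)) ⟩
  length (ball (suc d) x) ℕ.+ 3 ℕ.* length (ball d x)
    ≤⟨ ℕ.+-mono-≤ (length-ball (suc d) x) (ℕ.*-monoʳ-≤ 3 (length-ball d x)) ⟩
  (1 ℕ.+ 3 ℕ.* n) ℕ.* (1 ℕ.+ 3 ℕ.* n) ℕ.^ d ℕ.+ 3 ℕ.* (1 ℕ.+ 3 ℕ.* n) ℕ.^ d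
    ≡⟨ ℕ.*-distribʳ-+ ((1 ℕ.+ 3 ℕ.* n) ℕ.^ d) (1 ℕ.+ 3 ℕ.* n) 3 ⟨
  (1 ℕ.+ 3 ℕ.* n ℕ.+ 3) ℕ.* (1 ℕ.+ 3 ℕ.* n) ℕ.^ d
    ≡⟨ cong (ℕ._* (1 ℕ.+ 3 ℕ.* n) ℕ.^ d) (next n) ⟩
  (1 ℕ.+ 3 ℕ.* suc n) ℕ.* (1 ℕ.+ 3 ℕ.* n) ℕ.^ d
    ≤⟨ ℕ.*-monoʳ-≤ (1 ℕ.+ 3 ℕ.* suc n) (ℕ.^-monoˡ-≤ d (s≤s (ℕ.*-monoʳ-≤ 3 (ℕ.n≤1+n n)))) ⟩
  (1 ℕ.+ 3 ℕ.* suc n) ℕ.* (1 ℕ.+ 3 ℕ.* suc n) ℕ.^ d ∎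
  where
  open ℕ.≤-Reasoning
  next : ∀ n → 1 ℕ.+ 3 ℕ.* n ℕ.+ 3 ≡ 1 ℕ.+ 3 ℕ.* suc n
  next = ℕ-solve 1 (λ n → ⟨ 1 ⟩ ⊕ ⟨ 3 ⟩ ⊗ n ⊕ ⟨ 3 ⟩ ⊜ ⟨ 1 ⟩ ⊕ ⟨ 3 ⟩ ⊗ (⟨ 1 ⟩ ⊕ n)) refl

-- Counts are tripled to avoid the fractional means `2n/3` and `n/3`; `1 ℕ.* n` matches `e = 1` in
-- `tail`. The bound on zeros serves as a lower bound on nonzeros.
middle : ∀ {n} → ℕ → TernarySet n
middle {n} W x = (3 ℕ.* nonzeros x ≤ᵇ 2 ℕ.* n ℕ.+ W) ∧ (3 ℕ.* zeros x ≤ᵇ 1 ℕ.* n ℕ.+ W)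

-- The two bounds leave `nonzeros y - nonzeros x` at most `2W/3`, relaxed here to `W`.
middle⇒∈-ball : ∀ {n} W (x y : Point n) → x ∈ middle W → y ∈ middle W → y extends x → y List.∈ ball W x
middle⇒∈-ball {n} W x y x∈ y∈ ext = extends⇒∈-ball W x y ext (ℕ.*-cancelˡ-≤ 3 (ℕ.+-cancelʳ-≤ (3 ℕ.* zeros x) _ _ (begin
  3 ℕ.* nonzeros y ℕ.+ 3 ℕ.* zeros x                 ≤⟨ ℕ.+-mono-≤ (ℕ.≤ᵇ⇒≤ (3 ℕ.* nonzeros y) _ (proj₁ y-bounds)) (ℕ.≤ᵇ⇒≤ (3 ℕ.* zeros x) _ (proj₂ x-bounds)) ⟩
  (2 ℕ.* n ℕ.+ W) ℕ.+ (1 ℕ.* n ℕ.+ W)                ≤⟨ ℕ.m≤m+n _ W ⟩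
  (2 ℕ.* n ℕ.+ W) ℕ.+ (1 ℕ.* n ℕ.+ W) ℕ.+ W          ≡⟨ cong (λ n → (2 ℕ.* n ℕ.+ W) ℕ.+ (1 ℕ.* n ℕ.+ W) ℕ.+ W) (sym (nonzeros+zeros x)) ⟩
  (2 ℕ.* (nonzeros x ℕ.+ zeros x) ℕ.+ W) ℕ.+ (1 ℕ.* (nonzeros x ℕ.+ zeros x) ℕ.+ W) ℕ.+ W
                                                     ≡⟨ identity (nonzeros x) (zeros x) W ⟩
  3 ℕ.* (nonzeros x ℕ.+ W) ℕ.+ 3 ℕ.* zeros x         ∎)))
  where
  open ℕ.≤-Reasoning
  x-bounds = Equivalence.to (T-∧ {3 ℕ.* nonzeros x ≤ᵇ 2 ℕ.* n ℕ.+ W}) x∈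
  y-bounds = Equivalence.to (T-∧ {3 ℕ.* nonzeros y ≤ᵇ 2 ℕ.* n ℕ.+ W}) y∈
  identity : ∀ a b W → (2 ℕ.* (a ℕ.+ b) ℕ.+ W) ℕ.+ (1 ℕ.* (a ℕ.+ b) ℕ.+ W) ℕ.+ W ≡ 3 ℕ.* (a ℕ.+ W) ℕ.+ 3 ℕ.* b
  identity = ℕ-solve 3 (λ a b W → (⟨ 2 ⟩ ⊗ (a ⊕ b) ⊕ W) ⊕ (⟨ 1 ⟩ ⊗ (a ⊕ b) ⊕ W) ⊕ W ⊜ ⟨ 3 ⟩ ⊗ (a ⊕ W) ⊕ ⟨ 3 ⟩ ⊗ b) refl

-- Amplification and concentration

^-monoʳ-≤ : ∀ {p m n} → 1ℚ ≤ℚ p → m ≤ n → p ^ m ≤ℚ p ^ n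
^-monoʳ-≤ {n = n} 1≤p z≤n = 1≤^ 1≤p n
^-monoʳ-≤ {p} {suc m} {suc n} 1≤p (s≤s m≤n) =
  *-mono-≤′ (ℚ.<⇒≤ (ℚ.<-≤-trans 0<1 1≤p)) (0≤^ (ℚ.<⇒≤ (ℚ.<-≤-trans 0<1 1≤p)) m) ℚ.≤-refl (^-monoʳ-≤ 1≤p m≤n)

*-cancelʳ-≤ : ∀ {p q r} → 0ℚ <ℚ r → p * r ≤ℚ q * r → p ≤ℚ q
*-cancelʳ-≤ {r = r} 0<r = ℚ.*-cancelʳ-≤-pos r {{positive 0<r}}

inv-unique : ∀ {p x} (0<p : 0ℚ <ℚ p) → p * x ≡ 1ℚ → x ≡ inv 0<p
inv-unique {p} {x} 0<p px≡1 = trans (sym (inv-cancel 0<p x))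
  (trans (solve 3 (λ p i x → p :* (i :* x) := i :* (p :* x)) refl p (inv 0<p) x)
    (trans (cong (inv 0<p *_) px≡1) (ℚ.*-identityʳ (inv 0<p))))

-- Multiplying by `(1 - 1/2)²`, a factor of `bounds-product` at exponent 1, gives at most 1.
compound≤4 : ∀ n → (1ℚ + 1/suc n) ^ suc n ≤ℚ ι 4
compound≤4 n = *-cancelʳ-≤ {r = ½ * ½} (0<p*q 0<½ 0<½) (subst (λ p → p * (½ * ½) ≤ℚ 1ℚ)
  (cong (λ p → (1ℚ + p) ^ suc n) (ℚ.*-identityˡ (1/suc n)))
  (bounds-product 1 n 1ℚ (ℚ.<-≤-trans 0<1 (≤-by (1ℚ * 1/suc n) (0≤p*q (ℚ.<⇒≤ 0<1) (ℚ.<⇒≤ (0<1/suc n))) refl)) 0<½))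

-- Again `bounds-product` at exponent 1, now against the factor `1 + 1`.
discount≤½ : ∀ n → (1ℚ - 1/suc (suc n)) ^ suc (suc n) ≤ℚ ½
discount≤½ n = *-cancelʳ-≤ {r = ι 2} (0<ι 1) (subst (_≤ℚ 1ℚ)
  (trans (ℚ.*-comm (ι 2) ((1ℚ - 1ℚ * 1/suc (suc n)) ^ suc (suc n)))
    (cong (λ p → (1ℚ - p) ^ suc (suc n) * ι 2) (ℚ.*-identityˡ (1/suc (suc n)))))
  (bounds-product (suc n) 0 1ℚ (0<ι 1) (0<1-p/n {1ℚ} (suc n) (<-by (ι (suc n)) (0<ι n) (ι-suc (suc n))))))

-- A sample misses a set of density at least `1/M` with probability at most `1 - 1/M`. Then `M`
-- samples all miss with probability at most 1/2, and `2M` with probability at most 1/4, below 1/3.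
miss-twice : ∀ {a N b} M → 2 ≤ M → 0ℚ ≤ℚ a → 0ℚ ≤ℚ N → a ≡ N - b → N ≤ℚ ι M * b →
             a ^ (M ℕ.+ M) * ι 3 ≤ℚ N ^ (M ℕ.+ M)
miss-twice {a} {N} {b} M@(suc (suc n)) (s≤s (s≤s _)) 0≤a 0≤N a≡N-b N≤Mb = begin
  a ^ (M ℕ.+ M) * ι 3                  ≤⟨ *-mono-≤′ (0≤^ 0≤a (M ℕ.+ M)) (0≤ι 3) (^-mono-≤ 0≤a a≤ (M ℕ.+ M)) ℚ.≤-refl ⟩
  (N * v) ^ (M ℕ.+ M) * ι 3            ≡⟨ cong (_* ι 3) (trans (^-distrib-* N v (M ℕ.+ M)) (cong (N ^ (M ℕ.+ M) *_) (^-homo-* v M M))) ⟩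
  N ^ (M ℕ.+ M) * (v ^ M * v ^ M) * ι 3 ≤⟨ *-mono-≤′ (0≤p*q 0≤Nᴹ (0≤p*q 0≤vᴹ 0≤vᴹ)) (0≤ι 3)
                                            (*-mono-≤′ 0≤Nᴹ (0≤p*q 0≤vᴹ 0≤vᴹ) ℚ.≤-refl
                                              (*-mono-≤′ 0≤vᴹ 0≤vᴹ (discount≤½ n) (discount≤½ n))) ℚ.≤-refl ⟩
  N ^ (M ℕ.+ M) * (½ * ½) * ι 3        ≡⟨ ℚ.*-assoc (N ^ (M ℕ.+ M)) (½ * ½) (ι 3) ⟩
  N ^ (M ℕ.+ M) * (½ * ½ * ι 3)        ≤⟨ *-mono-≤′ 0≤Nᴹ (0≤p*q (0≤p*q (ℚ.<⇒≤ 0<½) (ℚ.<⇒≤ 0<½)) (0≤ι 3)) ℚ.≤-refl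
                                            (≤-by (½ * ½) (0≤p*q (ℚ.<⇒≤ 0<½) (ℚ.<⇒≤ 0<½)) refl) ⟩
  N ^ (M ℕ.+ M) * 1ℚ                   ≡⟨ ℚ.*-identityʳ (N ^ (M ℕ.+ M)) ⟩
  N ^ (M ℕ.+ M)                        ∎
  where
  open ℚ.≤-Reasoning
  u = 1/suc (suc n)
  v = 1ℚ - u
  0≤v : 0ℚ ≤ℚ v
  0≤v = ℚ.<⇒≤ (subst (λ p → 0ℚ <ℚ 1ℚ - p) (ℚ.*-identityˡ u) (0<1-p/n {1ℚ} (suc n) (<-by (ι (suc n)) (0<ι n) (ι-suc (suc n)))))
  0≤vᴹ = 0≤^ 0≤v M
  0≤Nᴹ = 0≤^ 0≤N (M ℕ.+ M)
  a≤ : a ≤ℚ N * v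
  a≤ = ≤-by (u * (ι M * b - N)) (0≤p*q (ℚ.<⇒≤ (0<1/suc (suc n))) (≤⇒0≤ N≤Mb))
    (trans (solve 4 (λ N u m b → N :* (con 1ℚ :- u) := N :- (m :* u) :* b :+ u :* (m :* b :- N)) refl N u (ι M) b)
      (cong (_+ u * (ι M * b - N)) (trans (cong (λ t → N - t * b) (ι*1/suc (suc n)))
        (trans (cong (λ t → N - t) (ℚ.*-identityˡ b)) (sym a≡N-b)))))

-- One query set for each `K`-tuple of centres, so a uniform entry amounts to `K` independent
-- uniform centres.
samples : ∀ n → ℕ → ℕ → List (List (Point n))
samples n W K = List.map (λ v → concatMap (ball W) (Vec.toList v)) (words (points n) K)

∏-nonNeg : ∀ (g : A → ℚ) → (∀ x → 0ℚ ≤ℚ g x) → ∀ {k} (v : Vec A k) → 0ℚ ≤ℚ ∏ g v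
∏-nonNeg g 0≤g []      = ℚ.<⇒≤ 0<1
∏-nonNeg g 0≤g (x ∷ v) = 0≤p*q (0≤g x) (∏-nonNeg g 0≤g v)

find-or-∏ : ∀ (p : A → Bool) {k} (v : Vec A k) → (∃[ x ] x List.∈ Vec.toList v × T (p x)) ⊎ ∏ (𝟙 ∘ not ∘ p) v ≡ 1ℚ
find-or-∏ p []      = inj₂ refl
find-or-∏ p (x ∷ v) with p x in px | find-or-∏ p v
... | true  | _                      = inj₁ (x , here refl , Equivalence.from T-≡ px)
... | false | inj₁ (y , y∈v , py)  = inj₁ (y , there y∈v , py)
... | false | inj₂ eq               = inj₂ (trans (ℚ.*-identityˡ _) eq)

-- A bad centre forces rejection, so consistency is dominated by the product of the indicators of
-- missing, which `∑-words` sums.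
samples-consistent : ∀ {n} (S : TernarySet n) W K →
  ∑ (samples n W K) (𝟙 ∘ consistent S) ≤ℚ ∑ (points n) (𝟙 ∘ not ∘ bad S (middle W)) ^ K
samples-consistent {n} S W K = ℚ.≤-trans (ℚ.≤-reflexive (∑-map (λ v → concatMap (ball W) (Vec.toList v)) (words (points n) K) (𝟙 ∘ consistent S)))
  (ℚ.≤-trans (∑-mono (words (points n) K) pointwise) (ℚ.≤-reflexive (∑-words (points n) (𝟙 ∘ not ∘ bad S (middle W)) K)))
  where
  detects : ∀ v x → x List.∈ Vec.toList v → x ∈ bad S (middle W) →
            T (not (consistent S (concatMap (ball W) (Vec.toList v))))
  detects v x x∈v x-bad = bad⇒inconsistent S (middle W) (concatMap (ball W) (Vec.toList {n = K} v)) x x-bad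
    (queried x (∈-ball-centre W x))
    λ y y∈G y-ext → queried y (middle⇒∈-ball W x y (proj₁ (Equivalence.to (T-∧ {middle W x}) x-bad)) y∈G y-ext)
    where
    queried : ∀ y → y List.∈ ball W x → y List.∈ concatMap (ball W) (Vec.toList v)
    queried y y∈ = ∈-concatMap⁺ (ball W) (Any.map (λ { refl → y∈ }) x∈v)
  pointwise : ∀ v → 𝟙 (consistent S (concatMap (ball W) (Vec.toList v))) ≤ℚ ∏ (𝟙 ∘ not ∘ bad S (middle W)) v
  pointwise v with find-or-∏ (bad S (middle W)) v
  ... | inj₂ eq = ℚ.≤-trans (𝟙≤1 (consistent S (concatMap (ball W) (Vec.toList v)))) (ℚ.≤-reflexive (sym eq))
  ... | inj₁ (x , x∈v , x-bad) = ℚ.≤-trans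
    (zero-case (consistent S (concatMap (ball W) (Vec.toList v))) (detects v x x∈v x-bad))
    (∏-nonNeg (𝟙 ∘ not ∘ bad S (middle W)) (λ x → 0≤𝟙 (not (bad S (middle W) x))) v)
    where
    zero-case : ∀ b → T (not b) → 𝟙 b ≤ℚ 0ℚ
    zero-case false _ = ℚ.≤-refl

-- Chernoff bounds with exponential base ℓ = 1 + 1/m. As n ≤ m²k, the second-order
-- factor (1 + 1/m²)ⁿ of the moment generating function is at most 4ᵏ.
module Tail (m′ k n : ℕ) (n≤m²k : n ≤ suc m′ ℕ.* suc m′ ℕ.* k) where

  m = suc m′
  t = 1/suc m′
  ℓ = 1ℚ + t

  0≤t : 0ℚ ≤ℚ t
  0≤t = ℚ.<⇒≤ (0<1/suc m′)

  1≤ℓ : 1ℚ ≤ℚ ℓ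
  1≤ℓ = ≤-by t 0≤t refl

  0<ℓ : 0ℚ <ℚ ℓ
  0<ℓ = ℚ.<-≤-trans 0<1 1≤ℓ

  Q : ℚ
  Q = ι 4 ^ k

  0<Q : 0ℚ <ℚ Q
  0<Q = 0<^ (0<ι 3) k

  second-order : (1ℚ + t * t) ^ n ≤ℚ Q
  second-order = begin
    (1ℚ + t * t) ^ n                ≤⟨ ^-monoʳ-≤ (≤-by (t * t) (0≤p*p t) refl) n≤m²k ⟩
    (1ℚ + t * t) ^ (m ℕ.* m ℕ.* k)  ≡⟨ ^-assocʳ (1ℚ + t * t) (m ℕ.* m) k ⟨
    ((1ℚ + t * t) ^ (m ℕ.* m)) ^ k  ≡⟨ cong (λ p → ((1ℚ + p) ^ (m ℕ.* m)) ^ k) t²≡ ⟩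
    ((1ℚ + 1/suc (m′ ℕ.+ m′ ℕ.* m)) ^ (m ℕ.* m)) ^ k
                                    ≤⟨ ^-mono-≤ (0≤^ (0≤p+q (ℚ.<⇒≤ 0<1) (ℚ.<⇒≤ (0<1/suc (m′ ℕ.+ m′ ℕ.* m)))) (m ℕ.* m))
                                         (compound≤4 (m′ ℕ.+ m′ ℕ.* m)) k ⟩
    Q                               ∎
    where
    open ℚ.≤-Reasoning
    -- `suc (m′ ℕ.+ m′ ℕ.* m)` is `m ℕ.* m` by computation, so `compound≤4` applies to `1/m²`.
    t²≡ : t * t ≡ 1/suc (m′ ℕ.+ m′ ℕ.* m)
    t²≡ = inv-unique (0<ι (m′ ℕ.+ m′ ℕ.* m)) (trans (cong (_* (t * t)) (ι-* m m))
      (trans (solve 2 (λ i t → i :* i :* (t :* t) := (i :* t) :* (i :* t)) refl (ι m) t)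
        (cong (λ p → p * p) (ι*1/suc m′))))

  2≤ℓᵐ : ι 2 ≤ℚ ℓ ^ m
  2≤ℓᵐ = subst (_≤ℚ ℓ ^ m) (cong (1ℚ +_) (ι*1/suc m′)) (bernoulli (ℚ.<⇒≤ 0<ℓ) m)

  -- As `ℓ ^ m` is at least 2, `ℓ ^ W` is at least `2^(6k) = Q³`. One `Q` absorbs the second-order
  -- factor; two remain as the tail bound.
  W : ℕ
  W = m ℕ.* (6 ℕ.* k)

  64^k≤ℓᵂ : Q * Q * Q ≤ℚ ℓ ^ W
  64^k≤ℓᵂ = begin
    Q * Q * Q             ≡⟨ trans (cong (_* Q) (sym (^-distrib-* (ι 4) (ι 4) k))) (sym (^-distrib-* (ι 4 * ι 4) (ι 4) k)) ⟩
    (ι 2 ^ 6) ^ k         ≡⟨ ^-assocʳ (ι 2) 6 k ⟩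
    ι 2 ^ (6 ℕ.* k)       ≤⟨ ^-mono-≤ (0≤ι 2) 2≤ℓᵐ (6 ℕ.* k) ⟩
    (ℓ ^ m) ^ (6 ℕ.* k)   ≡⟨ ^-assocʳ ℓ m (6 ℕ.* k) ⟩
    ℓ ^ W                 ∎
    where open ℚ.≤-Reasoning

  N : ℚ
  N = ι (3 ℕ.^ n)

  ∏-total : ∀ w {n} (x : Point n) → ∏ (λ s → ℓ ^ (3 ℕ.* w s)) x ≡ ℓ ^ (3 ℕ.* total w x)
  ∏-total w []      = refl
  ∏-total w (s ∷ x) = trans (cong (ℓ ^ (3 ℕ.* w s) *_) (∏-total w x))
    (trans (sym (^-homo-* ℓ (3 ℕ.* w s) (3 ℕ.* total w x))) (cong (ℓ ^_) (sym (ℕ.*-distribˡ-+ 3 (w s) (total w x)))))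

  -- Markov's inequality for `ℓ ^ (3 ℕ.* total w x)`. In both uses `e` is three times the mean of
  -- `w` over the trits, so `ℓ ^ e` centres the moment.
  tail : ∀ w e → ∑ trits (λ s → ℓ ^ (3 ℕ.* w s)) ≤ℚ ι 3 * (ℓ ^ e * (1ℚ + t * t)) →
         ∑ (points n) (λ x → 𝟙 (not (3 ℕ.* total w x ≤ᵇ e ℕ.* n ℕ.+ W))) * (Q * Q) ≤ℚ N
  tail w e moment = *-cancelʳ-≤ (0<p*q (0<^ 0<ℓ (e ℕ.* n)) 0<Q) (begin
    c * (Q * Q) * (ℓ ^ (e ℕ.* n) * Q)        ≡⟨ solve 3 (λ c q l → c :* (q :* q) :* (l :* q) := c :* (l :* (q :* q :* q))) refl c Q (ℓ ^ (e ℕ.* n)) ⟩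
    c * (ℓ ^ (e ℕ.* n) * (Q * Q * Q))        ≤⟨ *-mono-≤′ 0≤c (0≤p*q (0≤ℓ^ (e ℕ.* n)) (0≤p*q (0≤p*q 0≤Q 0≤Q) 0≤Q)) ℚ.≤-refl
                                                 (*-mono-≤′ (0≤ℓ^ (e ℕ.* n)) (0≤p*q (0≤p*q 0≤Q 0≤Q) 0≤Q) ℚ.≤-refl 64^k≤ℓᵂ) ⟩
    c * (ℓ ^ (e ℕ.* n) * ℓ ^ W)              ≡⟨ cong (c *_) (^-homo-* ℓ (e ℕ.* n) W) ⟨
    c * ℓ ^ (e ℕ.* n ℕ.+ W)                  ≤⟨ ∑-markov (points n) (λ x → not (3 ℕ.* total w x ≤ᵇ e ℕ.* n ℕ.+ W)) (∏ g)
                                                  (∏-nonNeg g λ s → 0≤ℓ^ (3 ℕ.* w s)) large ⟩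
    ∑ (points n) (∏ g)                       ≡⟨ trans (cong (λ xs → ∑ xs (∏ g)) (points≡words n)) (∑-words trits g n) ⟩
    ∑ trits g ^ n                            ≤⟨ ^-mono-≤ (sum-nonNeg (λ i → 0≤ℓ^ (3 ℕ.* w (List.lookup trits i)))) moment n ⟩
    (ι 3 * (ℓ ^ e * (1ℚ + t * t))) ^ n       ≡⟨ trans (^-distrib-* (ι 3) (ℓ ^ e * (1ℚ + t * t)) n)
                                                  (cong₂ _*_ (sym (ι-^ 3 n)) (^-distrib-* (ℓ ^ e) (1ℚ + t * t) n)) ⟩
    N * ((ℓ ^ e) ^ n * (1ℚ + t * t) ^ n)     ≡⟨ cong (λ p → N * (p * (1ℚ + t * t) ^ n)) (^-assocʳ ℓ e n) ⟩
    N * (ℓ ^ (e ℕ.* n) * (1ℚ + t * t) ^ n)   ≤⟨ *-mono-≤′ (0≤ι (3 ℕ.^ n)) (0≤p*q (0≤ℓ^ (e ℕ.* n)) 0≤1+t²) ℚ.≤-refl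
                                                 (*-mono-≤′ (0≤ℓ^ (e ℕ.* n)) 0≤1+t² ℚ.≤-refl second-order) ⟩
    N * (ℓ ^ (e ℕ.* n) * Q)                  ∎)
    where
    open ℚ.≤-Reasoning
    g = λ s → ℓ ^ (3 ℕ.* w s)
    c = ∑ (points n) (λ x → 𝟙 (not (3 ℕ.* total w x ≤ᵇ e ℕ.* n ℕ.+ W)))
    0≤c : 0ℚ ≤ℚ c
    0≤c = sum-nonNeg λ i → 0≤𝟙 (not (3 ℕ.* total w (List.lookup (points n) i) ≤ᵇ e ℕ.* n ℕ.+ W))
    0≤Q = ℚ.<⇒≤ 0<Q
    0≤ℓ^ : ∀ j → 0ℚ ≤ℚ ℓ ^ j
    0≤ℓ^ = 0≤^ (ℚ.<⇒≤ 0<ℓ)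
    0≤1+t² = 0≤^ (0≤p+q (ℚ.<⇒≤ 0<1) (0≤p*p t)) n
    large : ∀ x → T (not (3 ℕ.* total w x ≤ᵇ e ℕ.* n ℕ.+ W)) → ℓ ^ (e ℕ.* n ℕ.+ W) ≤ℚ ∏ g x
    large x exceeds = ℚ.≤-trans
      (^-monoʳ-≤ {m = e ℕ.* n ℕ.+ W} {3 ℕ.* total w x} 1≤ℓ (ℕ.≰⇒≥ λ ≤ → T-not⁻ exceeds (ℕ.≤⇒≤ᵇ ≤)))
      (ℚ.≤-reflexive (sym (∏-total w x)))

  -- In powers of `t` both sides agree up to order two and differ by `4t³ + 3t⁴`; for `lower-moment`
  -- the difference is `2t³`.
  upper-moment : ∑ trits (λ s → ℓ ^ (3 ℕ.* nonzeroᵗ s)) ≤ℚ ι 3 * (ℓ ^ 2 * (1ℚ + t * t))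
  upper-moment = ≤-by (t * t * (ι 4 * t + ι 3 * (t * t)))
    (0≤p*q (0≤p*p t) (0≤p+q (0≤p*q (0≤ι 4) 0≤t) (0≤p*q (0≤ι 3) (0≤p*p t))))
    (solve 1 (λ t → con (ι 3) :* ((con 1ℚ :+ t) :* ((con 1ℚ :+ t) :* con 1ℚ) :* (con 1ℚ :+ t :* t)) :=
      (((con 1ℚ :+ t) :* ((con 1ℚ :+ t) :* ((con 1ℚ :+ t) :* con 1ℚ))) :+ (con 1ℚ :+
        (((con 1ℚ :+ t) :* ((con 1ℚ :+ t) :* ((con 1ℚ :+ t) :* con 1ℚ))) :+ con 0ℚ)))
      :+ t :* t :* (con (ι 4) :* t :+ con (ι 3) :* (t :* t))) refl t)

  lower-moment : ∑ trits (λ s → ℓ ^ (3 ℕ.* zeroᵗ s)) ≤ℚ ι 3 * (ℓ ^ 1 * (1ℚ + t * t))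
  lower-moment = ≤-by (ι 2 * (t * t * t)) (0≤p*q (0≤ι 2) (0≤p*q (0≤p*p t) 0≤t))
    (solve 1 (λ t → con (ι 3) :* (((con 1ℚ :+ t) :* con 1ℚ) :* (con 1ℚ :+ t :* t)) :=
      (con 1ℚ :+ (((con 1ℚ :+ t) :* ((con 1ℚ :+ t) :* ((con 1ℚ :+ t) :* con 1ℚ))) :+ (con 1ℚ :+ con 0ℚ)))
      :+ con (ι 2) :* (t :* t :* t)) refl t)

  -- A union bound over the two tails: the lost fraction is at most `2/16ᵏ`, which for positive `k`
  -- is at most half of `4⁻ᵏ`.
  outside : ∑ (points n) (𝟙 ∘ not ∘ middle W) * (Q * Q) ≤ℚ N + N
  outside = begin
    ∑ (points n) (𝟙 ∘ not ∘ middle W) * (Q * Q)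
      ≤⟨ ℚ.*-monoʳ-≤-nonNeg (Q * Q) {{nonNegative (ℚ.<⇒≤ (0<p*q 0<Q 0<Q))}} (ℚ.≤-trans
           (∑-mono (points n) λ x → either (3 ℕ.* nonzeros x ≤ᵇ 2 ℕ.* n ℕ.+ W) (3 ℕ.* zeros x ≤ᵇ 1 ℕ.* n ℕ.+ W))
           (ℚ.≤-reflexive (∑-distrib-+ (𝟙₁ ∘ List.lookup (points n)) (𝟙₂ ∘ List.lookup (points n))))) ⟩
    (∑ (points n) 𝟙₁ + ∑ (points n) 𝟙₂) * (Q * Q)
      ≡⟨ ℚ.*-distribʳ-+ (Q * Q) (∑ (points n) 𝟙₁) (∑ (points n) 𝟙₂) ⟩
    ∑ (points n) 𝟙₁ * (Q * Q) + ∑ (points n) 𝟙₂ * (Q * Q)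
      ≤⟨ ℚ.+-mono-≤ (tail nonzeroᵗ 2 upper-moment) (tail zeroᵗ 1 lower-moment) ⟩
    N + N ∎
    where
    open ℚ.≤-Reasoning
    𝟙₁ 𝟙₂ : Point n → ℚ
    𝟙₁ x = 𝟙 (not (3 ℕ.* nonzeros x ≤ᵇ 2 ℕ.* n ℕ.+ W))
    𝟙₂ x = 𝟙 (not (3 ℕ.* zeros x ≤ᵇ 1 ℕ.* n ℕ.+ W))
    either : ∀ a b → 𝟙 (not (a ∧ b)) ≤ℚ 𝟙 (not a) + 𝟙 (not b)
    either true  b = ℚ.≤-reflexive (sym (ℚ.+-identityˡ (𝟙 (not b))))
    either false b = ≤-by (𝟙 (not b)) (0≤𝟙 (not b)) refl

-- Testers for large, small and moderate ε

TesterWithin : ∀ n → ℝ → ℕ → Set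
TesterWithin n ε q = ∃[ A ] IsOneSidedConvexityTester {n} ε A × NonAdaptiveAlgorithm.queryComplexity A ≤ q

max-≤ : ∀ {m q} (f : Fin m → ℕ) → (∀ i → f i ≤ q) → Vector.foldr ℕ._⊔_ 0 f ≤ q
max-≤ {zero}  f f≤q = z≤n
max-≤ {suc m} f f≤q = ℕ.⊔-lub (f≤q Fin.zero) (max-≤ (f ∘ Fin.suc) (f≤q ∘ Fin.suc))

uniform-tester : ∀ {n ε q} (qss : List (List (Point n))) → 0ℚ <ℚ ι (length qss) →
                 (∀ {qs} → qs List.∈ qss → length qs ≤ q) →
                 (∀ S → FarFromConvex ε S → ∑ qss (𝟙 ∘ consistent S) * ι 3 ≤ℚ ι (length qss)) →
                 TesterWithin n ε q
uniform-tester {n} qss nonempty short far =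
  tester , (accepts-convex , λ S S-far → rejects-often S (far S S-far))
         , max-≤ (length ∘ List.lookup qss) λ ω → short (∈-lookup {xs = qss} ω)
  where open Tester {n} qss nonempty

0<3^ : ∀ n → 0ℚ <ℚ ι (3 ℕ.^ n)
0<3^ n = subst (0ℚ <ℚ_) (sym (ι-^ 3 n)) (0<^ (0<ι 2) n)

-- Only an ε of at most 1/2 admits sets that are ε-far from convex: ∅ and the whole cube are convex.
blind-tester : ∀ n ε → fromℚ ((ℤ.+ 5) / 8) <ᴿ ε → TesterWithin n ε 0
blind-tester n ε 5/8<ε = uniform-tester {ε = ε} ([] ∷ []) (0<ι 0) (λ { (here refl) → z≤n })
  λ S far → contradiction (impossible S far) (ℚ.<-irrefl refl)
  where
  ∅-convex : Convex {n} (λ _ → false)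
  ∅-convex x = mk⇔ (λ ()) λ where
    (zero  , _ , _ , _ , _ , (_ , 1≤0) , _) → 1≤0 (lt 1ℚ 0<1 0 λ _ _ → ℚ.≤-refl)
    (suc m , _ , _ , y∈ , _) → y∈ Fin.zero
  full-convex : Convex {n} (λ _ → true)
  full-convex x = mk⇔ (⊆-Conv (λ _ → true) x) (λ _ → tt)
  N = ι (3 ℕ.^ n)
  -- Every point disagrees with exactly one of the two convex sets, so the two distance bounds would
  -- add up to `5N/4 ≤ N`.
  impossible : ∀ S → FarFromConvex ε S → N <ℚ N
  impossible S far = ℚ.<-≤-trans
    (<-by ((ℤ.+ 1) / 4 * N) (0<p*q (ℚ.positive⁻¹ ((ℤ.+ 1) / 4)) (0<3^ n))
      (solve 1 (λ N → con ((ℤ.+ 5) / 8) :* N :+ con ((ℤ.+ 5) / 8) :* N := N :+ con ((ℤ.+ 1) / 4) :* N) refl N))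
    (ℚ.≤-trans (ℚ.+-mono-≤ (far⇒disagreement S (λ _ → false) {ε} ((ℤ.+ 5) / 8) far ∅-convex 5/8<ε)
                          (far⇒disagreement S (λ _ → true) {ε} ((ℤ.+ 5) / 8) far full-convex 5/8<ε))
      (ℚ.≤-reflexive (trans (sym (∑-distrib-+ (λ i → 𝟙 (S (point i) xor false)) (λ i → 𝟙 (S (point i) xor true))))
        (trans (∑-cong (points n) λ x → split (S x)) (trans (∑-one (points n)) (cong ι (length-points n)))))))
    where
    point = List.lookup (points n)
    split : ∀ b → 𝟙 (b xor false) + 𝟙 (b xor true) ≡ 1ℚ
    split true  = refl
    split false = refl

-- With the whole cube as `G` nothing is lost outside, so any positive distance produces a bad
-- point, and the only query set exposes it.
exhaustive-tester : ∀ n ε → 0ᴿ <ᴿ ε → TesterWithin n ε (3 ℕ.^ n)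
exhaustive-tester n ε 0<ε = uniform-tester {ε = ε} (points n ∷ []) (0<ι 0)
  (λ { (here refl) → ℕ.≤-reflexive (length-points n) }) λ S far → inconsistent S (violated S far)
  where
  everything : TernarySet n
  everything _ = true
  ρ = proj₁ (positive-bound {ε} 0<ε)
  0<ρ = proj₁ (proj₂ (positive-bound {ε} 0<ε))
  ρ<ε = proj₂ (proj₂ (positive-bound {ε} 0<ε))
  0<𝟙 : ∀ b → 0ℚ <ℚ 𝟙 b → T b
  0<𝟙 true  _   = tt
  0<𝟙 false 0<0 = contradiction 0<0 (ℚ.<-irrefl refl)
  inconsistent : ∀ S → T (not (consistent S (points n))) → (𝟙 (consistent S (points n)) + 0ℚ) * ι 3 ≤ℚ ι 1
  inconsistent S = cases (consistent S (points n))
    where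
    cases : ∀ b → T (not b) → (𝟙 b + 0ℚ) * ι 3 ≤ℚ ι 1
    cases false _ = ℚ.<⇒≤ 0<1
  violated : ∀ S → FarFromConvex ε S → T (not (consistent S (points n)))
  violated S far =
    let 0<∑ = ℚ.<-≤-trans (0<p*q 0<ρ (0<3^ n)) (ℚ.≤-trans (far⇒many-bad S everything {ε} ρ far ρ<ε)
                (ℚ.≤-reflexive (trans (cong (∑ (points n) (𝟙 ∘ bad S everything) +_) (sum-replicate-zero (length (points n))))
                  (ℚ.+-identityʳ _))))
        (i , 0<𝟙bad) = positive-term (𝟙 ∘ bad S everything ∘ List.lookup (points n)) 0<∑
        x = List.lookup (points n) i
    in bad⇒inconsistent S everything (points n) x (0<𝟙 (bad S everything x) 0<𝟙bad) (∈-points x) λ y _ _ → ∈-points y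

length-concatMap-≤ : ∀ (f : A → List B) {q} → (∀ x → length (f x) ≤ q) →
                     ∀ {k} (v : Vec A k) → length (concatMap f (Vec.toList v)) ≤ k ℕ.* q
length-concatMap-≤ f f≤q []      = z≤n
length-concatMap-≤ f f≤q (x ∷ v) = ℕ.≤-trans (ℕ.≤-reflexive (length-++ (f x)))
  (ℕ.+-mono-≤ (f≤q x) (length-concatMap-≤ f f≤q v))

sampling-tester : ∀ n ε k m′ → 1 ≤ k → n ≤ suc m′ ℕ.* suc m′ ℕ.* k → fromℚ (inv (0<^ (0<ι 3) k)) <ᴿ ε →
                  TesterWithin n ε ((2 ℕ.* 4 ℕ.^ k ℕ.+ 2 ℕ.* 4 ℕ.^ k) ℕ.* (1 ℕ.+ 3 ℕ.* n) ℕ.^ (suc m′ ℕ.* (6 ℕ.* k)))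
sampling-tester n ε k m′ 1≤k n≤m²k ρ<ε = uniform-tester {ε = ε} (samples n W K)
  (subst (0ℚ <ℚ_) (sym length-samples) (0<^ (0<3^ n) K))
  (λ qs∈ → let (v , _ , qs≡) = ∈-map⁻ (λ v → concatMap (ball W) (Vec.toList v)) qs∈
            in subst (λ qs → length qs ≤ K ℕ.* (1 ℕ.+ 3 ℕ.* n) ℕ.^ W) (sym qs≡) (length-concatMap-≤ (ball W) (length-ball W) v))
  far-bound
  where
  open Tail m′ k n n≤m²k
  -- The inverse of the guaranteed density `4⁻ᵏ/2` of bad points; `miss-twice` asks for twice as
  -- many samples.
  M = 2 ℕ.* 4 ℕ.^ k
  K = M ℕ.+ M
  1≤4^k : 1 ≤ 4 ℕ.^ k
  1≤4^k = ℕ.m^n>0 4 k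
  2≤M : 2 ≤ M
  2≤M = ℕ.*-monoʳ-≤ 2 1≤4^k
  ιM : ι M ≡ ι 2 * Q
  ιM = trans (ι-* 2 (4 ℕ.^ k)) (cong (ι 2 *_) (ι-^ 4 k))
  4≤Q : ι 4 ≤ℚ Q
  4≤Q = subst (_≤ℚ Q) (ℚ.*-identityʳ (ι 4)) (^-monoʳ-≤ {ι 4} {1} {k} (ι-mono {1} {4} (s≤s z≤n)) 1≤k)
  length-samples : ι (length (samples n W K)) ≡ N ^ K
  length-samples = trans (cong ι (length-map (λ v → concatMap (ball W) (Vec.toList v)) (words (points n) K)))
    (trans (length-words (points n) K) (cong (_^ K) (cong ι (length-points n))))
  far-bound : ∀ S → FarFromConvex ε S → ∑ (samples n W K) (𝟙 ∘ consistent S) * ι 3 ≤ℚ ι (length (samples n W K))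
  far-bound S far = begin
    ∑ (samples n W K) (𝟙 ∘ consistent S) * ι 3
      ≤⟨ ℚ.*-monoʳ-≤-nonNeg (ι 3) {{nonNegative (0≤ι 3)}} (samples-consistent S W K) ⟩
    ∑ (points n) (𝟙 ∘ not ∘ bad S (middle W)) ^ K * ι 3
      ≤⟨ miss-twice M 2≤M (sum-nonNeg λ i → 0≤𝟙 (not (bad S (middle W) (List.lookup (points n) i)))) (0≤ι (3 ℕ.^ n))
           (trans (∑-complement (bad S (middle W)) (points n)) (cong (_- b) (cong ι (length-points n)))) N≤Mb ⟩
    N ^ K ≡⟨ length-samples ⟨
    ι (length (samples n W K)) ∎
    where
    open ℚ.≤-Reasoning
    b = ∑ (points n) (𝟙 ∘ bad S (middle W))
    o = ∑ (points n) (𝟙 ∘ not ∘ middle W)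
    ρ = inv 0<Q
    0≤o : 0ℚ ≤ℚ o
    0≤o = sum-nonNeg λ i → 0≤𝟙 (not (middle W (List.lookup (points n) i)))
    o≤ : o * Q * ι 4 ≤ℚ N + N
    o≤ = ℚ.≤-trans (*-mono-≤′ (0≤p*q 0≤o (ℚ.<⇒≤ 0<Q)) (0≤ι 4) ℚ.≤-refl 4≤Q)
      (ℚ.≤-trans (ℚ.≤-reflexive (ℚ.*-assoc o Q Q)) outside)
    -- Multiplying `ρ * N ≤ b + o` by `2Q = 2/ρ` gives `2N ≤ Mb + 2Qo`, and `o≤` bounds `2Qo` by
    -- `N`.
    N≤Mb : N ≤ℚ ι M * b
    N≤Mb = ≤-by (ι 2 * Q * (b + o - ρ * N) + ½ * (N + N - o * Q * ι 4))
      (0≤p+q (0≤p*q (0≤p*q (0≤ι 2) (ℚ.<⇒≤ 0<Q)) (≤⇒0≤ (far⇒many-bad S (middle W) {ε} ρ far ρ<ε)))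
             (0≤p*q (ℚ.<⇒≤ 0<½) (≤⇒0≤ o≤)))
      (trans (cong (_* b) ιM) (trans
        (solve 5 (λ q b o r N → con (ι 2) :* q :* b :=
          con (ι 2) :* (N :* (q :* r)) :- N :+ (con (ι 2) :* q :* (b :+ o :- r :* N) :+ con ½ :* (N :+ N :- o :* q :* con (ι 4)))) refl Q b o ρ N)
        (cong (_+ (ι 2 * Q * (b + o - ρ * N) + ½ * (N + N - o * Q * ι 4)))
          (trans (cong (λ t → ι 2 * (N * t) - N) (*-inv 0<Q)) (solve 1 (λ N → con (ι 2) :* (N :* con 1ℚ) :- N := N) refl N)))))

-- Lower bounds for the query budget

¾ ⅛ : ℚ
¾ = (ℤ.+ 3) / 4
⅛ = (ℤ.+ 1) / 8

0<¾ : 0ℚ <ℚ ¾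
0<¾ = ℚ.positive⁻¹ ¾

0<⅛ : 0ℚ <ℚ ⅛
0<⅛ = ℚ.positive⁻¹ ⅛

fromℚ-< : ∀ {p q} → p <ℚ q → fromℚ p <ᴿ fromℚ q
fromℚ-< {p} {q} p<q = lt (q - p) (<⇒0< p<q) 0 λ _ _ →
  ℚ.≤-reflexive (solve 2 (λ p q → p :+ (q :- p) := q) refl p q)

≤-<ᴿ-trans : ∀ {p q x} → p ≤ℚ q → fromℚ q <ᴿ x → fromℚ p <ᴿ x
≤-<ᴿ-trans p≤q (lt g 0<g N q+g≤) = lt g 0<g N λ n N≤n → ℚ.≤-trans (ℚ.+-monoˡ-≤ g p≤q) (q+g≤ n N≤n)

between : ∀ {p x} → fromℚ p <ᴿ x → ∃[ r ] p <ℚ r × fromℚ r <ᴿ x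
between {p} (lt g 0<g N p+g≤) = p + ½ * g , <-by (½ * g) (0<half 0<g) refl , lt (½ * g) (0<half 0<g) N λ n N≤n →
  ℚ.≤-trans (ℚ.≤-reflexive (solve 2 (λ p g → p :+ con ½ :* g :+ con ½ :* g := p :+ g) refl p g)) (p+g≤ n N≤n)

-- A member of the lower cut gives only the negative relation `≤ᴿ`; the room between `p` and `q`
-- makes it strict through cotransitivity.
<ᴿ-fromCut : ∀ C {p q} → p <ℚ q → Cut.lower C q → fromℚ p <ᴿ fromCut C
<ᴿ-fromCut C p<q q∈ = [ (λ p< → p<) , (λ <q → contradiction <q (lower≤fromCut C q∈)) ]′ (cotransitive (fromCut C) p<q)

*ᴿ-mono-< : ∀ x y {p r} → 0ℚ <ℚ p → 0ℚ <ℚ r → fromℚ p <ᴿ x → fromℚ r <ᴿ y → fromℚ (p * r) <ᴿ x *ᴿ y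
*ᴿ-mono-< x y {p} {r} 0<p 0<r (lt g 0<g M p+g≤) (lt h 0<h N r+h≤) = lt (g * h) (0<p*q 0<g 0<h) (M ℕ.⊔ N) λ n ≤n → ℚ.≤-trans
  (≤-by (p * h + g * r) (ℚ.<⇒≤ (0<p+q (0<p*q 0<p 0<h) (0<p*q 0<g 0<r)))
    (solve 4 (λ p g r h → (p :+ g) :* (r :+ h) := (p :* r :+ g :* h) :+ (p :* h :+ g :* r)) refl p g r h))
  (*-mono-≤′ (ℚ.<⇒≤ (0<p+q 0<p 0<g)) (ℚ.<⇒≤ (0<p+q 0<r 0<h)) (p+g≤ n (ℕ.m⊔n≤o⇒m≤o M N ≤n)) (r+h≤ n (ℕ.m⊔n≤o⇒n≤o M N ≤n)))

-- From `1/x - 1/p = (p - x)/(xp)`, a gap `g` below `p` becomes a gap of at least `g/p²`.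
<ᴿ-reciprocal : ∀ x (0<x : 0ᴿ <ᴿ x) {p} (0<p : 0ℚ <ℚ p) → x <ᴿ fromℚ p → fromℚ (inv 0<p) <ᴿ x ⁻¹[ 0<x ]
<ᴿ-reciprocal x 0<x@(lt e 0<e N e≤x) {p} 0<p (lt g 0<g M x+g≤p) = lt (i * i * g) (0<p*q (0<p*q 0<i 0<i) 0<g) M λ n M≤n →
  let 0<xₙ = Reciprocal.0<x x e 0<e N e≤x n
      xₙ = seq x (N ℕ.+ n)
      j = inv 0<xₙ
      xₙ+g≤p = x+g≤p (N ℕ.+ n) (ℕ.≤-trans M≤n (ℕ.m≤n+m n N))
      i≤j = inv-antimono 0<xₙ 0<p (ℚ.≤-trans (≤-by {xₙ} g (ℚ.<⇒≤ 0<g) refl) xₙ+g≤p)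
      ij≤ = *-mono-≤′ (ℚ.<⇒≤ 0<i) (ℚ.<⇒≤ 0<i) i≤j (ℚ.≤-refl {i})
      g≤p-xₙ = ≤-by {g} {p - xₙ} (p - (xₙ + g)) (≤⇒0≤ xₙ+g≤p) (solve 3 (λ p x g → p :- x := g :+ (p :- (x :+ g))) refl p xₙ g)
  in ℚ.≤-trans (ℚ.+-monoʳ-≤ i (*-mono-≤′ (ℚ.<⇒≤ (0<p*q 0<i 0<i)) (ℚ.<⇒≤ 0<g) ij≤ g≤p-xₙ))
       (ℚ.≤-reflexive (trans (cong (i +_) (sym (inv-diff 0<xₙ 0<p))) (solve 2 (λ i j → i :+ (j :- i) := j) refl i j)))
  where
  i = inv 0<p
  0<i = 0<inv 0<p

-- (1 - 1/4)ʲ ≤ e^(-j/4), so ln x > j/4 once x (3/4)ʲ > 1.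
ln-lower : ∀ j → 1 ≤ j → ∀ x (0<x : 0ᴿ <ᴿ x) {a} → 1ℚ ≤ℚ a * ¾ ^ j → fromℚ a <ᴿ x → fromℚ (ι j * ⅛) <ᴿ ln x 0<x
ln-lower (suc j) _ x 0<x {a} 1≤a¾ʲ a<x =
  let (r , a<r , r<x) = between {a} {x} a<x
      1<r¾ʲ = ℚ.≤-<-trans 1≤a¾ʲ (ℚ.*-monoˡ-<-pos (¾ ^ suc j) {{positive (0<^ 0<¾ (suc j))}} a<r)
  -- The cut contains `j/4`; retreating to `j/8` pays for strictness.
  in <ᴿ-fromCut (LnCut.cut x 0<x) {ι (suc j) * ⅛} {ι (suc j) * (ι 2 * ⅛)}
    (<-by (ι (suc j) * ⅛) (0<p*q (0<ι j) 0<⅛) (solve 1 (λ i → i :* (con (ι 2) :* con ⅛) := i :* con ⅛ :+ i :* con ⅛) refl (ι (suc j))))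
    (r , (j , subst (0ℚ <ℚ_) (sym base) 0<¾ , subst (λ t → 1ℚ <ℚ r * t ^ suc j) (sym base) 1<r¾ʲ) , r<x)
  where
  base : 1ℚ - ι (suc j) * (ι 2 * ⅛) * 1/suc j ≡ ¾
  base = trans (solve 2 (λ i u → con 1ℚ :- i :* (con (ι 2) :* con ⅛) :* u := con 1ℚ :- (con (ι 2) :* con ⅛) :* (i :* u)) refl (ι (suc j)) (1/suc j))
    (cong (λ t → 1ℚ - (ι 2 * ⅛) * t) (ι*1/suc j))

sqrt-lower : ∀ x {p q} → p <ℚ q → fromℚ (q * q) <ᴿ x → fromℚ p <ᴿ sqrt x
sqrt-lower x p<q q²<x = <ᴿ-fromCut (SqrtCut.cut x) p<q (inj₂ q²<x)

-- With as many factors as the exponent, the lower bound on `e^j` reads `(1 + j/j)^j = 2^j`.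
exp-lower : ∀ j → 1 ≤ j → ∀ z {r} → r <ℚ ι 2 ^ j → fromℚ (ι j) <ᴿ z → fromℚ r ≤ᴿ exp z
exp-lower (suc j) _ z {r} r<2ʲ j<z = lower≤fromCut (ExpCut.cut z) {r}
  (ι (suc j) , j<z , j , subst (0ℚ <ℚ_) (sym base) (0<ι 1) , subst (λ t → r <ℚ t ^ suc j) (sym base) r<2ʲ)
  where
  base : 1ℚ + ι (suc j) * 1/suc j ≡ ι 2
  base = cong (1ℚ +_) (ι*1/suc j)

-- The lower bounds s/16, l/8 and 1/8 for the square root, ln n and ln 3 turn this
-- factor into the exponent 45 s l, enough for 2^(45 s l) > 4^(22 s l) ≥ n^(22 s).
factor : ℚ
factor = ι 45 * (ι 16 * (ι 8 * ι 8))

-- The added 1 gives the strict inequality that `*ᴿ-mono-<` requires.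
constant : ℝ
constant = fromℚ (factor + 1ℚ)

0<factor : 0ℚ <ℚ factor
0<factor = 0<p*q (0<ι 44) (0<p*q (0<ι 15) (0<p*q (0<ι 7) (0<ι 7)))

0<ι⁺ : ∀ {n} → 1 ≤ n → 0ℚ <ℚ ι n
0<ι⁺ {suc n} _ = 0<ι n

1<^⁺ : ∀ {p n} → 1ℚ <ℚ p → 1 ≤ n → 1ℚ <ℚ p ^ n
1<^⁺ {n = suc n} 1<p _ = 1<^ 1<p n

1ℚ^ : ∀ n → 1ℚ ^ n ≡ 1ℚ
1ℚ^ zero    = refl
1ℚ^ (suc n) = trans (ℚ.*-identityˡ (1ℚ ^ n)) (1ℚ^ n)

ln-ε⁻¹-lower : ∀ k → 1 ≤ k → ∀ ε (0<ε : 0ᴿ <ᴿ ε) → ε <ᴿ fromℚ (¾ ^ k) →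
               fromℚ (ι k * ⅛) <ᴿ ln (ε ⁻¹[ 0<ε ]) (⁻¹-positive ε 0<ε)
ln-ε⁻¹-lower k 1≤k ε 0<ε ε<¾ᵏ = ln-lower k 1≤k (ε ⁻¹[ 0<ε ]) (⁻¹-positive ε 0<ε) {inv (0<^ 0<¾ k)}
  (ℚ.≤-reflexive (sym (trans (ℚ.*-comm (inv (0<^ 0<¾ k)) (¾ ^ k)) (*-inv (0<^ 0<¾ k)))))
  (<ᴿ-reciprocal ε 0<ε (0<^ 0<¾ k) ε<¾ᵏ)

-- Splitting `2^l` as `(4/3)^l (3/2)^l` shows that `n` strictly exceeds `(4/3)^l`, as `ln-lower`
-- needs.
ln-ℕ-lower : ∀ l → 1 ≤ l → ∀ n (1≤n : 1 ≤ n) → 2 ℕ.^ l ≤ n → fromℚ (ι l * ⅛) <ᴿ ln (fromℕ n) (fromℕ-positive n 1≤n)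
ln-ℕ-lower l 1≤l n 1≤n 2ˡ≤n = ln-lower l 1≤l (fromℕ n) (fromℕ-positive n 1≤n) {(4/3) ^ l}
  (ℚ.≤-reflexive (sym (trans (sym (^-distrib-* 4/3 ¾ l)) (1ℚ^ l))))
  (fromℚ-< (ℚ.<-≤-trans (subst (4/3 ^ l <ℚ_) (sym (^-distrib-* 4/3 3/2 l)) grow)
    (subst (_≤ℚ ι n) (ι-^ 2 l) (ι-mono 2ˡ≤n))))
  where
  4/3 3/2 : ℚ
  4/3 = (ℤ.+ 4) / 3
  3/2 = (ℤ.+ 3) / 2
  grow : 4/3 ^ l <ℚ 4/3 ^ l * 3/2 ^ l
  grow = subst (_<ℚ 4/3 ^ l * 3/2 ^ l) (ℚ.*-identityʳ (4/3 ^ l))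
    (ℚ.*-monoʳ-<-pos (4/3 ^ l) {{positive (0<^ (ℚ.positive⁻¹ 4/3) l)}} (1<^⁺ {3/2} (<-by ½ 0<½ refl) 1≤l))

sqrt-product-lower : ∀ n k s L → 1 ≤ n → 1 ≤ k → 1 ≤ s → s ℕ.* s ≤ 4 ℕ.* (n ℕ.* k) → fromℚ (ι k * ⅛) <ᴿ L →
                     fromℚ (½ * (ι s * ⅛)) <ᴿ sqrt (fromℕ n *ᴿ L)
sqrt-product-lower n k s L 1≤n 1≤k 1≤s s²≤4nk L> = sqrt-lower (fromℕ n *ᴿ L) (half< (0<p*q (0<ι⁺ 1≤s) 0<⅛))
  -- `s² ≤ 4nk` gives `(s/8)² ≤ (n/2)(k/8)`; the halvings of `n` and of `s/8` buy strictness.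
  (≤-<ᴿ-trans {ι s * ⅛ * (ι s * ⅛)} {½ * ι n * (ι k * ⅛)} {fromℕ n *ᴿ L}
    (≤-by (⅛ * ⅛ * (ι 4 * (ι n * ι k) - ι s * ι s)) (0≤p*q (ℚ.<⇒≤ (0<p*q 0<⅛ 0<⅛)) (≤⇒0≤ s²≤))
      (solve 3 (λ n k s → con ½ :* n :* (k :* con ⅛) := s :* con ⅛ :* (s :* con ⅛) :+ con ⅛ :* con ⅛ :* (con (ι 4) :* (n :* k) :- s :* s)) refl (ι n) (ι k) (ι s)))
    (*ᴿ-mono-< (fromℕ n) L (0<half (0<ι⁺ 1≤n)) (0<p*q (0<ι⁺ 1≤k) 0<⅛) (fromℚ-< (half< (0<ι⁺ 1≤n))) L>))
  where
  s²≤ : ι s * ι s ≤ℚ ι 4 * (ι n * ι k)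
  s²≤ = subst₂ _≤ℚ_ (ι-* s s) (trans (ι-* 4 (n ℕ.* k)) (cong (ι 4 *_) (ι-* n k))) (ι-mono s²≤4nk)

exponent-lower : ∀ s l R Λ Θ → 1 ≤ s → 1 ≤ l → fromℚ (½ * (ι s * ⅛)) <ᴿ R → fromℚ (ι l * ⅛) <ᴿ Λ → fromℚ ⅛ <ᴿ Θ →
                 fromℚ (ι (45 ℕ.* (s ℕ.* l))) <ᴿ constant *ᴿ R *ᴿ Λ *ᴿ Θ
exponent-lower s l R Λ Θ 1≤s 1≤l R> Λ> Θ> = ≤-<ᴿ-trans {ι (45 ℕ.* (s ℕ.* l))} {factor * (½ * (ι s * ⅛)) * (ι l * ⅛) * ⅛} {constant *ᴿ R *ᴿ Λ *ᴿ Θ}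
  (ℚ.≤-reflexive (trans (trans (ι-* 45 (s ℕ.* l)) (cong (ι 45 *_) (ι-* s l)))
    (solve 2 (λ s l → con (ι 45) :* (s :* l) := con (ι 45) :* (con (ι 16) :* (con (ι 8) :* con (ι 8))) :* (con ½ :* (s :* con ⅛)) :* (l :* con ⅛) :* con ⅛)
      refl (ι s) (ι l))))
  (*ᴿ-mono-< (constant *ᴿ R *ᴿ Λ) Θ (0<p*q (0<p*q 0<factor 0<R) 0<Λ) 0<⅛
    (*ᴿ-mono-< (constant *ᴿ R) Λ (0<p*q 0<factor 0<R) 0<Λ (*ᴿ-mono-< constant R 0<factor 0<R constant> R>) Λ>) Θ>)
  where
  0<R = 0<half (0<p*q (0<ι⁺ 1≤s) 0<⅛)
  0<Λ = 0<p*q (0<ι⁺ 1≤l) 0<⅛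
  constant> : fromℚ factor <ᴿ constant
  constant> = fromℚ-< (<-by 1ℚ 0<1 refl)

ι-mono-< : ∀ {m n} → m ℕ.< n → ι m <ℚ ι n
ι-mono-< {m} m<n = ℚ.<-≤-trans (<-by 1ℚ 0<1 (trans (ι-suc m) (ℚ.+-comm 1ℚ (ι m)))) (ι-mono m<n)

n^22s<2^45sl : ∀ n s l → 1 ≤ s → 1 ≤ l → n ≤ 4 ℕ.^ l → n ℕ.^ (22 ℕ.* s) ℕ.< 2 ℕ.^ (45 ℕ.* (s ℕ.* l))
n^22s<2^45sl n s l 1≤s 1≤l n≤4ˡ = begin-strict
  n ℕ.^ (22 ℕ.* s)                   ≤⟨ ℕ.^-monoˡ-≤ (22 ℕ.* s) n≤4ˡ ⟩
  (4 ℕ.^ l) ℕ.^ (22 ℕ.* s)           ≡⟨ cong (ℕ._^ (22 ℕ.* s)) (ℕ.^-*-assoc 2 2 l) ⟩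
  (2 ℕ.^ (2 ℕ.* l)) ℕ.^ (22 ℕ.* s)   ≡⟨ ℕ.^-*-assoc 2 (2 ℕ.* l) (22 ℕ.* s) ⟩
  2 ℕ.^ (2 ℕ.* l ℕ.* (22 ℕ.* s))     <⟨ ℕ.^-monoʳ-< 2 (s≤s (s≤s z≤n)) more ⟩
  2 ℕ.^ (45 ℕ.* (s ℕ.* l))           ∎
  where
  open ℕ.≤-Reasoning
  identity : ∀ s l → 2 ℕ.* l ℕ.* (22 ℕ.* s) ℕ.+ s ℕ.* l ≡ 45 ℕ.* (s ℕ.* l)
  identity = ℕ-solve 2 (λ s l → ⟨ 2 ⟩ ⊗ l ⊗ (⟨ 22 ⟩ ⊗ s) ⊕ s ⊗ l ⊜ ⟨ 45 ⟩ ⊗ (s ⊗ l)) refl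
  more : 2 ℕ.* l ℕ.* (22 ℕ.* s) ℕ.< 45 ℕ.* (s ℕ.* l)
  more = subst (2 ℕ.* l ℕ.* (22 ℕ.* s) ℕ.<_) (identity s l) (ℕ.m<m+n (2 ℕ.* l ℕ.* (22 ℕ.* s)) (ℕ.*-mono-≤ 1≤s 1≤l))

query-bound : ∀ n (2≤n : 2 ≤ n) ε (0<ε : 0ᴿ <ᴿ ε) k s l q → 1 ≤ k → 1 ≤ s → 1 ≤ l →
  ε <ᴿ fromℚ (¾ ^ k) → s ℕ.* s ≤ 4 ℕ.* (n ℕ.* k) → 2 ℕ.^ l ≤ n → n ≤ 4 ℕ.^ l → q ≤ n ℕ.^ (22 ℕ.* s) →
  fromℕ q ≤ᴿ 3^ (constant *ᴿ sqrt (fromℕ n *ᴿ ln (ε ⁻¹[ 0<ε ]) (⁻¹-positive ε 0<ε)) *ᴿ ln (fromℕ n) (fromℕ-positive n (<⇒≤ 2≤n)))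
query-bound n 2≤n ε 0<ε k s l q 1≤k 1≤s 1≤l ε<¾ᵏ s²≤4nk 2ˡ≤n n≤4ˡ q≤ =
  exp-lower (45 ℕ.* (s ℕ.* l)) (ℕ.*-mono-≤ {1} {45} (s≤s z≤n) (ℕ.*-mono-≤ 1≤s 1≤l)) _
    (subst (ι q <ℚ_) (ι-^ 2 (45 ℕ.* (s ℕ.* l))) (ι-mono-< (ℕ.≤-<-trans q≤ (n^22s<2^45sl n s l 1≤s 1≤l n≤4ˡ))))
    (exponent-lower s l _ _ _ 1≤s 1≤l
      (sqrt-product-lower n k s _ (<⇒≤ 2≤n) 1≤k 1≤s s²≤4nk (ln-ε⁻¹-lower k 1≤k ε 0<ε ε<¾ᵏ))
      (ln-ℕ-lower l 1≤l n (<⇒≤ 2≤n) 2ˡ≤n)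
      -- The bound `1/8` on `ln 3` comes from `2 * ¾ ≥ 1` and `2 < 3`.
      (ln-lower 1 (s≤s z≤n) (fromℕ 3) (fromℕ-positive 3 (s≤s z≤n)) {ι 2} (≤-by ½ (ℚ.<⇒≤ 0<½) refl) (fromℚ-< (<-by 1ℚ 0<1 refl))))

-- Choice of parameters

-- A two-sided integer stand-in for `ln n`. When `suc n` passes `4^l`, the next exponent is safe
-- because `l + 1 ≤ 2l`.
between-2^-and-4^ : ∀ n → 2 ≤ n → ∃[ l ] 1 ≤ l × 2 ℕ.^ l ≤ n × n ≤ 4 ℕ.^ l
between-2^-and-4^ 2 (s≤s (s≤s _)) = 1 , s≤s z≤n , ℕ.≤-refl , ℕ.m≤m+n 2 2
between-2^-and-4^ (suc n@(suc (suc _))) _ = step (between-2^-and-4^ n (s≤s (s≤s z≤n)))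
  where
  step : (∃[ l ] 1 ≤ l × 2 ℕ.^ l ≤ n × n ≤ 4 ℕ.^ l) → ∃[ l ] 1 ≤ l × 2 ℕ.^ l ≤ suc n × suc n ≤ 4 ℕ.^ l
  step (l , 1≤l , 2ˡ≤n , n≤4ˡ) with suc n ℕ.≤? 4 ℕ.^ l
  ... | yes n<4ˡ = l , 1≤l , ℕ.m≤n⇒m≤1+n 2ˡ≤n , n<4ˡ
  ... | no  n≮4ˡ = suc l , s≤s z≤n
    , ℕ.≤-trans (ℕ.^-monoʳ-≤ 2 (ℕ.≤-trans (ℕ.+-monoˡ-≤ l 1≤l) (ℕ.≤-reflexive (cong (l ℕ.+_) (sym (ℕ.+-identityʳ l))))))
        (ℕ.≤-trans (ℕ.≤-reflexive (sym (ℕ.^-*-assoc 2 2 l))) (<⇒≤ (ℕ.≰⇒> n≮4ˡ)))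
    , ℕ.≤-trans (s≤s n≤4ˡ) (ℕ.≤-trans (ℕ.+-monoˡ-≤ (4 ℕ.^ l) (ℕ.m^n>0 4 l)) (ℕ.+-monoʳ-≤ (4 ℕ.^ l) (ℕ.m≤m+n (4 ℕ.^ l) _)))

-- Descend until the next smaller root fails; a step changes the square by a factor of at most 4. At
-- root 1, `k ≤ n` gives the upper bound.
approximate-root : ∀ n k → 1 ≤ k → k ≤ n → ∃[ m ] n ≤ suc m ℕ.* suc m ℕ.* k × suc m ℕ.* suc m ℕ.* k ≤ 4 ℕ.* n
approximate-root n k 1≤k k≤n = descend n (ℕ.≤-trans (ℕ.n≤1+n n)
  (ℕ.≤-trans (ℕ.m≤m*n (suc n) (suc n)) (ℕ.m≤m*n (suc n ℕ.* suc n) k {{ℕ.>-nonZero 1≤k}})))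
  where
  double : ∀ m k → suc (suc m) ℕ.* suc (suc m) ℕ.* k ≤ 4 ℕ.* (suc m ℕ.* suc m ℕ.* k)
  double m k = ℕ.≤-trans (ℕ.m≤m+n _ ((3 ℕ.* (m ℕ.* m) ℕ.+ 4 ℕ.* m) ℕ.* k)) (ℕ.≤-reflexive
    (ℕ-solve 2 (λ m k → (⟨ 2 ⟩ ⊕ m) ⊗ (⟨ 2 ⟩ ⊕ m) ⊗ k ⊕ (⟨ 3 ⟩ ⊗ (m ⊗ m) ⊕ ⟨ 4 ⟩ ⊗ m) ⊗ k
      ⊜ ⟨ 4 ⟩ ⊗ ((⟨ 1 ⟩ ⊕ m) ⊗ (⟨ 1 ⟩ ⊕ m) ⊗ k)) refl m k))
  descend : ∀ m → n ≤ suc m ℕ.* suc m ℕ.* k → ∃[ m ] n ≤ suc m ℕ.* suc m ℕ.* k × suc m ℕ.* suc m ℕ.* k ≤ 4 ℕ.* n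
  descend zero    n≤ = 0 , n≤ , ℕ.≤-trans (ℕ.≤-reflexive (ℕ.+-identityʳ k)) (ℕ.≤-trans k≤n (ℕ.m≤n*m n 4))
  descend (suc m) n≤ with n ℕ.≤? suc m ℕ.* suc m ℕ.* k
  ... | yes n≤′ = descend m n≤′
  ... | no  n≰  = suc m , n≤ , ℕ.≤-trans (double m k) (ℕ.*-monoʳ-≤ 4 (<⇒≤ (ℕ.≰⇒> n≰)))

inv-≤ : ∀ {p x} (0<p : 0ℚ <ℚ p) → 1ℚ ≤ℚ p * x → inv 0<p ≤ℚ x
inv-≤ {p} {x} 0<p 1≤px = ≤-by (inv 0<p * (p * x - 1ℚ)) (0≤p*q (ℚ.<⇒≤ (0<inv 0<p)) (≤⇒0≤ 1≤px))
  (trans (sym (trans (cong (_* x) (*-inv 0<p)) (ℚ.*-identityˡ x)))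
    (solve 3 (λ p i x → p :* i :* x := i :+ i :* (p :* x :- con 1ℚ)) refl p (inv 0<p) x))

-- `4ᵏ ¾ᵏ⁺² = 3ᵏ * 9/16`, at least `27/16` for positive `k`.
4⁻ᵏ≤¾ᵏ⁺² : ∀ k → 1 ≤ k → inv (0<^ (0<ι 3) k) ≤ℚ ¾ ^ (2 ℕ.+ k)
4⁻ᵏ≤¾ᵏ⁺² (suc k) _ = inv-≤ (0<^ (0<ι 3) (suc k)) (ℚ.≤-trans
  (ℚ.≤-trans (1≤^ {ι 3} (ι-mono {1} {3} (s≤s z≤n)) k) (≤-by ((ℤ.+ 11) / 16 * ι 3 ^ k) (0≤p*q (ℚ.<⇒≤ (ℚ.positive⁻¹ ((ℤ.+ 11) / 16))) (0≤^ (0≤ι 3) k))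
    (solve 1 (λ x → con ((ℤ.+ 27) / 16) :* x := x :+ con ((ℤ.+ 11) / 16) :* x) refl (ι 3 ^ k))))
  (ℚ.≤-reflexive (trans (cong ((ℤ.+ 27) / 16 *_) (^-distrib-* (ι 4) ¾ k))
    (solve 2 (λ a b → con ((ℤ.+ 27) / 16) :* (a :* b) := con (ι 4) :* a :* (con ¾ :* (con ¾ :* (con ¾ :* b)))) refl (ι 4 ^ k) (¾ ^ k)))))

-- By Bernoulli `(4/3)^J` is at least `J/3`, so any `J` above `3/ρ` works.
power-below : ∀ {ρ} → 0ℚ <ℚ ρ → ∃[ J ] ¾ ^ J ≤ℚ ρ
power-below {ρ} 0<ρ =
  let (J , large) = archimedean (ι 3 * inv 0<ρ)
      1≤ρJ/3 = ≤-by {1ℚ} (ρ * (⅓ * (ι J - ι 3 * inv 0<ρ))) (0≤p*q (ℚ.<⇒≤ 0<ρ) (0≤p*q (ℚ.<⇒≤ 0<⅓) (ℚ.<⇒≤ (<⇒0< large))))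
        (trans (solve 3 (λ r j i → r :* (j :* con ⅓) := r :* i :+ r :* (con ⅓ :* (j :- con (ι 3) :* i))) refl ρ (ι J) (inv 0<ρ))
          (cong (_+ ρ * (⅓ * (ι J - ι 3 * inv 0<ρ))) (*-inv 0<ρ)))
      J/3≤ = ℚ.≤-trans (≤-by 1ℚ (ℚ.<⇒≤ 0<1) (ℚ.+-comm 1ℚ (ι J * ⅓))) (bernoulli {⅓} (0≤p+q (ℚ.<⇒≤ 0<1) (ℚ.<⇒≤ 0<⅓)) J)
      0<4/3ᴶ = 0<^ {1ℚ + ⅓} (0<p+q 0<1 0<⅓) J
  in J , *-cancelʳ-≤ 0<4/3ᴶ (ℚ.≤-trans (ℚ.≤-reflexive (trans (sym (^-distrib-* ¾ (1ℚ + ⅓) J)) (1ℚ^ J)))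
       (ℚ.≤-trans 1≤ρJ/3 (*-mono-≤′ (ℚ.<⇒≤ 0<ρ) (0≤p*q (0≤ι J) (ℚ.<⇒≤ 0<⅓)) ℚ.≤-refl J/3≤)))

-- A search downwards from `J`. A real cannot be compared exactly with one power, so cotransitivity
-- between neighbours is used and the bracket spans two steps.
bracket-by-powers : ∀ ε → ε <ᴿ fromℚ ¾ → ∀ J → fromℚ (¾ ^ J) <ᴿ ε →
                    ∃[ k ] 1 ≤ k × fromℚ (¾ ^ (2 ℕ.+ k)) <ᴿ ε × ε <ᴿ fromℚ (¾ ^ k)
bracket-by-powers ε ε<¾ 0 1<ε = contradiction (<ᴿ-between {1ℚ} {ε} {¾} 1<ε ε<¾) (ℚ.<-asym (<-by ((ℤ.+ 1) / 4) (ℚ.positive⁻¹ ((ℤ.+ 1) / 4)) refl))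
bracket-by-powers ε ε<¾ 1 ¾<ε = contradiction (<ᴿ-between {¾} {ε} {¾} ¾<ε ε<¾) (ℚ.<-irrefl refl)
bracket-by-powers ε ε<¾ 2 <ε  = 1 , s≤s z≤n
  , ≤-<ᴿ-trans {¾ ^ 3} {¾ ^ 2} {ε} (≤-by ((ℤ.+ 9) / 64) (ℚ.<⇒≤ (ℚ.positive⁻¹ ((ℤ.+ 9) / 64))) refl) <ε , ε<¾
bracket-by-powers ε ε<¾ (suc (suc (suc J))) <ε =
  [ bracket-by-powers ε ε<¾ (suc (suc J)) , (λ ε< → suc J , s≤s z≤n , <ε , ε<) ]′
    (cotransitive ε {¾ ^ suc (suc J)} {¾ ^ suc J}
      (<-by ((ℤ.+ 1) / 4 * ¾ ^ suc J) (0<p*q (ℚ.positive⁻¹ ((ℤ.+ 1) / 4)) (0<^ 0<¾ (suc J)))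
        (solve 1 (λ x → x := con ¾ :* x :+ con ((ℤ.+ 1) / 4) :* x) refl (¾ ^ suc J))))

-- One `k` serves both sides: `4⁻ᵏ < ε` makes the sampling suffice, and `ε < ¾ᵏ` makes `ln (1/ε)`
-- exceed `k/8`.
logarithm-of-ε : ∀ ε → 0ᴿ <ᴿ ε → ε <ᴿ fromℚ ¾ → ∃[ k ] 1 ≤ k × fromℚ (inv (0<^ (0<ι 3) k)) <ᴿ ε × ε <ᴿ fromℚ (¾ ^ k)
logarithm-of-ε ε 0<ε ε<¾ =
  let (ρ , 0<ρ , ρ<ε) = positive-bound {ε} 0<ε
      (J , ¾ᴶ≤ρ) = power-below 0<ρ
      (k , 1≤k , lower , upper) = bracket-by-powers ε ε<¾ J (≤-<ᴿ-trans {¾ ^ J} {ρ} {ε} ¾ᴶ≤ρ ρ<ε)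
  in k , 1≤k , ≤-<ᴿ-trans {inv (0<^ (0<ι 3) k)} {¾ ^ (2 ℕ.+ k)} {ε} (4⁻ᵏ≤¾ᵏ⁺² k 1≤k) lower , upper

1+3n≤n³ : ∀ n → 2 ≤ n → 1 ℕ.+ 3 ℕ.* n ≤ n ℕ.^ 3
1+3n≤n³ (suc (suc n)) (s≤s (s≤s _)) = ℕ.≤-trans (ℕ.m≤m+n _ (n ℕ.* n ℕ.* n ℕ.+ 6 ℕ.* (n ℕ.* n) ℕ.+ 9 ℕ.* n ℕ.+ 1)) (ℕ.≤-reflexive
  (ℕ-solve 1 (λ n → ⟨ 1 ⟩ ⊕ ⟨ 3 ⟩ ⊗ (⟨ 2 ⟩ ⊕ n) ⊕ (n ⊗ n ⊗ n ⊕ ⟨ 6 ⟩ ⊗ (n ⊗ n) ⊕ ⟨ 9 ⟩ ⊗ n ⊕ ⟨ 1 ⟩)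
    ⊜ (⟨ 2 ⟩ ⊕ n) ⊗ ((⟨ 2 ⟩ ⊕ n) ⊗ ((⟨ 2 ⟩ ⊕ n) ⊗ ⟨ 1 ⟩))) refl n))

-- The 22 is 4 for the `4ᵏ⁺¹` centres plus `3 * 6` for balls of radius `6mk`, since `1 + 3n ≤ n³`.
sampling-queries-≤ : ∀ n m k → 2 ≤ n → 1 ≤ m → 1 ≤ k →
  (2 ℕ.* 4 ℕ.^ k ℕ.+ 2 ℕ.* 4 ℕ.^ k) ℕ.* (1 ℕ.+ 3 ℕ.* n) ℕ.^ (m ℕ.* (6 ℕ.* k)) ≤ n ℕ.^ (22 ℕ.* (m ℕ.* k))
sampling-queries-≤ n m k 2≤n 1≤m 1≤k = begin
  (2 ℕ.* 4 ℕ.^ k ℕ.+ 2 ℕ.* 4 ℕ.^ k) ℕ.* (1 ℕ.+ 3 ℕ.* n) ℕ.^ (m ℕ.* (6 ℕ.* k))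
    ≤⟨ ℕ.*-mono-≤ trials (ℕ.^-monoˡ-≤ (m ℕ.* (6 ℕ.* k)) (1+3n≤n³ n 2≤n)) ⟩
  n ℕ.^ (4 ℕ.* (m ℕ.* k)) ℕ.* (n ℕ.^ 3) ℕ.^ (m ℕ.* (6 ℕ.* k))
    ≡⟨ cong (n ℕ.^ (4 ℕ.* (m ℕ.* k)) ℕ.*_) (ℕ.^-*-assoc n 3 (m ℕ.* (6 ℕ.* k))) ⟩
  n ℕ.^ (4 ℕ.* (m ℕ.* k)) ℕ.* n ℕ.^ (3 ℕ.* (m ℕ.* (6 ℕ.* k)))
    ≡⟨ ℕ.^-distribˡ-+-* n (4 ℕ.* (m ℕ.* k)) (3 ℕ.* (m ℕ.* (6 ℕ.* k))) ⟨
  n ℕ.^ (4 ℕ.* (m ℕ.* k) ℕ.+ 3 ℕ.* (m ℕ.* (6 ℕ.* k)))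
    ≡⟨ cong (n ℕ.^_) (exponents m k) ⟩
  n ℕ.^ (22 ℕ.* (m ℕ.* k)) ∎
  where
  open ℕ.≤-Reasoning
  instance _ = ℕ.>-nonZero {n} (<⇒≤ 2≤n)
  exponents : ∀ m k → 4 ℕ.* (m ℕ.* k) ℕ.+ 3 ℕ.* (m ℕ.* (6 ℕ.* k)) ≡ 22 ℕ.* (m ℕ.* k)
  exponents = ℕ-solve 2 (λ m k → ⟨ 4 ⟩ ⊗ (m ⊗ k) ⊕ ⟨ 3 ⟩ ⊗ (m ⊗ (⟨ 6 ⟩ ⊗ k)) ⊜ ⟨ 22 ⟩ ⊗ (m ⊗ k)) refl
  trials : 2 ℕ.* 4 ℕ.^ k ℕ.+ 2 ℕ.* 4 ℕ.^ k ≤ n ℕ.^ (4 ℕ.* (m ℕ.* k))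
  trials = begin
    2 ℕ.* 4 ℕ.^ k ℕ.+ 2 ℕ.* 4 ℕ.^ k  ≡⟨ ℕ-solve 1 (λ x → ⟨ 2 ⟩ ⊗ x ⊕ ⟨ 2 ⟩ ⊗ x ⊜ ⟨ 4 ⟩ ⊗ x) refl (4 ℕ.^ k) ⟩
    4 ℕ.^ suc k                      ≡⟨ ℕ.^-*-assoc 2 2 (suc k) ⟩
    2 ℕ.^ (2 ℕ.* suc k)              ≤⟨ ℕ.^-monoˡ-≤ (2 ℕ.* suc k) 2≤n ⟩
    n ℕ.^ (2 ℕ.* suc k)              ≤⟨ ℕ.^-monoʳ-≤ n (ℕ.*-monoʳ-≤ 2 (ℕ.+-monoˡ-≤ k 1≤k)) ⟩
    n ℕ.^ (2 ℕ.* (k ℕ.+ k))          ≡⟨ cong (n ℕ.^_) (ℕ-solve 1 (λ k → ⟨ 2 ⟩ ⊗ (k ⊕ k) ⊜ ⟨ 4 ⟩ ⊗ k) refl k) ⟩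
    n ℕ.^ (4 ℕ.* k)                  ≤⟨ ℕ.^-monoʳ-≤ n (ℕ.*-monoʳ-≤ 4 (ℕ.m≤n*m k m {{ℕ.>-nonZero 1≤m}})) ⟩
    n ℕ.^ (4 ℕ.* (m ℕ.* k))          ∎

exhaustive-queries-≤ : ∀ n → 2 ≤ n → 3 ℕ.^ n ≤ n ℕ.^ (22 ℕ.* n)
exhaustive-queries-≤ n 2≤n = begin
  3 ℕ.^ n           ≤⟨ ℕ.^-monoˡ-≤ n (ℕ.≤-trans (ℕ.n≤1+n 3) (ℕ.^-monoˡ-≤ 2 2≤n)) ⟩
  (n ℕ.^ 2) ℕ.^ n   ≡⟨ ℕ.^-*-assoc n 2 n ⟩
  n ℕ.^ (2 ℕ.* n)   ≤⟨ ℕ.^-monoʳ-≤ n (ℕ.*-monoˡ-≤ n (ℕ.m≤m+n 2 20)) ⟩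
  n ℕ.^ (22 ℕ.* n)  ∎
  where
  open ℕ.≤-Reasoning
  instance _ = ℕ.>-nonZero {n} (<⇒≤ 2≤n)

-- Assembly of the testers within the budget

-- `s` is an integer standing for `√(nk)`: sampling takes `mk`, and the exhaustive tester, used for
-- `n ≤ k`, takes `n`.
record BudgetedTester (n : ℕ) (ε : ℝ) (k : ℕ) : Set where
  constructor budgeted
  field
    s        : ℕ
    1≤s      : 1 ≤ s
    s²≤4nk   : s ℕ.* s ≤ 4 ℕ.* (n ℕ.* k)
    q        : ℕ
    q≤n^22s  : q ≤ n ℕ.^ (22 ℕ.* s)
    A-within : TesterWithin n ε q

budgeted-exhaustive : ∀ n ε k → 2 ≤ n → 0ᴿ <ᴿ ε → n ≤ k → BudgetedTester n ε k
budgeted-exhaustive n ε k 2≤n 0<ε n≤k = budgeted n (<⇒≤ 2≤n)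
  (ℕ.≤-trans (ℕ.*-monoʳ-≤ n n≤k) (ℕ.m≤n*m (n ℕ.* k) 4))
  (3 ℕ.^ n) (exhaustive-queries-≤ n 2≤n) (exhaustive-tester n ε 0<ε)

budgeted-sampling : ∀ n ε k → 2 ≤ n → 1 ≤ k → k ≤ n → fromℚ (inv (0<^ (0<ι 3) k)) <ᴿ ε → BudgetedTester n ε k
budgeted-sampling n ε k 2≤n 1≤k k≤n 4⁻ᵏ<ε = build (approximate-root n k 1≤k k≤n)
  where
  square : ∀ m → m ℕ.* m ℕ.* k ≤ 4 ℕ.* n → m ℕ.* k ℕ.* (m ℕ.* k) ≤ 4 ℕ.* (n ℕ.* k)
  square m m²k≤4n = ℕ.≤-trans (ℕ.≤-reflexive (ℕ-solve 2 (λ m k → m ⊗ k ⊗ (m ⊗ k) ⊜ m ⊗ m ⊗ k ⊗ k) refl m k))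
    (ℕ.≤-trans (ℕ.*-monoˡ-≤ k m²k≤4n) (ℕ.≤-reflexive (ℕ.*-assoc 4 n k)))
  build : (∃[ m ] n ≤ suc m ℕ.* suc m ℕ.* k × suc m ℕ.* suc m ℕ.* k ≤ 4 ℕ.* n) → BudgetedTester n ε k
  build (m , n≤m²k , m²k≤4n) = budgeted (suc m ℕ.* k) (ℕ.*-mono-≤ {1} {suc m} {1} (s≤s z≤n) 1≤k)
    (square (suc m) m²k≤4n)
    ((2 ℕ.* 4 ℕ.^ k ℕ.+ 2 ℕ.* 4 ℕ.^ k) ℕ.* (1 ℕ.+ 3 ℕ.* n) ℕ.^ (suc m ℕ.* (6 ℕ.* k)))
    (sampling-queries-≤ n (suc m) k 2≤n (s≤s z≤n) 1≤k)
    (sampling-tester n ε k m 1≤k n≤m²k 4⁻ᵏ<ε)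

exp-nonNeg : ∀ z {r} → r ≤ℚ 0ℚ → fromℚ r ≤ᴿ exp z
exp-nonNeg z {r} r≤0 = lower≤fromCut (ExpCut.cut z) {r} (ExpCut.lower-nonPos z {r} r≤0)

TesterWithinBudget : ∀ n → 2 ≤ n → ∀ ε → 0ᴿ <ᴿ ε → Set
TesterWithinBudget n 2≤n ε 0<ε = ∃[ A ] IsOneSidedConvexityTester {n} ε A ×
  fromℕ (NonAdaptiveAlgorithm.queryComplexity A) ≤ᴿ 
    3^ (constant *ᴿ sqrt (fromℕ n *ᴿ ln (ε ⁻¹[ 0<ε ]) (⁻¹-positive ε 0<ε)) *ᴿ ln (fromℕ n) (fromℕ-positive n (<⇒≤ 2≤n)))

tester-large-ε : ∀ n 2≤n ε 0<ε → TesterWithin n ε 0 → TesterWithinBudget n 2≤n ε 0<ε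
tester-large-ε n 2≤n ε 0<ε (A , correct , ≤0) = A , correct , exp-nonNeg _ (ι-mono ≤0)

tester-small-ε : ∀ n 2≤n ε 0<ε k → 1 ≤ k → ε <ᴿ fromℚ (¾ ^ k) → BudgetedTester n ε k →
                 (∃[ l ] 1 ≤ l × 2 ℕ.^ l ≤ n × n ≤ 4 ℕ.^ l) → TesterWithinBudget n 2≤n ε 0<ε
tester-small-ε n 2≤n ε 0<ε k 1≤k ε<¾ᵏ (budgeted s 1≤s s²≤4nk q q≤ (A , correct , A≤q)) (l , 1≤l , 2ˡ≤n , n≤4ˡ) =
  A , correct , query-bound n 2≤n ε 0<ε k s l (NonAdaptiveAlgorithm.queryComplexity A)
    1≤k 1≤s 1≤l ε<¾ᵏ s²≤4nk 2ˡ≤n n≤4ˡ (ℕ.≤-trans A≤q q≤)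

theorem1p9 : ∃[ C ] 0ᴿ <ᴿ C × (∀ n → (2≤n : 2 ≤ n) → ∀ ε → (0<ε : 0ᴿ <ᴿ ε) → ε <ᴿ 1ᴿ →
    ∃[ A ] IsOneSidedConvexityTester {n} ε A ×
    fromℕ (NonAdaptiveAlgorithm.queryComplexity A) ≤ᴿ
    3^ (C *ᴿ sqrt (fromℕ n *ᴿ ln (ε ⁻¹[ 0<ε ]) (⁻¹-positive ε 0<ε))
    *ᴿ ln (fromℕ n) (fromℕ-positive n (<⇒≤ 2≤n))))
theorem1p9 = constant , fromℚ-< (0<p+q 0<factor 0<1) , λ n 2≤n ε 0<ε _ →
  [ (λ 5/8<ε → tester-large-ε n 2≤n ε 0<ε (blind-tester n ε 5/8<ε))
  , (λ ε<¾ →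
      let (k , 1≤k , 4⁻ᵏ<ε , ε<¾ᵏ) = logarithm-of-ε ε 0<ε ε<¾
      in tester-small-ε n 2≤n ε 0<ε k 1≤k ε<¾ᵏ
           ([ (λ k≤n → budgeted-sampling n ε k 2≤n 1≤k k≤n 4⁻ᵏ<ε) , budgeted-exhaustive n ε k 2≤n 0<ε ]′ (ℕ.≤-total k n))
           (between-2^-and-4^ n 2≤n))
  -- The overlapping thresholds 5/8 and 3/4 replace an undecidable comparison of `ε` with a single
  -- number.
  ]′ (cotransitive ε {(ℤ.+ 5) / 8} {¾} (<-by ⅛ 0<⅛ refl))
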